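{- Let $f(n)$ be the number of permutations $w\in\mathfrak S_n$ such that both $w$ and $w^{ -1}$ are alternating, and let $f^*(n)$ be the number of $w\in\mathfrak S_n$ such that $w$ is alternating and $w^{ -1}$ is reverse alternating. Let $L(t)=\frac12\log\frac{1+t}{1-t}=t+\frac{t^3}{3}+\frac{t^5}{5}+\cdots$. Then $$\sum_{k\ge0}f(2k+1)t^{2k+1}=\sum_{r\ge0}E_{2r+1}^2\frac{L(t)^{2r+1}}{(2r+1)!},\qquad f^*(2k+1)=f(2k+1),$$ $$\sum_{k\ge0}f(2k)t^{2k}=\frac{1}{\sqrt{1-t^2}}\sum_{r\ge0}E_{2r}^2\frac{L(t)^{2r}}{(2r)!},\qquad f^*(2k)=f(2k)-f(2k-2).$$
   Context: A permutation $w=a_1a_2\cdots a_n\in\mathfrak S_n$ is alternating if $a_1>a_2<a_3>a_4<\cdots$ and reverse alternating if $a_1<a_2>a_3<a_4>\cdots$. The Euler numbers $E_n$ are defined by $\sum_{n\ge0}E_nx^n/n!=\sec x+\tan x$ (so $E_n$ is the number of alternating permutations in $\mathfrak S_n$). -}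

module Defs where

open import Data.Nat as ℕ using (ℕ; zero; suc; _<_; _>_; _<?_)
open import Data.Nat.Combinatorics using (_C_)
import Data.Nat.Properties as ℕP
open import Data.Integer as ℤ using (ℤ; +_)
open import Data.Rational as ℚ using (ℚ; 0ℚ; 1ℚ; _/_)
open import Data.Fin as Fin using (Fin; toℕ)
open import Data.Fin.Properties using (all?)
open import Data.Vec as Vec using (Vec; []; _∷_; lookup)
open import Data.List as List using (List; []; _∷_; length; filter; concatMap; allFin)
open import Data.List.Relation.Unary.Any as Any using (Any)
open import Data.Product using (_×_)
open import Data.Unit using (⊤; tt)
open import Data.Bool using (Bool; true; false; if_then_else_)
open import Relation.Nullary using (Dec; yes; no)
open import Relation.Nullary.Decidable using (_×-dec_)
open import Relation.Binary.PropositionalEquality using (_≡_)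
open import Data.Fin.Properties using () renaming (_≟_ to _≟F_)

-- Permutations of [n] = {0,…,n-1}, written in one-line notation as
-- vectors w = (w 0, …, w (n-1)) of elements of Fin n.

allWords : (m n : ℕ) → List (Vec (Fin n) m)
allWords zero    n = [] ∷ []
allWords (suc m) n = concatMap (λ i → List.map (i ∷_) (allWords m n)) (allFin n)

-- u is the (two-sided) inverse of w; w ∈ 𝔖ₙ iff such u exists
IsInverse : ∀ {n} → Vec (Fin n) n → Vec (Fin n) n → Set
IsInverse w u = (∀ i → lookup u (lookup w i) ≡ i) × (∀ i → lookup w (lookup u i) ≡ i)

isInverse? : ∀ {n} (w u : Vec (Fin n) n) → Dec (IsInverse w u)
isInverse? w u = all? (λ i → lookup u (lookup w i) ≟F i) ×-dec all? (λ i → lookup w (lookup u i) ≟F i)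

mutual
  Alt : List ℕ → Set
  Alt []           = ⊤
  Alt (a ∷ [])     = ⊤
  Alt (a ∷ b ∷ xs) = (a > b) × RevAlt (b ∷ xs)

  RevAlt : List ℕ → Set
  RevAlt []           = ⊤
  RevAlt (a ∷ [])     = ⊤
  RevAlt (a ∷ b ∷ xs) = (a < b) × Alt (b ∷ xs)

mutual
  alt? : (xs : List ℕ) → Dec (Alt xs)
  alt? []           = yes tt
  alt? (a ∷ [])     = yes tt
  alt? (a ∷ b ∷ xs) = (b <? a) ×-dec revAlt? (b ∷ xs)

  revAlt? : (xs : List ℕ) → Dec (RevAlt xs)
  revAlt? []           = yes tt
  revAlt? (a ∷ [])     = yes tt
  revAlt? (a ∷ b ∷ xs) = (a <? b) ×-dec alt? (b ∷ xs)

word : ∀ {n} → Vec (Fin n) n → List ℕ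
word w = List.map toℕ (Vec.toList w)

IsAlternating : ∀ {n} → Vec (Fin n) n → Set
IsAlternating w = Alt (word w)

IsRevAlternating : ∀ {n} → Vec (Fin n) n → Set
IsRevAlternating w = RevAlt (word w)

FProp : ∀ {n} → Vec (Fin n) n → Set
FProp {n} w = Any (λ u → IsInverse w u × (IsAlternating w × IsAlternating u)) (allWords n n)

f : ℕ → ℕ
f n = length (filter (λ w → Any.any? (λ u → isInverse? w u ×-dec (alt? (word w) ×-dec alt? (word u))) (allWords n n)) (allWords n n))

f* : ℕ → ℕ
f* n = length (filter (λ w → Any.any? (λ u → isInverse? w u ×-dec (alt? (word w) ×-dec revAlt? (word u))) (allWords n n)) (allWords n n))

Series : Set
Series = ℕ → ℚ

_≋_ : Series → Series → Set
a ≋ b = ∀ n → a n ≡ b n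

infix 4 _≋_

fromℕ : ℕ → ℚ
fromℕ n = + n / 1

sumTo : ℕ → (ℕ → ℚ) → ℚ
sumTo zero    g = g 0
sumTo (suc n) g = sumTo n g ℚ.+ g (suc n)

_⋆_ : Series → Series → Series
(a ⋆ b) n = sumTo n (λ k → a k ℚ.* b (n ℕ.∸ k))

infixl 7 _⋆_

one : Series
one zero    = 1ℚ
one (suc n) = 0ℚ

_^ˢ_ : Series → ℕ → Series
a ^ˢ zero  = one
a ^ˢ suc m = a ⋆ (a ^ˢ m)

scale : ℚ → Series → Series
scale c a n = c ℚ.* a n

-- Infinite sum Σ_{r ≥ 0} g r of a family of series with ord (g r) ≥ r
-- (so that the coefficient of tⁿ only involves r ≤ n).
Σseries : (ℕ → Series) → Series
Σseries g n = sumTo n (λ r → g r n)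

evenSpread : (ℕ → ℚ) → Series
evenSpread c zero          = c 0
evenSpread c (suc zero)    = 0ℚ
evenSpread c (suc (suc n)) = evenSpread (λ k → c (suc k)) n

oddSpread : (ℕ → ℚ) → Series
oddSpread c zero          = 0ℚ
oddSpread c (suc zero)    = c 0
oddSpread c (suc (suc n)) = oddSpread (λ k → c (suc k)) n

-- L(t) = t + t³/3 + t⁵/5 + ⋯ = ½ log((1+t)/(1-t))
L : Series
L = oddSpread (λ k → + 1 / suc (2 ℕ.* k))

-- (1 - t²)^{-1/2} = Σ_k binom(2k,k)/4^k t^{2k}  (binomial series)
invSqrt1-t² : Series
invSqrt1-t² = evenSpread (λ k → _/_ (+ ((2 ℕ.* k) C k)) (4 ℕ.^ k) {{ℕP.m^n≢0 4 k}})

-- Euler numbers: Σ Eₙ xⁿ/n! = sec x + tan x = (1 + sin x) / cos x.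

invFact : ℕ → ℚ
invFact n = _/_ (+ 1) (n ℕ.!) {{n ℕP.!≢0}}

factℚ : ℕ → ℚ
factℚ n = fromℕ (n ℕ.!)

cosS : Series
cosS = evenSpread (λ k → _/_ (if isEven k then + 1 else ℤ.-[1+ 0 ]) ((2 ℕ.* k) ℕ.!) {{(2 ℕ.* k) ℕP.!≢0}})
  where
  isEven : ℕ → Bool
  isEven zero = true
  isEven (suc zero) = false
  isEven (suc (suc k)) = isEven k

sinS : Series
sinS = oddSpread (λ k → _/_ (if isEven k then + 1 else ℤ.-[1+ 0 ]) ((suc (2 ℕ.* k)) ℕ.!) {{(suc (2 ℕ.* k)) ℕP.!≢0}})
  where
  isEven : ℕ → Bool
  isEven zero = true
  isEven (suc zero) = false
  isEven (suc (suc k)) = isEven k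

-- multiplicative inverse of a series with constant term 1:
-- b₀ = 1, bₙ = - Σ_{k=1}^{n} aₖ b_{n-k}
nth : List ℚ → ℕ → ℚ
nth []       _       = 0ℚ
nth (x ∷ xs) zero    = x
nth (x ∷ xs) (suc i) = nth xs i

invPrefix : Series → ℕ → List ℚ
invPrefix a zero    = 1ℚ ∷ []
invPrefix a (suc n) = p List.++ (ℚ.- sumTo n (λ k → a (suc k) ℚ.* nth p (n ℕ.∸ k)) ∷ [])
  where p = invPrefix a n

inv₁ : Series → Series
inv₁ a n = nth (invPrefix a n) n

secTan : Series
secTan = (one ⊕ sinS) ⋆ inv₁ cosS
  where
  _⊕_ : Series → Series → Series
  (a ⊕ b) n = a n ℚ.+ b n

E : ℕ → ℚ
E n = factℚ n ℚ.* secTan n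

{-# OPTIONS --safe #-}
-- Insert the letters 0, 1, 2, … of w one after the other into a partial word whose gaps
-- await larger letters: since w is alternating, a new letter k either fills a gap (a peak)
-- or splits it in two (a valley). With p gaps to the left and q to the right of the last
-- letter, the order of k and k + 1 in w, that is the alternation of w⁻¹, says whether the next
-- move is to the right or to the left, so f and f* count alternating products of two
-- transfer operators. Their sum forgets the position and is governed by D, the operator
-- D T = 1 + T² of tan (acting on tan or on sec). Inclusion–exclusion over runs of equal
-- moves expresses the counts through the operators c_k that insert k letters from left to
-- right, and Σ c_k xᵏ = exp(arctan(x) D), up to a factor (1 + x²)^(±1/2) in even length,
-- because both sides satisfy the same linear differential equation. At x = i t this is
-- exp(i L(t) D), hence the generating functions are tan(L D) tan and sec(L D) sec at 0.
module Submission where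

open import Defs

-- The squares have two sources. One factor E_r is the coefficient E_r/r! of tan or sec, expanded as
-- a function of the operator `L(t) D`; the other is what `D` yields when applied r times to tan or
-- sec and evaluated at 0. For this, a function u of the number of gaps is read as the coefficient
-- sequence of Σ u_m T^m in odd length and of sec · Σ u_m T^m in even length, with T = tan; `D` is
-- then differentiation. The arctangent comes from tangent addition: a run of right moves turns T
-- into (T + x)/(1 - T x). An end gap needs a valley next to it. In even length the right end of an
-- alternating word is one; in odd length both ends are peaks, so reverse complements are counted
-- instead. Everything stays over ℚ: powers of i become the signs `σ`, and the parity of degrees
-- separates real from imaginary parts. No operator series is inverted: differential equations are
-- compared coefficientwise after multiplication by 1 ± t², and the quotients sin/cos and 1/cos of
-- operators are recognised as unique solutions of convolution recurrences.

module GeneratingFunctions where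

  open import Data.Nat as ℕ using (ℕ; zero; suc; 2+; _≤_; _<_; z≤n; s≤s; NonZero; _∸_)
  import Data.Nat.Properties as ℕP
  open import Data.Nat.Combinatorics using (_C_; nCk≡n!/k![n-k]!; k![n∸k]!∣n!)
  open import Data.Nat.DivMod using (m/n*n≡m)
  open import Data.Nat.Induction using (<-rec)
  open import Data.Integer as ℤ using (ℤ)
  import Data.Integer.Properties as ℤP
  open import Data.Rational as ℚ using (ℚ; 0ℚ; 1ℚ; _/_; _+_; _*_; _-_; -_)
  import Data.Rational.Properties as ℚP
  open import Data.Rational.Unnormalised as ℚᵘ using (mkℚᵘ; *≡*)
  import Data.Rational.Unnormalised.Properties as ℚᵘP
  open import Data.List using (List; []; _∷_; length; _++_)
  import Data.List.Properties as ListP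
  open import Data.Product using (_×_; _,_; proj₁; proj₂)
  open import Relation.Nullary.Decidable using (dec⇒maybe)
  open import Relation.Binary.PropositionalEquality using (_≡_; refl; sym; trans; cong; cong₂; subst; module ≡-Reasoning)
  open import Tactic.RingSolver using (solve-∀)
  open import Tactic.RingSolver.Core.AlmostCommutativeRing using (AlmostCommutativeRing; fromCommutativeRing)

  open ≡-Reasoning

  ℚ-ring : AlmostCommutativeRing _ _
  ℚ-ring = fromCommutativeRing ℚP.+-*-commutativeRing (λ x → dec⇒maybe (0ℚ ℚP.≟ x))

  -- `ν (suc n)` unfolds to `1ℚ + ν n`, so the ring solver can take ν n as a variable and prove
  -- identities between consecutive integers.
  ν : ℕ → ℚ
  ν zero    = 0ℚ
  ν (suc n) = 1ℚ + ν n

  fromℕ-suc : ∀ n → fromℕ (suc n) ≡ 1ℚ + fromℕ n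
  fromℕ-suc n = ℚP.toℚᵘ-injective (begin-≃
    ℚ.toℚᵘ (fromℕ (suc n))                 ≈⟨ ℚP.toℚᵘ-fromℚᵘ (mkℚᵘ (ℤ.+ suc n) 0) ⟩
    mkℚᵘ (ℤ.+ suc n) 0                       ≈⟨ *≡* (cong (ℤ._* ℤ.+ 1) (cong (ℤ._+_ (ℤ.+ 1)) (sym (ℤP.*-identityʳ (ℤ.+ n))))) ⟩
    ℚ.toℚᵘ 1ℚ ℚᵘ.+ mkℚᵘ (ℤ.+ n) 0            ≈⟨ ℚᵘP.+-congʳ (ℚ.toℚᵘ 1ℚ) (ℚᵘP.≃-sym (ℚP.toℚᵘ-fromℚᵘ (mkℚᵘ (ℤ.+ n) 0))) ⟩
    ℚ.toℚᵘ 1ℚ ℚᵘ.+ ℚ.toℚᵘ (fromℕ n)        ≈⟨ ℚᵘP.≃-sym (ℚP.toℚᵘ-homo-+ 1ℚ (fromℕ n)) ⟩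
    ℚ.toℚᵘ (1ℚ + fromℕ n)                  ∎≃)
    where open ℚᵘP.≃-Reasoning renaming (begin_ to begin-≃_; _∎ to _∎≃)

  fromℕ≡ν : ∀ n → fromℕ n ≡ ν n
  fromℕ≡ν zero    = refl
  fromℕ≡ν (suc n) = trans (fromℕ-suc n) (cong (1ℚ +_) (fromℕ≡ν n))

  /-*-cancel : ∀ z d .{{_ : NonZero d}} → (z / d) * fromℕ d ≡ z / 1
  /-*-cancel z (suc d) = ℚP.toℚᵘ-injective (begin-≃
    ℚ.toℚᵘ ((z / suc d) * fromℕ (suc d))               ≈⟨ ℚP.toℚᵘ-homo-* (z / suc d) (fromℕ (suc d)) ⟩
    ℚ.toℚᵘ (z / suc d) ℚᵘ.* ℚ.toℚᵘ (fromℕ (suc d))     ≈⟨ ℚᵘP.*-cong (ℚP.toℚᵘ-fromℚᵘ (mkℚᵘ z d)) (ℚP.toℚᵘ-fromℚᵘ (mkℚᵘ (ℤ.+ suc d) 0)) ⟩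
    mkℚᵘ z d ℚᵘ.* mkℚᵘ (ℤ.+ suc d) 0                     ≈⟨ *≡* (trans (ℤP.*-identityʳ _) (cong (z ℤ.*_) (cong ℤ.+_ (sym (ℕP.*-identityʳ (suc d)))))) ⟩
    mkℚᵘ z 0                                           ≈⟨ ℚᵘP.≃-sym (ℚP.toℚᵘ-fromℚᵘ (mkℚᵘ z 0)) ⟩
    ℚ.toℚᵘ (z / 1)                                     ∎≃)
    where open ℚᵘP.≃-Reasoning renaming (begin_ to begin-≃_; _∎ to _∎≃)

  ν-+ : ∀ m n → ν (m ℕ.+ n) ≡ ν m + ν n
  ν-+ zero    n = sym (ℚP.+-identityˡ (ν n))
  ν-+ (suc m) n = trans (cong (1ℚ +_) (ν-+ m n)) (sym (ℚP.+-assoc 1ℚ (ν m) (ν n)))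

  ν-* : ∀ m n → ν (m ℕ.* n) ≡ ν m * ν n
  ν-* zero    n = sym (ℚP.*-zeroˡ (ν n))
  ν-* (suc m) n = trans (ν-+ n (m ℕ.* n)) (trans (cong (ν n +_) (ν-* m n)) (lemma (ν m) (ν n)))
    where
    lemma : ∀ x y → y + x * y ≡ (1ℚ + x) * y
    lemma = solve-∀ ℚ-ring

  ν-suc≢0 : ∀ n → ℚ.NonZero (ν (suc n))
  ν-suc≢0 n = subst ℚ.NonZero (fromℕ≡ν (suc n)) (ℚ.>-nonZero (ℚP.positive⁻¹ (fromℕ (suc n)) {{ℚP.normalize-pos (suc n) 1}}))

  ν-cancel : ∀ n {x y} → ν (suc n) * x ≡ ν (suc n) * y → x ≡ y
  ν-cancel n {x} {y} p = trans (sym (undo x)) (trans (cong (r *_) p) (undo y))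
    where
    instance
      _ = ν-suc≢0 n
    r = ℚ.1/ ν (suc n)
    undo : ∀ z → r * (ν (suc n) * z) ≡ z
    undo z = trans (sym (ℚP.*-assoc r (ν (suc n)) z))
      (trans (cong (_* z) (ℚP.*-inverseˡ (ν (suc n)))) (ℚP.*-identityˡ z))

  -- Finite sums

  sumTo-cong : ∀ n {g h : ℕ → ℚ} → (∀ k → k ≤ n → g k ≡ h k) → sumTo n g ≡ sumTo n h
  sumTo-cong zero    p = p 0 z≤n
  sumTo-cong (suc n) p = cong₂ _+_ (sumTo-cong n (λ k k≤n → p k (ℕP.m≤n⇒m≤1+n k≤n))) (p (suc n) ℕP.≤-refl)

  sumTo-ext : ∀ n {g h : ℕ → ℚ} → (∀ k → g k ≡ h k) → sumTo n g ≡ sumTo n h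
  sumTo-ext n p = sumTo-cong n (λ k _ → p k)

  +-interchange : ∀ a b c d → (a + b) + (c + d) ≡ (a + c) + (b + d)
  +-interchange = solve-∀ ℚ-ring

  sumTo-+ : ∀ n (g h : ℕ → ℚ) → sumTo n (λ k → g k + h k) ≡ sumTo n g + sumTo n h
  sumTo-+ zero    g h = refl
  sumTo-+ (suc n) g h = trans (cong (_+ (g (suc n) + h (suc n))) (sumTo-+ n g h)) (+-interchange (sumTo n g) (sumTo n h) (g (suc n)) (h (suc n)))

  sumTo-*ˡ : ∀ n c (g : ℕ → ℚ) → sumTo n (λ k → c * g k) ≡ c * sumTo n g
  sumTo-*ˡ zero    c g = refl
  sumTo-*ˡ (suc n) c g = trans (cong (_+ c * g (suc n)) (sumTo-*ˡ n c g)) (sym (ℚP.*-distribˡ-+ c (sumTo n g) (g (suc n))))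

  sumTo-*ʳ : ∀ n c (g : ℕ → ℚ) → sumTo n (λ k → g k * c) ≡ sumTo n g * c
  sumTo-*ʳ n c g = trans (sumTo-ext n (λ k → ℚP.*-comm (g k) c)) (trans (sumTo-*ˡ n c g) (ℚP.*-comm c (sumTo n g)))

  sumTo-0 : ∀ n → sumTo n (λ _ → 0ℚ) ≡ 0ℚ
  sumTo-0 zero    = refl
  sumTo-0 (suc n) = trans (cong (_+ 0ℚ) (sumTo-0 n)) refl

  sumTo-≡0 : ∀ n {g : ℕ → ℚ} → (∀ k → k ≤ n → g k ≡ 0ℚ) → sumTo n g ≡ 0ℚ
  sumTo-≡0 n p = trans (sumTo-cong n p) (sumTo-0 n)

  sumTo-head : ∀ n (g : ℕ → ℚ) → sumTo (suc n) g ≡ g 0 + sumTo n (λ k → g (suc k))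
  sumTo-head zero    g = refl
  sumTo-head (suc n) g = trans (cong (_+ g (2+ n)) (sumTo-head n g)) (ℚP.+-assoc (g 0) _ _)

  sumTo-reverse : ∀ n (g : ℕ → ℚ) → sumTo n g ≡ sumTo n (λ k → g (n ∸ k))
  sumTo-reverse zero    g = refl
  sumTo-reverse (suc n) g = begin
    sumTo n g + g (suc n)                        ≡⟨ ℚP.+-comm (sumTo n g) (g (suc n)) ⟩
    g (suc n) + sumTo n g                        ≡⟨ cong (g (suc n) +_) (sumTo-reverse n g) ⟩
    g (suc n) + sumTo n (λ k → g (n ∸ k))        ≡⟨ sym (sumTo-head n (λ k → g (suc n ∸ k))) ⟩
    sumTo (suc n) (λ k → g (suc n ∸ k))          ∎

  sumTo-swap : ∀ m n (a : ℕ → ℕ → ℚ) → sumTo m (λ i → sumTo n (λ j → a i j)) ≡ sumTo n (λ j → sumTo m (λ i → a i j))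
  sumTo-swap zero    n a = refl
  sumTo-swap (suc m) n a = trans (cong (_+ sumTo n (a (suc m))) (sumTo-swap m n a)) (sym (sumTo-+ n _ _))

  -- Both sides run over the triangle i + j ≤ n, once by rows and once by antidiagonals.
  sumTo-triangle : ∀ n (a : ℕ → ℕ → ℚ) →
    sumTo n (λ i → sumTo (n ∸ i) (a i)) ≡ sumTo n (λ N → sumTo N (λ i → a i (N ∸ i)))
  sumTo-triangle zero    a = refl
  sumTo-triangle (suc n) a = begin
    sumTo (suc n) (λ i → sumTo (suc n ∸ i) (a i))
      ≡⟨ sumTo-head n _ ⟩
    sumTo (suc n) (a 0) + sumTo n (λ i → sumTo (n ∸ i) (a (suc i)))
      ≡⟨ cong₂ _+_ (sumTo-head n (a 0)) (sumTo-triangle n (λ i → a (suc i))) ⟩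
    (a 0 0 + sumTo n (λ N → a 0 (suc N))) + sumTo n (λ N → sumTo N (λ i → a (suc i) (N ∸ i)))
      ≡⟨ ℚP.+-assoc (a 0 0) _ _ ⟩
    a 0 0 + (sumTo n (λ N → a 0 (suc N)) + sumTo n (λ N → sumTo N (λ i → a (suc i) (N ∸ i))))
      ≡⟨ cong (a 0 0 +_) (sym (sumTo-+ n _ _)) ⟩
    a 0 0 + sumTo n (λ N → a 0 (suc N) + sumTo N (λ i → a (suc i) (N ∸ i)))
      ≡⟨ cong (a 0 0 +_) (sumTo-ext n (λ N → sym (sumTo-head N (λ i → a i (suc N ∸ i))))) ⟩
    a 0 0 + sumTo n (λ N → sumTo (suc N) (λ i → a i (suc N ∸ i)))
      ≡⟨ sym (sumTo-head n _) ⟩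
    sumTo (suc n) (λ N → sumTo N (λ i → a i (N ∸ i))) ∎

  sumTo-truncate : ∀ m d (g : ℕ → ℚ) → (∀ k → m < k → g k ≡ 0ℚ) → sumTo (d ℕ.+ m) g ≡ sumTo m g
  sumTo-truncate m zero    g p = refl
  sumTo-truncate m (suc d) g p = trans (cong₂ _+_ (sumTo-truncate m d g p) (p _ (s≤s (ℕP.m≤n+m m d)))) (ℚP.+-identityʳ _)

  sumTo-extend : ∀ {m n} (g : ℕ → ℚ) → m ≤ n → (∀ k → m < k → g k ≡ 0ℚ) → sumTo n g ≡ sumTo m g
  sumTo-extend {m} {n} g m≤n p = trans (cong (λ N → sumTo N g) (sym (ℕP.m∸n+n≡m m≤n))) (sumTo-truncate m (n ∸ m) g p)

  -- Formal power series

  ≋-refl : ∀ {a} → a ≋ a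
  ≋-refl n = refl

  ≋-sym : ∀ {a b} → a ≋ b → b ≋ a
  ≋-sym p n = sym (p n)

  ≋-trans : ∀ {a b c} → a ≋ b → b ≋ c → a ≋ c
  ≋-trans p q n = trans (p n) (q n)

  _⊞_ : Series → Series → Series
  (a ⊞ b) n = a n + b n

  infixl 6 _⊞_

  ⊞-cong : ∀ {a b c d} → a ≋ b → c ≋ d → a ⊞ c ≋ b ⊞ d
  ⊞-cong p q n = cong₂ _+_ (p n) (q n)

  ⋆-cong : ∀ {a b c d} → a ≋ b → c ≋ d → a ⋆ c ≋ b ⋆ d
  ⋆-cong p q n = sumTo-ext n (λ k → cong₂ _*_ (p k) (q (n ∸ k)))

  ⋆-comm : ∀ a b → a ⋆ b ≋ b ⋆ a
  ⋆-comm a b n = trans (sumTo-reverse n _) (sumTo-cong n (λ k k≤n →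
    trans (cong (λ i → a (n ∸ k) * b i) (ℕP.m∸[m∸n]≡n k≤n)) (ℚP.*-comm (a (n ∸ k)) (b k))))

  ⋆-assoc : ∀ a b c → (a ⋆ b) ⋆ c ≋ a ⋆ (b ⋆ c)
  ⋆-assoc a b c n = sym (begin
    sumTo n (λ i → a i * sumTo (n ∸ i) (λ j → b j * c (n ∸ i ∸ j)))
      ≡⟨ sumTo-ext n (λ i → sym (sumTo-*ˡ (n ∸ i) (a i) _)) ⟩
    sumTo n (λ i → sumTo (n ∸ i) (λ j → a i * (b j * c (n ∸ i ∸ j))))
      ≡⟨ sumTo-triangle n _ ⟩
    sumTo n (λ N → sumTo N (λ i → a i * (b (N ∸ i) * c (n ∸ i ∸ (N ∸ i)))))
      ≡⟨ sumTo-ext n (λ N → sumTo-cong N (λ i i≤N → trans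
           (cong (λ k → a i * (b (N ∸ i) * c k)) (trans (ℕP.∸-+-assoc n i (N ∸ i)) (cong (n ∸_) (ℕP.m+[n∸m]≡n i≤N))))
           (sym (ℚP.*-assoc (a i) (b (N ∸ i)) (c (n ∸ N)))))) ⟩
    sumTo n (λ N → sumTo N (λ i → a i * b (N ∸ i) * c (n ∸ N)))
      ≡⟨ sumTo-ext n (λ N → sumTo-*ʳ N (c (n ∸ N)) _) ⟩
    sumTo n (λ N → sumTo N (λ i → a i * b (N ∸ i)) * c (n ∸ N)) ∎)

  ⋆-distribʳ-⊞ : ∀ a b c → (a ⊞ b) ⋆ c ≋ (a ⋆ c) ⊞ (b ⋆ c)
  ⋆-distribʳ-⊞ a b c n = trans (sumTo-ext n (λ k → ℚP.*-distribʳ-+ (c (n ∸ k)) (a k) (b k))) (sumTo-+ n _ _)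

  ⋆-distribˡ-⊞ : ∀ a b c → a ⋆ (b ⊞ c) ≋ (a ⋆ b) ⊞ (a ⋆ c)
  ⋆-distribˡ-⊞ a b c n = trans (sumTo-ext n (λ k → ℚP.*-distribˡ-+ (a k) (b (n ∸ k)) (c (n ∸ k)))) (sumTo-+ n _ _)

  ⋆-scaleˡ : ∀ q a b → scale q a ⋆ b ≋ scale q (a ⋆ b)
  ⋆-scaleˡ q a b n = trans (sumTo-ext n (λ k → ℚP.*-assoc q (a k) (b (n ∸ k)))) (sumTo-*ˡ n q _)

  ⋆-scaleʳ : ∀ q a b → a ⋆ scale q b ≋ scale q (a ⋆ b)
  ⋆-scaleʳ q a b = ≋-trans (⋆-comm a (scale q b)) (≋-trans (⋆-scaleˡ q b a) (λ n → cong (q *_) (⋆-comm b a n)))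

  ⋆-identityˡ : ∀ a → one ⋆ a ≋ a
  ⋆-identityˡ a zero    = ℚP.*-identityˡ (a 0)
  ⋆-identityˡ a (suc n) = begin
    sumTo (suc n) (λ k → one k * a (suc n ∸ k))       ≡⟨ sumTo-head n _ ⟩
    1ℚ * a (suc n) + sumTo n (λ k → 0ℚ * a (n ∸ k))   ≡⟨ cong₂ _+_ (ℚP.*-identityˡ (a (suc n))) (sumTo-≡0 n (λ k _ → ℚP.*-zeroˡ (a (n ∸ k)))) ⟩
    a (suc n) + 0ℚ                                    ≡⟨ ℚP.+-identityʳ _ ⟩
    a (suc n)                                         ∎

  ⋆-identityʳ : ∀ a → a ⋆ one ≋ a
  ⋆-identityʳ a = ≋-trans (⋆-comm a one) (⋆-identityˡ a)

  shift : Series → Series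
  shift a zero    = 0ℚ
  shift a (suc n) = a n

  shift-cong : ∀ {a b} → a ≋ b → shift a ≋ shift b
  shift-cong p zero    = refl
  shift-cong p (suc n) = p n

  shift-⋆ : ∀ a b → shift a ⋆ b ≋ shift (a ⋆ b)
  shift-⋆ a b zero    = ℚP.*-zeroˡ (b 0)
  shift-⋆ a b (suc n) = trans (sumTo-head n _) (trans (cong (_+ (a ⋆ b) n) (ℚP.*-zeroˡ (b (suc n)))) (ℚP.+-identityˡ _))

  -- Multiplication by 1 - t².
  J : Series → Series
  J a n = a n - shift (shift a) n

  J-cong : ∀ {a b} → a ≋ b → J a ≋ J b
  J-cong p n = cong₂ _-_ (p n) (shift-cong (shift-cong p) n)

  J-⋆ : ∀ a b → J a ⋆ b ≋ J (a ⋆ b)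
  J-⋆ a b n = begin
    sumTo n (λ k → (a k - shift (shift a) k) * b (n ∸ k))
      ≡⟨ sumTo-ext n (λ k → lemma (a k) (shift (shift a) k) (b (n ∸ k))) ⟩
    sumTo n (λ k → a k * b (n ∸ k) + - 1ℚ * (shift (shift a) k * b (n ∸ k)))
      ≡⟨ trans (sumTo-+ n _ _) (cong ((a ⋆ b) n +_) (sumTo-*ˡ n (- 1ℚ) _)) ⟩
    (a ⋆ b) n + - 1ℚ * (shift (shift a) ⋆ b) n
      ≡⟨ lemma′ ((a ⋆ b) n) _ ⟩
    (a ⋆ b) n - (shift (shift a) ⋆ b) n
      ≡⟨ cong (λ z → (a ⋆ b) n - z) (≋-trans (shift-⋆ (shift a) b) (shift-cong (shift-⋆ a b)) n) ⟩
    (a ⋆ b) n - shift (shift (a ⋆ b)) n ∎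
    where
    lemma : ∀ x y z → (x - y) * z ≡ x * z + - 1ℚ * (y * z)
    lemma = solve-∀ ℚ-ring
    lemma′ : ∀ x y → x + - 1ℚ * y ≡ x - y
    lemma′ = solve-∀ ℚ-ring

  ∂ : Series → Series
  ∂ a n = ν (suc n) * a (suc n)

  ∂-⋆ : ∀ a b → ∂ (a ⋆ b) ≋ (∂ a ⋆ b) ⊞ (a ⋆ ∂ b)
  ∂-⋆ a b n = begin
    ν (suc n) * sumTo (suc n) (λ k → a k * b (suc n ∸ k))
      ≡⟨ sym (sumTo-*ˡ (suc n) (ν (suc n)) _) ⟩
    sumTo (suc n) (λ k → ν (suc n) * (a k * b (suc n ∸ k)))
      ≡⟨ sumTo-cong (suc n) (λ k k≤ → trans
           (cong (_* (a k * b (suc n ∸ k))) (trans (cong ν (sym (ℕP.m+[n∸m]≡n k≤))) (ν-+ k (suc n ∸ k))))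
           (lemma (ν k) (ν (suc n ∸ k)) (a k) (b (suc n ∸ k)))) ⟩
    sumTo (suc n) (λ k → ν k * a k * b (suc n ∸ k) + a k * (ν (suc n ∸ k) * b (suc n ∸ k)))
      ≡⟨ sumTo-+ (suc n) _ _ ⟩
    sumTo (suc n) (λ k → ν k * a k * b (suc n ∸ k)) + sumTo (suc n) (λ k → a k * (ν (suc n ∸ k) * b (suc n ∸ k)))
      ≡⟨ cong₂ _+_ left right ⟩
    (∂ a ⋆ b) n + (a ⋆ ∂ b) n ∎
    where
    lemma : ∀ x y z w → (x + y) * (z * w) ≡ x * z * w + z * (y * w)
    lemma = solve-∀ ℚ-ring
    lemma₀ : ∀ x y z → 0ℚ * x * y + z ≡ z
    lemma₀ = solve-∀ ℚ-ring
    lemma₁ : ∀ x y z → z + x * (0ℚ * y) ≡ z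
    lemma₁ = solve-∀ ℚ-ring
    left : sumTo (suc n) (λ k → ν k * a k * b (suc n ∸ k)) ≡ (∂ a ⋆ b) n
    left = trans (sumTo-head n _) (lemma₀ (a 0) (b (suc n)) _)
    right : sumTo (suc n) (λ k → a k * (ν (suc n ∸ k) * b (suc n ∸ k))) ≡ (a ⋆ ∂ b) n
    right = trans (cong (sumTo n (λ k → a k * (ν (suc n ∸ k) * b (suc n ∸ k))) +_) (cong (λ i → a (suc n) * (ν i * b i)) (ℕP.n∸n≡0 n)))
              (trans (lemma₁ (a (suc n)) (b 0) _)
                (sumTo-cong n (λ k k≤n → cong (λ i → a k * (ν i * b i)) (ℕP.+-∸-assoc 1 k≤n))))

  -- Parity of degrees and signs

  double : ℕ → ℕ
  double zero    = zero
  double (suc k) = suc (suc (double k))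

  double≡2* : ∀ k → double k ≡ 2 ℕ.* k
  double≡2* zero    = refl
  double≡2* (suc k) = cong suc (trans (cong suc (double≡2* k)) (sym (ℕP.+-suc k (k ℕ.+ 0))))

  data Parity : ℕ → Set where
    even : ∀ k → Parity (double k)
    odd  : ∀ k → Parity (suc (double k))

  parity : ∀ n → Parity n
  parity zero = even 0
  parity (suc n) with parity n
  ... | even k = odd k
  ... | odd k  = even (suc k)

  evenSpread-even : ∀ c k → evenSpread c (double k) ≡ c k
  evenSpread-even c zero    = refl
  evenSpread-even c (suc k) = evenSpread-even (λ i → c (suc i)) k

  evenSpread-odd : ∀ c k → evenSpread c (suc (double k)) ≡ 0ℚ
  evenSpread-odd c zero    = refl
  evenSpread-odd c (suc k) = evenSpread-odd (λ i → c (suc i)) k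

  oddSpread-even : ∀ c k → oddSpread c (double k) ≡ 0ℚ
  oddSpread-even c zero    = refl
  oddSpread-even c (suc k) = oddSpread-even (λ i → c (suc i)) k

  oddSpread-odd : ∀ c k → oddSpread c (suc (double k)) ≡ c k
  oddSpread-odd c zero    = refl
  oddSpread-odd c (suc k) = oddSpread-odd (λ i → c (suc i)) k

  sg : ℕ → ℚ
  sg zero    = 1ℚ
  sg (suc n) = - sg n

  sg-+ : ∀ m n → sg (m ℕ.+ n) ≡ sg m * sg n
  sg-+ zero    n = sym (ℚP.*-identityˡ (sg n))
  sg-+ (suc m) n = trans (cong -_ (sg-+ m n)) (ℚP.neg-distribˡ-* (sg m) (sg n))

  neg-neg : ∀ x → - - x ≡ x
  neg-neg = solve-∀ ℚ-ring

  sg-even : ∀ k → sg (double k) ≡ 1ℚ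
  sg-even zero    = refl
  sg-even (suc k) = trans (neg-neg (sg (double k))) (sg-even k)

  sg-odd : ∀ k → sg (suc (double k)) ≡ - 1ℚ
  sg-odd k = cong -_ (sg-even k)

  sg-evenSpread : ∀ c n → sg n * evenSpread c n ≡ evenSpread c n
  sg-evenSpread c n with parity n
  ... | even k = trans (cong (_* x) (sg-even k)) (ℚP.*-identityˡ x)
    where x = evenSpread c (double k)
  ... | odd k rewrite evenSpread-odd c k = ℚP.*-zeroʳ (sg (suc (double k)))

  sg-oddSpread : ∀ c n → sg n * oddSpread c n ≡ - oddSpread c n
  sg-oddSpread c n with parity n
  ... | even k rewrite oddSpread-even c k = ℚP.*-zeroʳ (sg (double k))
  ... | odd k  = trans (cong (_* x) (sg-odd k)) (sym (ℚP.neg-distribˡ-* 1ℚ x) ∙ cong -_ (ℚP.*-identityˡ x))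
    where
    x = oddSpread c (suc (double k))
    _∙_ = trans

  -- The series L and its powers

  ∂L-even : ∀ k → ∂ L (double k) ≡ 1ℚ
  ∂L-even k = begin
    ν (suc (double k)) * L (suc (double k))                  ≡⟨ cong (ν (suc (double k)) *_) (oddSpread-odd _ k) ⟩
    ν (suc (double k)) * ((ℤ.+ 1) / suc (2 ℕ.* k))           ≡⟨ cong (λ i → ν (suc i) * ((ℤ.+ 1) / suc (2 ℕ.* k))) (double≡2* k) ⟩
    ν (suc (2 ℕ.* k)) * ((ℤ.+ 1) / suc (2 ℕ.* k))            ≡⟨ ℚP.*-comm (ν (suc (2 ℕ.* k))) _ ⟩
    ((ℤ.+ 1) / suc (2 ℕ.* k)) * ν (suc (2 ℕ.* k))            ≡⟨ cong (((ℤ.+ 1) / suc (2 ℕ.* k)) *_) (sym (fromℕ≡ν (suc (2 ℕ.* k)))) ⟩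
    ((ℤ.+ 1) / suc (2 ℕ.* k)) * fromℕ (suc (2 ℕ.* k))        ≡⟨ /-*-cancel (ℤ.+ 1) (suc (2 ℕ.* k)) ⟩
    1ℚ ∎

  ∂L-odd : ∀ k → ∂ L (suc (double k)) ≡ 0ℚ
  ∂L-odd k = trans (cong (ν (suc (suc (double k))) *_) (oddSpread-even (λ k → (ℤ.+ 1) / suc (2 ℕ.* k)) (suc k))) (ℚP.*-zeroʳ (ν (suc (suc (double k)))))

  x-x≡0 : ∀ x → x - x ≡ 0ℚ
  x-x≡0 = solve-∀ ℚ-ring

  -- The defining property L′ = 1/(1 - t²), cleared of its denominator. The differential equations
  -- for functions of L are stated in the same form.
  J∂L : J (∂ L) ≋ one
  J∂L zero          = trans (cong (_- 0ℚ) (∂L-even 0)) refl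
  J∂L (suc zero)    = trans (cong (_- 0ℚ) (∂L-odd 0)) refl
  J∂L (2+ n) with parity n
  ... | even k = trans (cong₂ _-_ (∂L-even (suc k)) (∂L-even k)) refl
  ... | odd k  = trans (cong₂ _-_ (∂L-odd (suc k)) (∂L-odd k)) refl

  J-⊞ : ∀ a b → J (a ⊞ b) ≋ J a ⊞ J b
  J-⊞ a b zero          = lemma (a 0) (b 0)
    where
    lemma : ∀ x y → x + y - 0ℚ ≡ (x - 0ℚ) + (y - 0ℚ)
    lemma = solve-∀ ℚ-ring
  J-⊞ a b (suc zero)    = lemma (a 1) (b 1)
    where
    lemma : ∀ x y → x + y - 0ℚ ≡ (x - 0ℚ) + (y - 0ℚ)
    lemma = solve-∀ ℚ-ring
  J-⊞ a b (2+ n) = lemma (a (2+ n)) (b (2+ n)) (a n) (b n)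
    where
    lemma : ∀ x y z w → x + y - (z + w) ≡ (x - z) + (y - w)
    lemma = solve-∀ ℚ-ring

  ⋆-J : ∀ a b → a ⋆ J b ≋ J (a ⋆ b)
  ⋆-J a b = ≋-trans (⋆-comm a (J b)) (≋-trans (J-⋆ b a) (J-cong (⋆-comm b a)))

  J∂-⋆ : ∀ a b → J (∂ (a ⋆ b)) ≋ J (∂ a) ⋆ b ⊞ a ⋆ J (∂ b)
  J∂-⋆ a b = ≋-trans (J-cong (∂-⋆ a b)) (≋-trans (J-⊞ (∂ a ⋆ b) (a ⋆ ∂ b))
    (⊞-cong (≋-sym (J-⋆ (∂ a) b)) (≋-sym (⋆-J a (∂ b)))))

  ∂-one : ∀ n → ∂ one n ≡ 0ℚ
  ∂-one n = ℚP.*-zeroʳ (ν (suc n))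

  J-0 : ∀ {a} → (∀ n → a n ≡ 0ℚ) → ∀ n → J a n ≡ 0ℚ
  J-0 p zero          = cong (_- 0ℚ) (p 0)
  J-0 p (suc zero)    = cong (_- 0ℚ) (p 1)
  J-0 p (2+ n) = cong₂ _-_ (p (2+ n)) (p n)

  ⋆-0ʳ : ∀ a {b} → (∀ n → b n ≡ 0ℚ) → ∀ n → (a ⋆ b) n ≡ 0ℚ
  ⋆-0ʳ a p n = sumTo-≡0 n (λ k _ → trans (cong (a k *_) (p (n ∸ k))) (ℚP.*-zeroʳ (a k)))

  J∂L^ : ∀ m → J (∂ (L ^ˢ suc m)) ≋ scale (ν (suc m)) (L ^ˢ m)
  J∂L^ m n = trans (J∂-⋆ L (L ^ˢ m) n) (trans (cong₂ _+_ (trans (⋆-cong J∂L (≋-refl {L ^ˢ m}) n) (⋆-identityˡ (L ^ˢ m) n)) (second m)) (lemma (ν m) ((L ^ˢ m) n)))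
    where
    lemma : ∀ x y → y + x * y ≡ (1ℚ + x) * y
    lemma = solve-∀ ℚ-ring
    second : ∀ m → (L ⋆ J (∂ (L ^ˢ m))) n ≡ ν m * (L ^ˢ m) n
    second zero    = trans (⋆-0ʳ L (J-0 {∂ one} ∂-one) n) (sym (ℚP.*-zeroˡ (one n)))
    second (suc m) = trans (⋆-cong (≋-refl {L}) (J∂L^ m) n) (⋆-scaleʳ (ν (suc m)) L (L ^ˢ m) n)

  L^-+ : ∀ m l → L ^ˢ m ⋆ L ^ˢ l ≋ L ^ˢ (m ℕ.+ l)
  L^-+ zero    l = ⋆-identityˡ (L ^ˢ l)
  L^-+ (suc m) l = ≋-trans (⋆-assoc L (L ^ˢ m) (L ^ˢ l)) (⋆-cong (≋-refl {L}) (L^-+ m l))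

  -- L has no constant term. Series in powers of L are therefore finite sums in each degree.
  L^-vanish : ∀ m n → n < m → (L ^ˢ m) n ≡ 0ℚ
  L^-vanish (suc m) n (s≤s n≤m) = sumTo-≡0 n term
    where
    term : ∀ k → k ≤ n → L k * (L ^ˢ m) (n ∸ k) ≡ 0ℚ
    term zero    _ = ℚP.*-zeroˡ ((L ^ˢ m) n)
    term (suc k) (s≤s {n = n′} k≤n′) = trans (cong (L (suc k) *_) (L^-vanish m (n′ ∸ k) (ℕP.≤-trans (s≤s (ℕP.m∸n≤m n′ k)) n≤m)))
      (ℚP.*-zeroʳ (L (suc k)))

  L^-parity : ∀ m n → sg n * (L ^ˢ m) n ≡ sg m * (L ^ˢ m) n
  L^-parity zero    zero    = refl
  L^-parity zero    (suc n) = ℚP.*-zeroʳ (sg (suc n))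
  L^-parity (suc m) n = begin
    sg n * sumTo n (λ k → L k * (L ^ˢ m) (n ∸ k))
      ≡⟨ sym (sumTo-*ˡ n (sg n) _) ⟩
    sumTo n (λ k → sg n * (L k * (L ^ˢ m) (n ∸ k)))
      ≡⟨ sumTo-cong n (λ k k≤n → term k k≤n) ⟩
    sumTo n (λ k → sg (suc m) * (L k * (L ^ˢ m) (n ∸ k)))
      ≡⟨ sumTo-*ˡ n (sg (suc m)) _ ⟩
    sg (suc m) * sumTo n (λ k → L k * (L ^ˢ m) (n ∸ k)) ∎
    where
    lemma : ∀ a b x y → (a * b) * (x * y) ≡ (a * x) * (b * y)
    lemma = solve-∀ ℚ-ring
    lemma′ : ∀ s x y → (- x) * (s * y) ≡ (- s) * (x * y)
    lemma′ = solve-∀ ℚ-ring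
    term : ∀ k → k ≤ n → sg n * (L k * (L ^ˢ m) (n ∸ k)) ≡ sg (suc m) * (L k * (L ^ˢ m) (n ∸ k))
    term k k≤n = begin
      sg n * (L k * M)                        ≡⟨ cong (λ i → sg i * (L k * M)) (sym (ℕP.m+[n∸m]≡n k≤n)) ⟩
      sg (k ℕ.+ (n ∸ k)) * (L k * M)          ≡⟨ cong (_* (L k * M)) (sg-+ k (n ∸ k)) ⟩
      (sg k * sg (n ∸ k)) * (L k * M)         ≡⟨ lemma (sg k) (sg (n ∸ k)) (L k) M ⟩
      (sg k * L k) * (sg (n ∸ k) * M)         ≡⟨ cong₂ _*_ (sg-oddSpread _ k) (L^-parity m (n ∸ k)) ⟩
      (- L k) * (sg m * M)                    ≡⟨ lemma′ (sg m) (L k) M ⟩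
      sg (suc m) * (L k * M)                  ∎
      where M = (L ^ˢ m) (n ∸ k)

  ≡neg⇒≡0 : ∀ x → x ≡ - x → x ≡ 0ℚ
  ≡neg⇒≡0 x p = ν-cancel 1 (trans (lemma x) (trans (cong (x +_) p) (trans (x-x≡0 x) (sym (ℚP.*-zeroʳ (ν 2))))))
    where
    lemma : ∀ x → (1ℚ + (1ℚ + 0ℚ)) * x ≡ x + x
    lemma = solve-∀ ℚ-ring

  L^-even-odd : ∀ m n → (L ^ˢ double m) (suc (double n)) ≡ 0ℚ
  L^-even-odd m n = ≡neg⇒≡0 x (begin
    x                             ≡⟨ sym (ℚP.*-identityˡ x) ⟩
    1ℚ * x                        ≡⟨ cong (_* x) (sym (sg-even m)) ⟩
    sg (double m) * x             ≡⟨ sym (L^-parity (double m) (suc (double n))) ⟩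
    sg (suc (double n)) * x       ≡⟨ cong (_* x) (sg-odd n) ⟩
    (- 1ℚ) * x                    ≡⟨ lemma x ⟩
    - x                           ∎)
    where
    x = (L ^ˢ double m) (suc (double n))
    lemma : ∀ x → (- 1ℚ) * x ≡ - x
    lemma = solve-∀ ℚ-ring

  L^-odd-even : ∀ m n → (L ^ˢ suc (double m)) (double n) ≡ 0ℚ
  L^-odd-even m n = ≡neg⇒≡0 x (begin
    x                             ≡⟨ sym (ℚP.*-identityˡ x) ⟩
    1ℚ * x                        ≡⟨ cong (_* x) (sym (sg-even n)) ⟩
    sg (double n) * x             ≡⟨ L^-parity (suc (double m)) (double n) ⟩
    sg (suc (double m)) * x       ≡⟨ cong (_* x) (sg-odd m) ⟩
    (- 1ℚ) * x                    ≡⟨ lemma x ⟩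
    - x                           ∎)
    where
    x = (L ^ˢ suc (double m)) (double n)
    lemma : ∀ x → (- 1ℚ) * x ≡ - x
    lemma = solve-∀ ℚ-ring

  -- Sine, cosine and Euler numbers

  invFact-! : ∀ n → invFact n * ν (n ℕ.!) ≡ 1ℚ
  invFact-! n = trans (cong (invFact n *_) (sym (fromℕ≡ν (n ℕ.!)))) (/-*-cancel (ℤ.+ 1) (n ℕ.!) {{n ℕP.!≢0}})

  inverse-unique : ∀ {x y z} → x * z ≡ 1ℚ → y * z ≡ 1ℚ → x ≡ y
  inverse-unique {x} {y} {z} p q = begin
    x             ≡⟨ sym (ℚP.*-identityʳ x) ⟩
    x * 1ℚ        ≡⟨ cong (x *_) (sym q) ⟩
    x * (y * z)   ≡⟨ lemma x y z ⟩
    y * (x * z)   ≡⟨ cong (y *_) p ⟩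
    y * 1ℚ        ≡⟨ ℚP.*-identityʳ y ⟩
    y             ∎
    where
    lemma : ∀ x y z → x * (y * z) ≡ y * (x * z)
    lemma = solve-∀ ℚ-ring

  invFact-suc : ∀ n → ν (suc n) * invFact (suc n) ≡ invFact n
  invFact-suc n = inverse-unique {z = ν (n ℕ.!)} (begin
    ν (suc n) * invFact (suc n) * ν (n ℕ.!)     ≡⟨ lemma (ν (suc n)) (invFact (suc n)) (ν (n ℕ.!)) ⟩
    invFact (suc n) * (ν (suc n) * ν (n ℕ.!))   ≡⟨ cong (invFact (suc n) *_) (sym (ν-* (suc n) (n ℕ.!))) ⟩
    invFact (suc n) * ν (suc n ℕ.!)             ≡⟨ invFact-! (suc n) ⟩
    1ℚ                                          ∎) (invFact-! n)
    where
    lemma : ∀ x y z → x * y * z ≡ y * (x * z)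
    lemma = solve-∀ ℚ-ring

  record SignedReciprocal (x : ℚ) (k d : ℕ) : Set where
    constructor signedReciprocal
    field
      cleared : x * fromℕ d ≡ sg k

  -- The numerators of cosS and sinS come from a local function of Defs that has
  -- no name here. Abstracting _/_ into a variable w makes them inferable, since
  -- w (? k) is then a rigid application.
  module _ (w : ℤ → (d : ℕ) → .{{NonZero d}} → ℚ) (/≡w : _/_ ≡ w)
    (d : ℕ → ℕ) (d≢0 : ∀ k → NonZero (d k))
    (z : ℕ → ℤ) (z₀ : z 0 ≡ ℤ.+ 1) (z₁ : z 1 ≡ ℤ.-[1+ 0 ]) (z₂ : ∀ k → z (2+ k) ≡ z k) where

    private
      z/1 : ∀ k → z k / 1 ≡ sg k
      z/1 zero          rewrite z₀ = refl
      z/1 (suc zero)    rewrite z₁ = refl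
      z/1 (2+ k) rewrite z₂ k = trans (z/1 k) (sym (neg-neg (sg k)))

      w-reciprocal : ∀ k → w (z k) (d k) {{d≢0 k}} * fromℕ (d k) ≡ sg k
      w-reciprocal k = trans (cong (λ (v : ℤ → (d : ℕ) → .{{NonZero d}} → ℚ) → v (z k) (d k) {{d≢0 k}} * fromℕ (d k)) (sym /≡w))
        (trans (/-*-cancel (z k) (d k) {{d≢0 k}}) (z/1 k))

    evenSpread-reciprocal : ∀ k → SignedReciprocal (evenSpread (λ k → w (z k) (d k) {{d≢0 k}}) (double k)) k (d k)
    evenSpread-reciprocal k = signedReciprocal (trans (cong (_* fromℕ (d k)) (evenSpread-even _ k)) (w-reciprocal k))

    oddSpread-reciprocal : ∀ k → SignedReciprocal (oddSpread (λ k → w (z k) (d k) {{d≢0 k}}) (suc (double k))) k (d k)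
    oddSpread-reciprocal k = signedReciprocal (trans (cong (_* fromℕ (d k)) (oddSpread-odd _ k)) (w-reciprocal k))

  cosS-reciprocal : ∀ k → SignedReciprocal (cosS (double k)) k ((2 ℕ.* k) ℕ.!)
  cosS-reciprocal k with _/_ in eq
  ... | w = evenSpread-reciprocal w eq _ (λ k → (2 ℕ.* k) ℕP.!≢0) _ refl refl (λ _ → refl) k

  sinS-reciprocal : ∀ k → SignedReciprocal (sinS (suc (double k))) k (suc (2 ℕ.* k) ℕ.!)
  sinS-reciprocal k with _/_ in eq
  ... | w = oddSpread-reciprocal w eq _ (λ k → suc (2 ℕ.* k) ℕP.!≢0) _ refl refl (λ _ → refl) k

  signedReciprocal⇒ : ∀ {x k} n → SignedReciprocal x k (n ℕ.!) → x ≡ sg k * invFact n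
  signedReciprocal⇒ {x} {k} n (signedReciprocal p) = begin
    x                              ≡⟨ sym (ℚP.*-identityʳ x) ⟩
    x * 1ℚ                         ≡⟨ cong (x *_) (sym (invFact-! n)) ⟩
    x * (invFact n * ν (n ℕ.!))    ≡⟨ lemma x (invFact n) (ν (n ℕ.!)) ⟩
    x * ν (n ℕ.!) * invFact n      ≡⟨ cong (λ y → x * y * invFact n) (sym (fromℕ≡ν (n ℕ.!))) ⟩
    x * fromℕ (n ℕ.!) * invFact n  ≡⟨ cong (_* invFact n) p ⟩
    sg k * invFact n               ∎
    where
    lemma : ∀ x y z → x * (y * z) ≡ x * z * y
    lemma = solve-∀ ℚ-ring

  cosS-even : ∀ k → cosS (double k) ≡ sg k * invFact (double k)
  cosS-even k = trans (signedReciprocal⇒ (2 ℕ.* k) (cosS-reciprocal k)) (cong (λ n → sg k * invFact n) (sym (double≡2* k)))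

  cosS-odd : ∀ k → cosS (suc (double k)) ≡ 0ℚ
  cosS-odd k = evenSpread-odd _ k

  sinS-odd : ∀ k → sinS (suc (double k)) ≡ sg k * invFact (suc (double k))
  sinS-odd k = trans (signedReciprocal⇒ (suc (2 ℕ.* k)) (sinS-reciprocal k)) (cong (λ n → sg k * invFact (suc n)) (sym (double≡2* k)))

  sinS-even : ∀ k → sinS (double k) ≡ 0ℚ
  sinS-even k = oddSpread-even _ k

  ∂cosS : ∀ n → ∂ cosS n ≡ - sinS n
  ∂cosS n with parity n
  ... | even k rewrite sinS-even k | cosS-odd k = ℚP.*-zeroʳ (ν (suc (double k)))
  ... | odd k = begin
    ν N * cosS N                  ≡⟨ cong (ν N *_) (cosS-even (suc k)) ⟩
    ν N * (- sg k * invFact N)    ≡⟨ lemma (ν N) (sg k) (invFact N) ⟩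
    - (sg k * (ν N * invFact N))  ≡⟨ cong (λ x → - (sg k * x)) (invFact-suc (suc (double k))) ⟩
    - (sg k * invFact (suc (double k)))  ≡⟨ cong -_ (sym (sinS-odd k)) ⟩
    - sinS (suc (double k)) ∎
    where
    N = suc (suc (double k))
    lemma : ∀ x y z → x * (- y * z) ≡ - (y * (x * z))
    lemma = solve-∀ ℚ-ring

  ∂sinS : ∀ n → ∂ sinS n ≡ cosS n
  ∂sinS n with parity n
  ... | odd k = trans (cong (ν (suc (suc (double k))) *_) (sinS-even (suc k))) (trans (ℚP.*-zeroʳ (ν (suc (suc (double k))))) (sym (cosS-odd k)))
  ... | even k = begin
    ν N * sinS N                  ≡⟨ cong (ν N *_) (sinS-odd k) ⟩
    ν N * (sg k * invFact N)      ≡⟨ lemma (ν N) (sg k) (invFact N) ⟩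
    sg k * (ν N * invFact N)      ≡⟨ cong (sg k *_) (invFact-suc (double k)) ⟩
    sg k * invFact (double k)     ≡⟨ sym (cosS-even k) ⟩
    cosS (double k) ∎
    where
    N = suc (double k)
    lemma : ∀ x y z → x * (y * z) ≡ y * (x * z)
    lemma = solve-∀ ℚ-ring

  nth-++ˡ : ∀ (xs ys : List ℚ) i → i < length xs → nth (xs ++ ys) i ≡ nth xs i
  nth-++ˡ (x ∷ xs) ys zero    _       = refl
  nth-++ˡ (x ∷ xs) ys (suc i) (s≤s p) = nth-++ˡ xs ys i p

  nth-++-last : ∀ (xs : List ℚ) y → nth (xs ++ y ∷ []) (length xs) ≡ y
  nth-++-last []       y = refl
  nth-++-last (x ∷ xs) y = nth-++-last xs y

  length-invPrefix : ∀ a n → length (invPrefix a n) ≡ suc n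
  length-invPrefix a zero    = refl
  length-invPrefix a (suc n) = trans (ListP.length-++ (invPrefix a n)) (trans (ℕP.+-comm (length (invPrefix a n)) 1) (cong suc (length-invPrefix a n)))

  -- Longer prefixes only append entries, so the k-th entry may be read off any prefix that reaches
  -- it.
  nth-invPrefix : ∀ a d k → nth (invPrefix a (d ℕ.+ k)) k ≡ inv₁ a k
  nth-invPrefix a zero    k = refl
  nth-invPrefix a (suc d) k = trans
    (nth-++ˡ (invPrefix a (d ℕ.+ k)) _ k (subst (k <_) (sym (length-invPrefix a (d ℕ.+ k))) (s≤s (ℕP.m≤n+m k d))))
    (nth-invPrefix a d k)

  inv₁-suc : ∀ a n → inv₁ a (suc n) ≡ - sumTo n (λ k → a (suc k) * inv₁ a (n ∸ k))
  inv₁-suc a n = begin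
    nth (invPrefix a (suc n)) (suc n)
      ≡⟨ cong (nth (invPrefix a (suc n))) (sym (length-invPrefix a n)) ⟩
    nth (invPrefix a (suc n)) (length (invPrefix a n))
      ≡⟨ nth-++-last (invPrefix a n) _ ⟩
    - sumTo n (λ k → a (suc k) * nth (invPrefix a n) (n ∸ k))
      ≡⟨ cong -_ (sumTo-cong n (λ k k≤n → cong (a (suc k) *_)
           (trans (cong (λ i → nth (invPrefix a i) (n ∸ k)) (sym (ℕP.m+[n∸m]≡n k≤n))) (nth-invPrefix a k (n ∸ k))))) ⟩
    - sumTo n (λ k → a (suc k) * inv₁ a (n ∸ k)) ∎

  ⋆-inv₁ : ∀ a → a 0 ≡ 1ℚ → a ⋆ inv₁ a ≋ one
  ⋆-inv₁ a a₀ zero    = trans (cong (_* 1ℚ) a₀) refl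
  ⋆-inv₁ a a₀ (suc n) = begin
    sumTo (suc n) (λ k → a k * inv₁ a (suc n ∸ k))   ≡⟨ sumTo-head n _ ⟩
    a 0 * inv₁ a (suc n) + S                         ≡⟨ cong₂ (λ x y → x * y + S) a₀ (inv₁-suc a n) ⟩
    1ℚ * (- S) + S                                   ≡⟨ lemma S ⟩
    0ℚ                                               ∎
    where
    S = sumTo n (λ k → a (suc k) * inv₁ a (n ∸ k))
    lemma : ∀ x → 1ℚ * (- x) + x ≡ 0ℚ
    lemma = solve-∀ ℚ-ring

  -- Later facts about `secTan` are all drawn from this product, which can be evaluated at an
  -- operator as well as at a number.
  cosS⋆secTan : cosS ⋆ secTan ≋ one ⊞ sinS
  cosS⋆secTan = ≋-trans (≋-sym (⋆-assoc cosS (one ⊞ sinS) (inv₁ cosS)))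
    (≋-trans (⋆-cong (⋆-comm cosS (one ⊞ sinS)) (≋-refl {inv₁ cosS}))
    (≋-trans (⋆-assoc (one ⊞ sinS) cosS (inv₁ cosS))
    (≋-trans (⋆-cong (≋-refl {one ⊞ sinS}) (⋆-inv₁ cosS refl)) (⋆-identityʳ (one ⊞ sinS)))))

  cosS-cancel : ∀ a b → cosS ⋆ a ≋ cosS ⋆ b → a ≋ b
  cosS-cancel a b p = ≋-trans (≋-sym (undo a)) (≋-trans (⋆-cong (≋-refl {inv₁ cosS}) p) (undo b))
    where
    undo : ∀ c → inv₁ cosS ⋆ (cosS ⋆ c) ≋ c
    undo c = ≋-trans (≋-sym (⋆-assoc (inv₁ cosS) cosS c))
      (≋-trans (⋆-cong (≋-trans (⋆-comm (inv₁ cosS) cosS) (⋆-inv₁ cosS refl)) (≋-refl {c})) (⋆-identityˡ c))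

  -- Linear operators on spaces of functions

  -- Operators are bare maps between function spaces and equality of functions is pointwise, so
  -- respect for it, `ext`, has to be a field.
  record Linear {X Y : Set} (T : (X → ℚ) → (Y → ℚ)) : Set where
    field
      ext : ∀ {u v} → (∀ x → u x ≡ v x) → ∀ y → T u y ≡ T v y
      add : ∀ u v y → T (λ x → u x + v x) y ≡ T u y + T v y
      scl : ∀ a u y → T (λ x → a * u x) y ≡ a * T u y

    sub : ∀ u v y → T (λ x → u x - v x) y ≡ T u y - T v y
    sub u v y = begin
      T (λ x → u x - v x) y             ≡⟨ ext (λ x → lemma (u x) (v x)) y ⟩
      T (λ x → u x + - 1ℚ * v x) y      ≡⟨ add u (λ x → - 1ℚ * v x) y ⟩
      T u y + T (λ x → - 1ℚ * v x) y    ≡⟨ cong (T u y +_) (scl (- 1ℚ) v y) ⟩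
      T u y + - 1ℚ * T v y              ≡⟨ sym (lemma (T u y) (T v y)) ⟩
      T u y - T v y                     ∎
      where
      lemma : ∀ x y → x - y ≡ x + - 1ℚ * y
      lemma = solve-∀ ℚ-ring

    sum : ∀ n (g : ℕ → X → ℚ) y → T (λ x → sumTo n (λ k → g k x)) y ≡ sumTo n (λ k → T (g k) y)
    sum zero    g y = refl
    sum (suc n) g y = trans (add (λ x → sumTo n (λ k → g k x)) (g (suc n)) y) (cong (_+ T (g (suc n)) y) (sum n g y))

  open Linear

  Linear-id : ∀ {X} → Linear {X} (λ u → u)
  Linear-id = record { ext = λ p → p ; add = λ _ _ _ → refl ; scl = λ _ _ _ → refl }

  Linear-∘ : ∀ {X Y Z} {T : (Y → ℚ) → (Z → ℚ)} {S : (X → ℚ) → (Y → ℚ)} → Linear T → Linear S → Linear (λ u → T (S u))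
  Linear-∘ {T = T} {S} t s = record
    { ext = λ p → ext t (ext s p)
    ; add = λ u v z → trans (ext t (add s u v) z) (add t (S u) (S v) z)
    ; scl = λ a u z → trans (ext t (scl s a u) z) (scl t a (S u) z)
    }

  iter : ∀ {A : Set} → (A → A) → ℕ → A → A
  iter T zero    x = x
  iter T (suc n) x = T (iter T n x)

  iter-suc : ∀ {A : Set} (T : A → A) n x → iter T n (T x) ≡ iter T (suc n) x
  iter-suc T zero    x = refl
  iter-suc T (suc n) x = cong T (iter-suc T n x)

  Linear-iter : ∀ {X} {T : (X → ℚ) → (X → ℚ)} → Linear T → ∀ n → Linear (iter T n)
  Linear-iter t zero    = Linear-id
  Linear-iter t (suc n) = Linear-∘ t (Linear-iter t n)

  -- Inclusion–exclusion over the runs of an alternating chain P Q P Q ⋯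

  double-+ : ∀ i j → double i ℕ.+ 2+ j ≡ suc (suc (double i ℕ.+ j))
  double-+ i j = trans (ℕP.+-suc (double i) (suc j)) (cong suc (ℕP.+-suc (double i) j))

  -- `π` forgets the position and `ι` sums over all insertions of a letter. By `P+Q` every `Q` can
  -- be traded for a free insertion minus a `P`.
  module Runs {S : Set} {P Q : (S → ℚ) → (S → ℚ)} {π : (ℕ → ℚ) → (S → ℚ)} {ι : (S → ℚ) → (ℕ → ℚ)}
    (P-linear : Linear P) (π-linear : Linear π) (ι-linear : Linear ι)
    (P+Q : ∀ V s → P V s + Q V s ≡ π (ι V) s) where

    -- The operator c_k: one free insertion followed by k - 1 moves `P`. Operators act on functions
    -- of the final state, so the outermost one is the first move.
    run : ℕ → (ℕ → ℚ) → (ℕ → ℚ)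
    run zero    u = u
    run (suc k) u = ι (iter P k (π u))

    run-linear : ∀ k → Linear (run k)
    run-linear zero    = Linear-id
    run-linear (suc k) = Linear-∘ ι-linear (Linear-∘ (Linear-iter P-linear k) π-linear)

    chain : (S → ℚ) → ℕ → (S → ℚ)
    chain V k = iter (λ V → P (Q V)) k V

    private
      tail : (S → ℚ) → ℕ → ℕ → ℕ → ℚ
      tail V j k = ι (iter P j (chain V k))

      -- `Q` becomes `π ι - P`: the first term cuts the chain after a run of j + 2 letters, the
      -- second lengthens the run.
      tail-suc : ∀ V j k m → tail V j (suc k) m ≡ run (2+ j) (ι (chain V k)) m - tail V (2+ j) k m
      tail-suc V j k m = begin
        ι (iter P j (P (Q W))) m
          ≡⟨ cong (λ Z → ι Z m) (iter-suc P j (Q W)) ⟩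
        ι (iter P (suc j) (Q W)) m
          ≡⟨ ext T-linear (λ s → trans (lemma (Q W s) (P W s)) (cong (_- P W s) (P+Q W s))) m ⟩
        ι (iter P (suc j) (λ s → π (ι W) s - P W s)) m
          ≡⟨ sub T-linear (π (ι W)) (P W) m ⟩
        run (2+ j) (ι W) m - ι (iter P (suc j) (P W)) m
          ≡⟨ cong (λ Z → run (2+ j) (ι W) m - ι Z m) (iter-suc P (suc j) W) ⟩
        run (2+ j) (ι W) m - tail V (2+ j) k m ∎
        where
        W = chain V k
        T-linear : Linear (λ Z → ι (iter P (suc j) Z))
        T-linear = Linear-∘ ι-linear (Linear-iter P-linear (suc j))
        lemma : ∀ x y → x ≡ y + x - y
        lemma = solve-∀ ℚ-ring

      tail-expand : ∀ V k j m → tail V j (suc k) m ≡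
        sumTo k (λ i → sg i * run (suc (suc (double i ℕ.+ j))) (ι (chain V (k ∸ i))) m)
          + sg (suc k) * tail V (suc (suc (double k ℕ.+ j))) 0 m
      tail-expand V zero j m = trans (tail-suc V j 0 m) (lemma (run (2+ j) (ι V) m) (tail V (2+ j) 0 m))
        where
        lemma : ∀ x y → x - y ≡ 1ℚ * x + - 1ℚ * y
        lemma = solve-∀ ℚ-ring
      tail-expand V (suc k) j m = begin
        tail V j (2+ k) m
          ≡⟨ tail-suc V j (suc k) m ⟩
        A - tail V (2+ j) (suc k) m
          ≡⟨ cong (λ z → A - z) (tail-expand V k (2+ j) m) ⟩
        A - (sumTo k (λ i → sg i * B i (double i ℕ.+ 2+ j)) + sg (suc k) * C (double k ℕ.+ 2+ j))
          ≡⟨ cong (λ z → A - z) (cong₂ _+_ (sumTo-ext k (λ i → cong (λ n → sg i * B i n) (double-+ i j))) (cong (λ n → sg (suc k) * C n) (double-+ k j))) ⟩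
        A - (sumTo k (λ i → sg i * B i (double (suc i) ℕ.+ j)) + sg (suc k) * C (double (suc k) ℕ.+ j))
          ≡⟨ lemma A (sumTo k (λ i → sg i * B i (double (suc i) ℕ.+ j))) (sg (suc k)) (C (double (suc k) ℕ.+ j)) ⟩
        (1ℚ * A + - 1ℚ * sumTo k (λ i → sg i * B i (double (suc i) ℕ.+ j))) + sg (2+ k) * C (double (suc k) ℕ.+ j)
          ≡⟨ cong (λ z → (1ℚ * A + z) + sg (2+ k) * C (double (suc k) ℕ.+ j))
               (trans (sym (sumTo-*ˡ k (- 1ℚ) _)) (sumTo-ext k (λ i → lemma′ (sg i) (B i (double (suc i) ℕ.+ j))))) ⟩
        (1ℚ * A + sumTo k (λ i → sg (suc i) * B i (double (suc i) ℕ.+ j))) + sg (2+ k) * C (double (suc k) ℕ.+ j)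
          ≡⟨ cong (_+ sg (2+ k) * C (double (suc k) ℕ.+ j)) (sym (sumTo-head k (λ i → sg i * run (suc (suc (double i ℕ.+ j))) (ι (chain V (suc k ∸ i))) m))) ⟩
        _ ∎
        where
        A = run (2+ j) (ι (chain V (suc k))) m
        B : ℕ → ℕ → ℚ
        B i n = run (2+ n) (ι (chain V (k ∸ i))) m
        C : ℕ → ℚ
        C n = tail V (2+ n) 0 m
        lemma : ∀ x y s z → x - (y + s * z) ≡ (1ℚ * x + - 1ℚ * y) + (- s) * z
        lemma = solve-∀ ℚ-ring
        lemma′ : ∀ x y → - 1ℚ * (x * y) ≡ (- x) * y
        lemma′ = solve-∀ ℚ-ring

    oddChain : (ℕ → ℚ) → ℕ → ℕ → ℚ
    oddChain v k = ι (chain (π v) k)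

    -- Read as Σ_j (-1)^j c_(2j) F_(k+1-j) = (-1)^(k+1) c_(2k+3): the even signed runs times the
    -- series of the chains are the odd signed runs, as in cos · tan = sin.
    oddChain-suc : ∀ v k m → oddChain v (suc k) m ≡
      sumTo k (λ i → sg i * run (double (suc i)) (oddChain v (k ∸ i)) m) + sg (suc k) * run (suc (double (suc k))) v m
    oddChain-suc v k m = trans (tail-expand (π v) k 0 m) (cong₂ _+_
      (sumTo-ext k (λ i → cong (λ n → sg i * run (2+ n) (oddChain v (k ∸ i)) m) (ℕP.+-identityʳ (double i))))
      (cong (λ n → sg (suc k) * run (suc (2+ n)) v m) (ℕP.+-identityʳ (double k))))

    evenChain : (ℕ → ℚ) → ℕ → ℕ → ℚ
    evenChain v zero    = v
    evenChain v (suc k) = ι (chain (P (π v)) k)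

    -- Read as Σ_j (-1)^j c_(2j) F_(k+1-j) = 0: the series of the chains inverts that of the even
    -- signed runs, as in cos · sec = 1.
    evenChain-suc : ∀ v k m → evenChain v (suc k) m ≡ sumTo k (λ i → sg i * run (double (suc i)) (evenChain v (k ∸ i)) m)
    evenChain-suc v zero m = sym (ℚP.*-identityˡ _)
    evenChain-suc v (suc k) m = begin
      ι (chain (P (π v)) (suc k)) m
        ≡⟨ tail-expand (P (π v)) k 0 m ⟩
      sumTo k (λ i → sg i * run (suc (suc (double i ℕ.+ 0))) (ι (chain (P (π v)) (k ∸ i))) m)
        + sg (suc k) * ι (iter P (suc (suc (double k ℕ.+ 0))) (P (π v))) m
        ≡⟨ cong₂ _+_
             (sumTo-cong k (λ i i≤k → cong₂ (λ n l → sg i * run (2+ n) (evenChain v l) m) (ℕP.+-identityʳ (double i)) (sym (ℕP.+-∸-assoc 1 i≤k))))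
             (cong (λ Z → sg (suc k) * ι Z m) (trans (iter-suc P (suc (suc (double k ℕ.+ 0))) (π v)) (cong (λ n → iter P (suc (2+ n)) (π v)) (ℕP.+-identityʳ (double k))))) ⟩
      sumTo k (λ i → sg i * run (double (suc i)) (evenChain v (suc k ∸ i)) m)
        + sg (suc k) * run (double (2+ k)) v m
        -- The leftover run reaches the end of the chain; since `evenChain v 0` is `v`, it is the
        -- term i = k + 1 of the sum.
        ≡⟨ cong (λ l → sumTo k (λ i → sg i * run (double (suc i)) (evenChain v (suc k ∸ i)) m) + sg (suc k) * run (double (2+ k)) (evenChain v l) m) (sym (ℕP.n∸n≡0 k)) ⟩
      sumTo (suc k) (λ i → sg i * run (double (suc i)) (evenChain v (suc k ∸ i)) m) ∎

  -- Transfer operators on states (p , q)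

  -- In odd length a partial word has a gap at both ends, in even length only at the right end.
  data System : Set where
    oddSys evenSys : System

  -- The numbers of gaps to the left and to the right of the last letter, end gaps not counted.
  State : Set
  State = ℕ × ℕ

  -- The next gap on the right is split by a valley, or filled by a peak, or passed over. In the
  -- case `zero` only the end gap is left, which can only be split.
  rightAt : (State → ℚ) → ℕ → ℕ → ℚ
  rightAt V p zero    = V (suc p , 0)
  rightAt V p (suc q) = V (suc p , suc q) + V (p , q) + rightAt V (suc p) q

  right : (State → ℚ) → (State → ℚ)
  right V (p , q) = rightAt V p q

  -- The left end gap exists in odd length only and, like the right one, can only be split.
  leftmost : System → (State → ℚ) → ℕ → ℚ
  leftmost oddSys  V q = V (0 , suc q)
  leftmost evenSys V q = 0ℚ

  leftAt : System → (State → ℚ) → ℕ → ℕ → ℚ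
  leftAt s V zero    q = leftmost s V q
  leftAt s V (suc p) q = V (suc p , suc q) + V (p , q) + leftAt s V p (suc q)

  left : System → (State → ℚ) → (State → ℚ)
  left s V (p , q) = leftAt s V p q

  -- The exponent of T in the monomial attached to a state: T^(p+q+1) in odd length, sec · T^(p+q)
  -- in even length.
  blocks : System → ℕ → ℕ
  blocks oddSys  n = suc n
  blocks evenSys n = n

  forget : System → (ℕ → ℚ) → (State → ℚ)
  forget s v (p , q) = v (blocks s (p ℕ.+ q))

  -- In odd length the word without letters is a single gap that serves as both ends, hence the
  -- separate case `zero`; otherwise the last summand is the left end gap.
  insert : System → (State → ℚ) → (ℕ → ℚ)
  insert oddSys  V zero    = V (0 , 0)
  insert oddSys  V (suc m) = right V (0 , m) + V (0 , suc m)
  insert evenSys V m       = right V (0 , m)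

  -- When the last letter moves left over one gap, the two terms of that gap pass from `leftAt` to
  -- `rightAt`, so the total does not depend on the position.
  rightAt+leftAt : ∀ s V p q → rightAt V p q + leftAt s V p q ≡ insert s V (blocks s (p ℕ.+ q))
  rightAt+leftAt oddSys V zero q = refl
  rightAt+leftAt evenSys V zero q = ℚP.+-identityʳ _
  rightAt+leftAt s V (suc p) q = begin
    right V (suc p , q) + (V (suc p , suc q) + V (p , q) + left s V (p , suc q))
      ≡⟨ lemma (right V (suc p , q)) (V (suc p , suc q)) (V (p , q)) (left s V (p , suc q)) ⟩
    right V (p , suc q) + left s V (p , suc q)
      ≡⟨ rightAt+leftAt s V p (suc q) ⟩
    insert s V (blocks s (p ℕ.+ suc q))
      ≡⟨ cong (λ n → insert s V (blocks s n)) (ℕP.+-suc p q) ⟩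
    insert s V (blocks s (suc p ℕ.+ q)) ∎
    where
    lemma : ∀ r x y l → r + (x + y + l) ≡ (x + y + r) + l
    lemma = solve-∀ ℚ-ring

  right+left : ∀ s V pq → right V pq + left s V pq ≡ forget s (insert s V) pq
  right+left s V (p , q) = rightAt+leftAt s V p q

  left+right : ∀ s V pq → left s V pq + right V pq ≡ forget s (insert s V) pq
  left+right s V pq = trans (ℚP.+-comm (left s V pq) (right V pq)) (right+left s V pq)

  private
    add₃ : ∀ a b c d e f → (a + b) + (c + d) + (e + f) ≡ (a + c + e) + (b + d + f)
    add₃ = solve-∀ ℚ-ring

    scl₃ : ∀ a x y z → a * x + a * y + a * z ≡ a * (x + y + z)
    scl₃ = solve-∀ ℚ-ring

  right-linear : Linear right
  right-linear = record { ext = λ h (p , q) → e h p q ; add = λ u v (p , q) → a u v p q ; scl = λ c u (p , q) → s c u p q }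
    where
    e : ∀ {u v} → (∀ x → u x ≡ v x) → ∀ p q → rightAt u p q ≡ rightAt v p q
    e h p zero  = h (suc p , 0)
    e h p (suc q) = cong₂ _+_ (cong₂ _+_ (h (suc p , suc q)) (h (p , q))) (e h (suc p) q)
    a : ∀ u v p q → rightAt (λ x → u x + v x) p q ≡ rightAt u p q + rightAt v p q
    a u v p zero  = refl
    a u v p (suc q) = trans (cong ((u (suc p , suc q) + v (suc p , suc q)) + (u (p , q) + v (p , q)) +_) (a u v (suc p) q))
      (add₃ (u (suc p , suc q)) (v (suc p , suc q)) (u (p , q)) (v (p , q)) (right u (suc p , q)) (right v (suc p , q)))
    s : ∀ c u p q → rightAt (λ x → c * u x) p q ≡ c * rightAt u p q
    s c u p zero  = refl
    s c u p (suc q) = trans (cong (c * u (suc p , suc q) + c * u (p , q) +_) (s c u (suc p) q))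
      (scl₃ c (u (suc p , suc q)) (u (p , q)) (right u (suc p , q)))

  left-linear : ∀ s → Linear (left s)
  left-linear s = record { ext = λ h (p , q) → e h p q ; add = λ u v (p , q) → a u v p q ; scl = λ c u (p , q) → m c u p q }
    where
    e₀ : ∀ s {u v} → (∀ x → u x ≡ v x) → ∀ q → leftmost s u q ≡ leftmost s v q
    e₀ oddSys  h q = h (0 , suc q)
    e₀ evenSys h q = refl
    a₀ : ∀ s u v q → leftmost s (λ x → u x + v x) q ≡ leftmost s u q + leftmost s v q
    a₀ oddSys  u v q = refl
    a₀ evenSys u v q = refl
    m₀ : ∀ s c u q → leftmost s (λ x → c * u x) q ≡ c * leftmost s u q
    m₀ oddSys  c u q = refl
    m₀ evenSys c u q = sym (ℚP.*-zeroʳ c)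
    e : ∀ {u v} → (∀ x → u x ≡ v x) → ∀ p q → leftAt s u p q ≡ leftAt s v p q
    e h zero q = e₀ s h q
    e h (suc p) q = cong₂ _+_ (cong₂ _+_ (h (suc p , suc q)) (h (p , q))) (e h p (suc q))
    a : ∀ u v p q → leftAt s (λ x → u x + v x) p q ≡ leftAt s u p q + leftAt s v p q
    a u v zero q = a₀ s u v q
    a u v (suc p) q = trans (cong ((u (suc p , suc q) + v (suc p , suc q)) + (u (p , q) + v (p , q)) +_) (a u v p (suc q)))
      (add₃ (u (suc p , suc q)) (v (suc p , suc q)) (u (p , q)) (v (p , q)) (left s u (p , suc q)) (left s v (p , suc q)))
    m : ∀ c u p q → leftAt s (λ x → c * u x) p q ≡ c * leftAt s u p q
    m c u zero q = m₀ s c u q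
    m c u (suc p) q = trans (cong (c * u (suc p , suc q) + c * u (p , q) +_) (m c u p (suc q)))
      (scl₃ c (u (suc p , suc q)) (u (p , q)) (left s u (p , suc q)))

  forget-linear : ∀ s → Linear (forget s)
  forget-linear s = record { ext = λ h (p , q) → h _ ; add = λ _ _ _ → refl ; scl = λ _ _ _ → refl }

  insert-linear : ∀ s → Linear (insert s)
  insert-linear evenSys = record
    { ext = λ h m → ext right-linear h (0 , m) ; add = λ u v m → add right-linear u v (0 , m) ; scl = λ c u m → scl right-linear c u (0 , m) }
  insert-linear oddSys = record { ext = λ h → e h ; add = a ; scl = s }
    where
    lemma : ∀ c x y → c * x + c * y ≡ c * (x + y)
    lemma = solve-∀ ℚ-ring
    e : ∀ {u v} → (∀ x → u x ≡ v x) → ∀ y → insert oddSys u y ≡ insert oddSys v y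
    e h zero    = h (0 , 0)
    e h (suc m) = cong₂ _+_ (ext right-linear h (0 , m)) (h (0 , suc m))
    a : ∀ u v y → insert oddSys (λ x → u x + v x) y ≡ insert oddSys u y + insert oddSys v y
    a u v zero    = refl
    a u v (suc m) = trans (cong (_+ (u (0 , suc m) + v (0 , suc m))) (add right-linear u v (0 , m)))
      (+-interchange (right u (0 , m)) (right v (0 , m)) (u (0 , suc m)) (v (0 , suc m)))
    s : ∀ c u y → insert oddSys (λ x → c * u x) y ≡ c * insert oddSys u y
    s c u zero    = refl
    s c u (suc m) = trans (cong (_+ c * u (0 , suc m)) (scl right-linear c u (0 , m))) (lemma c (right u (0 , m)) (u (0 , suc m)))

  -- The number of gaps that a peak may fill, the end gaps being excluded.
  closable : System → ℕ → ℕ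
  closable oddSys  m = m ∸ 1
  closable evenSys m = m

  -- Coefficient of T^m in the derivative of Σ u_j T^j, or of sec · T^m in that of sec · Σ u_j T^j,
  -- from T′ = 1 + T² and sec′ = sec · T. At m = 0 the factor `ν (closable s m)` is 0 and removes
  -- the truncated index.
  D : System → (ℕ → ℚ) → (ℕ → ℚ)
  D s u m = ν (suc m) * u (suc m) + ν (closable s m) * u (m ∸ 1)

  D-linear : ∀ s → Linear (D s)
  D-linear s = record
    { ext = λ h m → cong₂ _+_ (cong (ν (suc m) *_) (h _)) (cong (ν (closable s m) *_) (h _))
    ; add = λ u v m → lemma (ν (suc m)) (u (suc m)) (v (suc m)) (ν (closable s m)) (u (m ∸ 1)) (v (m ∸ 1))
    ; scl = λ c u m → lemma′ c (ν (suc m)) (u (suc m)) (ν (closable s m)) (u (m ∸ 1)) }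
    where
    lemma : ∀ a x y b z w → a * (x + y) + b * (z + w) ≡ (a * x + b * z) + (a * y + b * w)
    lemma = solve-∀ ℚ-ring
    lemma′ : ∀ c a x b y → a * (c * x) + b * (c * y) ≡ c * (a * x + b * y)
    lemma′ = solve-∀ ℚ-ring

  -- W (suc k) = rightᵏ applied to a function of the number p + q, and W 0 = 0.
  -- With T the shift of v and x marking k, the generating function of W is
  -- x Tᵖ ((T + x) / (1 - T x))^q / (1 - T x).
  module Tower (v : ℕ → ℚ) where

    W : ℕ → State → ℚ
    W zero    _ = 0ℚ
    W (suc k)   = iter right k (forget evenSys v)

    -- For S = (T + x)/(1 - T x) this is S = T + x (T S + 1), multiplied by T^p S^q and the common
    -- prefactor.
    W-suc : ∀ k p q → W (suc k) (p , suc q) ≡ W (suc k) (suc p , q) + (W k (suc p , suc q) + W k (p , q))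
    W-suc zero p q = trans (cong v (ℕP.+-suc p q)) (sym (ℚP.+-identityʳ _))
    W-suc (suc k) p q = ℚP.+-comm (W (suc k) (suc p , suc q) + W (suc k) (p , q)) (W (2+ k) (suc p , q))

    -- With S = (T + x)/(1 - T x), tangent addition gives (1 + x²) ∂S/∂x = 1 + S², and T (1 + x²)/(1
    -- - T x) = S - x accounts for the denominator; for H_q = S^q/(1 - T x) this yields (1 + x²)
    -- ∂H_q/∂x + x H_q = q H_(q-1) + (q + 1) H_(q+1). The formal proof is an induction on `k` and
    -- `q` through `W-suc`.
    W-ode : ∀ k p q → ν (suc k) * W (2+ k) (p , q) + ν k * W k (p , q)
      ≡ ν q * W (suc k) (p , q ∸ 1) + ν (suc q) * W (suc k) (p , suc q)
    W-ode zero p zero = begin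
      (1ℚ + 0ℚ) * a + 0ℚ * 0ℚ              ≡⟨ lemma a (W 1 (p , 0)) ⟩
      0ℚ * W 1 (p , 0) + (1ℚ + 0ℚ) * (a + (0ℚ + 0ℚ)) ≡⟨ cong (λ z → 0ℚ * W 1 (p , 0) + (1ℚ + 0ℚ) * z) (sym (W-suc 0 p 0)) ⟩
      0ℚ * W 1 (p , 0) + (1ℚ + 0ℚ) * W 1 (p , 1) ∎
      where
      a = W 1 (suc p , 0)
      lemma : ∀ a b → (1ℚ + 0ℚ) * a + 0ℚ * 0ℚ ≡ 0ℚ * b + (1ℚ + 0ℚ) * (a + (0ℚ + 0ℚ))
      lemma = solve-∀ ℚ-ring
    W-ode (suc k) p zero = begin
      (1ℚ + ν (suc k)) * a + ν (suc k) * b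
        ≡⟨ lemma (ν k) a b c ⟩
      0ℚ * c + (1ℚ + 0ℚ) * (a + ((ν (suc k) * a + ν k * b) + b))
        ≡⟨ cong (λ z → 0ℚ * c + (1ℚ + 0ℚ) * (a + (z + b))) (trans (cong (ν (suc k) * a +_) (ν*W k)) (trans (W-ode k (suc p) zero) (lemma′ (W (suc k) (suc p , 0)) (W (suc k) (suc p , 1))))) ⟩
      0ℚ * c + (1ℚ + 0ℚ) * (a + (W (suc k) (suc p , 1) + b))
        ≡⟨ cong (λ z → 0ℚ * c + (1ℚ + 0ℚ) * z) (sym (W-suc (suc k) p 0)) ⟩
      0ℚ * c + (1ℚ + 0ℚ) * W (2+ k) (p , 1) ∎
      where
      a = W (2+ k) (suc p , 0)
      b = W (suc k) (p , 0)
      c = W (2+ k) (p , 0)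
      ν*W : ∀ k → ν k * W (suc k) (p , 0) ≡ ν k * W k (suc p , 0)
      ν*W zero    = trans (ℚP.*-zeroˡ (W 1 (p , 0))) (sym (ℚP.*-zeroˡ 0ℚ))
      ν*W (suc k) = refl
      lemma : ∀ k a b c → (1ℚ + (1ℚ + k)) * a + (1ℚ + k) * b ≡ 0ℚ * c + (1ℚ + 0ℚ) * (a + (((1ℚ + k) * a + k * b) + b))
      lemma = solve-∀ ℚ-ring
      lemma′ : ∀ x y → 0ℚ * x + (1ℚ + 0ℚ) * y ≡ y
      lemma′ = solve-∀ ℚ-ring
    W-ode zero p (suc q) = begin
      (1ℚ + 0ℚ) * W 2 (p , suc q) + 0ℚ * 0ℚ
        ≡⟨ cong (λ z → (1ℚ + 0ℚ) * z + 0ℚ * 0ℚ) (W-suc 1 p q) ⟩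
      (1ℚ + 0ℚ) * (W 2 (suc p , q) + (W 1 (suc p , suc q) + W 1 (p , q))) + 0ℚ * 0ℚ
        ≡⟨ lemma (W 2 (suc p , q)) (W 1 (suc p , suc q)) (W 1 (p , q)) ⟩
      ((1ℚ + 0ℚ) * W 2 (suc p , q) + 0ℚ * 0ℚ) + (W 1 (suc p , suc q) + W 1 (p , q))
        ≡⟨ cong (_+ (W 1 (suc p , suc q) + W 1 (p , q))) (W-ode zero (suc p) q) ⟩
      (ν q * W 1 (suc p , q ∸ 1) + ν (suc q) * W 1 (suc p , suc q)) + (W 1 (suc p , suc q) + W 1 (p , q))
        ≡⟨ cong (λ z → (z + ν (suc q) * W 1 (suc p , suc q)) + (W 1 (suc p , suc q) + W 1 (p , q))) (lower q) ⟩
      (ν q * W 1 (p , q) + ν (suc q) * W 1 (suc p , suc q)) + (W 1 (suc p , suc q) + W 1 (p , q))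
        ≡⟨ lemma′ (ν q) (W 1 (p , q)) (W 1 (suc p , suc q)) ⟩
      ν (suc q) * W 1 (p , q) + ν (2+ q) * (W 1 (suc p , suc q) + (0ℚ + 0ℚ))
        ≡⟨ cong (λ z → ν (suc q) * W 1 (p , q) + ν (2+ q) * z) (sym (W-suc 0 p (suc q))) ⟩
      ν (suc q) * W 1 (p , q) + ν (2+ q) * W 1 (p , 2+ q) ∎
      where
      lower : ∀ q → ν q * W 1 (suc p , q ∸ 1) ≡ ν q * W 1 (p , q)
      lower zero    = trans (ℚP.*-zeroˡ (W 1 (suc p , 0))) (sym (ℚP.*-zeroˡ (W 1 (p , 0))))
      lower (suc q) = cong (ν (suc q) *_) (sym (trans (W-suc 0 p q) (ℚP.+-identityʳ _)))
      lemma : ∀ a b c → (1ℚ + 0ℚ) * (a + (b + c)) + 0ℚ * 0ℚ ≡ ((1ℚ + 0ℚ) * a + 0ℚ * 0ℚ) + (b + c)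
      lemma = solve-∀ ℚ-ring
      lemma′ : ∀ q a b → (q * a + (1ℚ + q) * b) + (b + a) ≡ (1ℚ + q) * a + (1ℚ + (1ℚ + q)) * (b + (0ℚ + 0ℚ))
      lemma′ = solve-∀ ℚ-ring
    W-ode (suc k) p (suc q) = begin
      ν (2+ k) * W (3+ k) (p , suc q) + ν (suc k) * W (suc k) (p , suc q)
        ≡⟨ cong₂ (λ y z → ν (2+ k) * y + ν (suc k) * z) (W-suc (2+ k) p q) (W-suc k p q) ⟩
      ν (2+ k) * (W (3+ k) (suc p , q) + (a₂ + b₂)) + ν (suc k) * (W (suc k) (suc p , q) + (a₀ + b₀))
        ≡⟨ lemma₁ (ν k) (W (3+ k) (suc p , q)) (W (suc k) (suc p , q)) a₂ a₀ b₂ b₀ ⟩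
      ((ν (2+ k) * W (3+ k) (suc p , q) + ν (suc k) * W (suc k) (suc p , q))
        + (ν (suc k) * a₂ + ν k * a₀)) + ((ν (suc k) * b₂ + ν k * b₀) + (a₂ + a₀ + (b₂ + b₀)))
        -- The three groups are the left sides of the equation at (k + 1, p + 1, q), (k, p + 1, q +
        -- 1) and (k, p, q).
        ≡⟨ cong₂ (λ y z → y + (z + (a₂ + a₀ + (b₂ + b₀)))) (cong₂ _+_ (W-ode (suc k) (suc p) q) (W-ode k (suc p) (suc q))) (W-ode k p q) ⟩
      ((ν q * W₂ (suc p , q ∸ 1) + ν (suc q) * a₂) + (ν (suc q) * W₁ (suc p , q) + ν (2+ q) * W₁ (suc p , 2+ q)))
        + ((ν q * W₁ (p , q ∸ 1) + ν (suc q) * W₁ (p , suc q)) + (a₂ + a₀ + (b₂ + b₀)))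
        ≡⟨ lemma₂ (ν q) (W₂ (suc p , q ∸ 1)) a₂ (W₁ (suc p , q)) (W₁ (suc p , 2+ q)) (W₁ (p , q ∸ 1)) (W₁ (p , suc q)) a₀ b₂ b₀ ⟩
      ν q * (W₂ (suc p , q ∸ 1) + (W₁ (suc p , q) + W₁ (p , q ∸ 1)))
        + ((ν (suc q) * (a₂ + (W₁ (suc p , 2+ q) + W₁ (p , suc q))) + (a₂ + W₁ (suc p , 2+ q) + b₂)) + (W₁ (suc p , q) + (a₀ + b₀)))
        ≡⟨ cong₂ (λ y z → y + ((ν (suc q) * (a₂ + (W₁ (suc p , 2+ q) + W₁ (p , suc q))) + (a₂ + W₁ (suc p , 2+ q) + b₂)) + z))
             (lower q) (sym (W-suc k p q)) ⟩
      ν q * b₂ + ((ν (suc q) * (a₂ + (W₁ (suc p , 2+ q) + W₁ (p , suc q))) + (a₂ + W₁ (suc p , 2+ q) + b₂)) + W₁ (p , suc q))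
        ≡⟨ lemma₃ (ν q) b₂ a₂ (W₁ (suc p , 2+ q)) (W₁ (p , suc q)) ⟩
      ν (suc q) * b₂ + ν (2+ q) * (a₂ + (W₁ (suc p , 2+ q) + W₁ (p , suc q)))
        ≡⟨ cong (λ z → ν (suc q) * b₂ + ν (2+ q) * z) (sym (W-suc (suc k) p (suc q))) ⟩
      ν (suc q) * W₂ (p , q) + ν (2+ q) * W₂ (p , 2+ q) ∎
      where
      3+ : ℕ → ℕ
      3+ n = suc (2+ n)
      W₁ = W (suc k)
      W₂ = W (2+ k)
      a₂ = W₂ (suc p , suc q)
      a₀ = W k (suc p , suc q)
      b₂ = W₂ (p , q)
      b₀ = W k (p , q)
      lower : ∀ q → ν q * (W₂ (suc p , q ∸ 1) + (W₁ (suc p , q) + W₁ (p , q ∸ 1))) ≡ ν q * W₂ (p , q)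
      lower zero    = trans (ℚP.*-zeroˡ (W₂ (suc p , 0) + (W₁ (suc p , 0) + W₁ (p , 0)))) (sym (ℚP.*-zeroˡ (W₂ (p , 0))))
      lower (suc q) = cong (ν (suc q) *_) (sym (W-suc (suc k) p q))
      lemma₁ : ∀ k x y a₂ a₀ b₂ b₀ → (1ℚ + (1ℚ + k)) * (x + (a₂ + b₂)) + (1ℚ + k) * (y + (a₀ + b₀))
        ≡ (((1ℚ + (1ℚ + k)) * x + (1ℚ + k) * y) + ((1ℚ + k) * a₂ + k * a₀)) + (((1ℚ + k) * b₂ + k * b₀) + (a₂ + a₀ + (b₂ + b₀)))
      lemma₁ = solve-∀ ℚ-ring
      lemma₂ : ∀ q x a₂ y z w u a₀ b₂ b₀ →
        ((q * x + (1ℚ + q) * a₂) + ((1ℚ + q) * y + (1ℚ + (1ℚ + q)) * z)) + ((q * w + (1ℚ + q) * u) + (a₂ + a₀ + (b₂ + b₀)))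
        ≡ q * (x + (y + w)) + (((1ℚ + q) * (a₂ + (z + u)) + (a₂ + z + b₂)) + (y + (a₀ + b₀)))
      lemma₂ = solve-∀ ℚ-ring
      lemma₃ : ∀ q b a z u → q * b + (((1ℚ + q) * (a + (z + u)) + (a + z + b)) + u) ≡ (1ℚ + q) * b + (1ℚ + (1ℚ + q)) * (a + (z + u))
      lemma₃ = solve-∀ ℚ-ring

    -- The generating function of U (iterates of left) is that of W times 1 - T x.
    U : ℕ → State → ℚ
    U k = iter (left evenSys) k (forget evenSys v)

    U≡W : ∀ k p q → U k (q , p) ≡ W (suc k) (p , q) - W k (suc p , q)
    U≡W zero    p q = trans (cong v (ℕP.+-comm q p)) (lemma (v (p ℕ.+ q)))
      where
      lemma : ∀ x → x ≡ x - 0ℚ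
      lemma = solve-∀ ℚ-ring
    -- At this edge `left evenSys` finds no gap, while `right` still has the end gap; the subtracted
    -- term removes exactly that contribution.
    U≡W (suc k) p zero    = sym (x-x≡0 (W (suc k) (suc p , 0)))
    U≡W (suc k) p (suc q) = begin
      U k (suc q , suc p) + U k (q , p) + U (suc k) (q , suc p)
        ≡⟨ cong₂ _+_ (cong₂ _+_ (U≡W k (suc p) (suc q)) (U≡W k p q)) (U≡W (suc k) (suc p) q) ⟩
      (a - W k (2+ p , suc q)) + (W (suc k) (p , q) - W k (suc p , q)) + (W (2+ k) (suc p , q) - W (suc k) (2+ p , q))
        ≡⟨ lemma a (W k (2+ p , suc q)) (W (suc k) (p , q)) (W k (suc p , q)) (W (2+ k) (suc p , q)) (W (suc k) (2+ p , q)) ⟩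
      (W (2+ k) (suc p , q) + (a + W (suc k) (p , q))) - (W (suc k) (2+ p , q) + (W k (2+ p , suc q) + W k (suc p , q)))
        ≡⟨ cong₂ _-_ (sym (W-suc (suc k) p q)) (sym (W-suc k (suc p) q)) ⟩
      W (2+ k) (p , suc q) - a ∎
      where
      a = W (suc k) (suc p , suc q)
      lemma : ∀ a b c d e f → (a - b) + (c - d) + (e - f) ≡ (e + (a + c)) - (f + (b + d))
      lemma = solve-∀ ℚ-ring

    -- A free insertion may be split at any position. At the state `(m , 0)` all terms with first
    -- coordinate 1 cancel and only values of `W` at `(0 , m)` survive.
    insert-U : ∀ k m → insert evenSys (U k) m ≡ W (2+ k) (0 , m) + W k (0 , m)
    insert-U k m = begin
      insert evenSys (U k) m
        ≡⟨ cong (insert evenSys (U k)) (sym (ℕP.+-identityʳ m)) ⟩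
      insert evenSys (U k) (m ℕ.+ 0)
        ≡⟨ sym (right+left evenSys (U k) (m , 0)) ⟩
      U k (suc m , 0) + U (suc k) (m , 0)
        ≡⟨ cong₂ _+_ (U≡W k 0 (suc m)) (U≡W (suc k) 0 m) ⟩
      (W (suc k) (0 , suc m) - W k (1 , suc m)) + (W (2+ k) (0 , m) - W (suc k) (1 , m))
        ≡⟨ cong (λ z → (z - W k (1 , suc m)) + (W (2+ k) (0 , m) - W (suc k) (1 , m))) (W-suc k 0 m) ⟩
      ((W (suc k) (1 , m) + (W k (1 , suc m) + W k (0 , m))) - W k (1 , suc m)) + (W (2+ k) (0 , m) - W (suc k) (1 , m))
        ≡⟨ lemma (W (suc k) (1 , m)) (W k (1 , suc m)) (W k (0 , m)) (W (2+ k) (0 , m)) ⟩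
      W (2+ k) (0 , m) + W k (0 , m) ∎
      where
      lemma : ∀ a b c d → ((a + (b + c)) - b) + (d - a) ≡ d + c
      lemma = solve-∀ ℚ-ring

    -- One more index shift, with value 0 below the range, so that the formula for left runs covers
    -- length 0 too.
    W₋ : ℕ → State → ℚ
    W₋ zero    _ = 0ℚ
    W₋ (suc k)   = W k

  module OddRight  = Runs right-linear (forget-linear oddSys) (insert-linear oddSys) (right+left oddSys)
  module EvenRight = Runs right-linear (forget-linear evenSys) (insert-linear evenSys) (right+left evenSys)
  module EvenLeft  = Runs (left-linear evenSys) (forget-linear evenSys) (insert-linear evenSys) (left+right evenSys)

  EvenRight-run : ∀ k v m → EvenRight.run k v m ≡ Tower.W v (suc k) (0 , m)
  EvenRight-run zero    v m = refl
  EvenRight-run (suc k) v m = refl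

  EvenLeft-run : ∀ k v m → EvenLeft.run k v m ≡ Tower.W v (suc k) (0 , m) + Tower.W₋ v k (0 , m)
  EvenLeft-run zero    v m = sym (ℚP.+-identityʳ (v m))
  EvenLeft-run (suc k) v m = Tower.insert-U v k m

  EvenLeft-run≡EvenRight-run : ∀ k v m → EvenLeft.run (2+ k) v m ≡ EvenRight.run (2+ k) v m + EvenRight.run k v m
  EvenLeft-run≡EvenRight-run k v m = trans (EvenLeft-run (2+ k) v m) (cong (EvenRight.run (2+ k) v m +_) (sym (EvenRight-run k v m)))

  W-ode′ : ∀ v k m → ν (suc k) * Tower.W v (2+ k) (0 , m) + ν k * Tower.W v k (0 , m) ≡ D evenSys (λ m → Tower.W v (suc k) (0 , m)) m
  W-ode′ v k m = trans (Tower.W-ode v k 0 m) (ℚP.+-comm (ν m * Tower.W v (suc k) (0 , m ∸ 1)) (ν (suc m) * Tower.W v (suc k) (0 , suc m)))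

  EvenLeft-run-1 : ∀ v m → EvenLeft.run 1 v m ≡ D evenSys v m
  EvenLeft-run-1 v m = trans (EvenLeft-run 1 v m) (trans (lemma (Tower.W v 2 (0 , m))) (W-ode′ v 0 m))
    where
    lemma : ∀ x → x + 0ℚ ≡ (1ℚ + 0ℚ) * x + 0ℚ * 0ℚ
    lemma = solve-∀ ℚ-ring

  -- Coefficientwise (1 + x²) C′ - x C = D C, so left runs have the series C = (1 + x²)^(1/2)
  -- exp(arctan(x) D). The equation is the sum of two instances of `W-ode` whose indices differ by
  -- two.
  EvenLeft-run-ode : ∀ k v m → ν (2+ k) * EvenLeft.run (2+ k) v m + (ν k - 1ℚ) * EvenLeft.run k v m ≡ D evenSys (EvenLeft.run (suc k) v) m
  EvenLeft-run-ode k v m = begin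
    ν (2+ k) * EvenLeft.run (2+ k) v m + (ν k - 1ℚ) * EvenLeft.run k v m
      ≡⟨ cong₂ (λ y z → ν (2+ k) * y + (ν k - 1ℚ) * z) (EvenLeft-run (2+ k) v m) (EvenLeft-run k v m) ⟩
    ν (2+ k) * (w 3 + w 1) + (ν k - 1ℚ) * (w 1 + W₋ k (0 , m))
      ≡⟨ lemma (ν k) (w 3) (w 1) (W₋ k (0 , m)) ⟩
    (ν (2+ k) * w 3 + ν (suc k) * w 1) + (ν k * w 1 + (ν k - 1ℚ) * W₋ k (0 , m))
      ≡⟨ cong₂ _+_ (W-ode′ v (suc k) m) (lower k) ⟩
    D evenSys (λ m → W (2+ k) (0 , m)) m + D evenSys (λ m → W k (0 , m)) m
      ≡⟨ sym (add (D-linear evenSys) (λ m → W (2+ k) (0 , m)) (λ m → W k (0 , m)) m) ⟩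
    D evenSys (λ m → W (2+ k) (0 , m) + W k (0 , m)) m
      ≡⟨ ext (D-linear evenSys) (λ m → sym (EvenLeft-run (suc k) v m)) m ⟩
    D evenSys (EvenLeft.run (suc k) v) m ∎
    where
    open Tower v
    w : ℕ → ℚ
    w i = W (i ℕ.+ k) (0 , m)
    lemma : ∀ k x y z → (1ℚ + (1ℚ + k)) * (x + y) + (k - 1ℚ) * (y + z) ≡ ((1ℚ + (1ℚ + k)) * x + (1ℚ + k) * y) + (k * y + (k - 1ℚ) * z)
    lemma = solve-∀ ℚ-ring
    lemma₀ : ∀ x a b → 0ℚ * x + (0ℚ - 1ℚ) * 0ℚ ≡ a * 0ℚ + b * 0ℚ
    lemma₀ = solve-∀ ℚ-ring
    lemma₁ : ∀ x y k → (1ℚ + k) * x + (1ℚ + k - 1ℚ) * y ≡ (1ℚ + k) * x + k * y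
    lemma₁ = solve-∀ ℚ-ring
    lower : ∀ k → ν k * W (suc k) (0 , m) + (ν k - 1ℚ) * W₋ k (0 , m) ≡ D evenSys (λ m → W k (0 , m)) m
    lower zero    = lemma₀ (W 1 (0 , m)) (ν (suc m)) (ν m)
    lower (suc k) = trans (lemma₁ (W (2+ k) (0 , m)) (W k (0 , m)) (ν k)) (W-ode′ v k m)

  -- In odd length `forget` shifts the argument by one, so the tower of the shifted function
  -- applies; the second summand is the insertion into the left end gap.
  OddRight-run-suc : ∀ k v m → OddRight.run k v (suc m) ≡ Tower.W (λ n → v (suc n)) (suc k) (0 , m) + Tower.W (λ n → v (suc n)) k (0 , suc m)
  OddRight-run-suc zero    v m = sym (ℚP.+-identityʳ (v (suc m)))
  OddRight-run-suc (suc k) v m = refl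

  OddRight-run-1 : ∀ v m → OddRight.run 1 v m ≡ D oddSys v m
  OddRight-run-1 v zero    = lemma (v 1) (v 0)
    where
    lemma : ∀ x y → x ≡ (1ℚ + 0ℚ) * x + 0ℚ * y
    lemma = solve-∀ ℚ-ring
  OddRight-run-1 v (suc m) = begin
    W 2 (0 , m) + v (2+ m)
      ≡⟨ lemma (W 2 (0 , m)) (v (2+ m)) ⟩
    ((1ℚ + 0ℚ) * W 2 (0 , m) + 0ℚ * 0ℚ) + v (2+ m)
      ≡⟨ cong (_+ v (2+ m)) (Tower.W-ode v′ 0 0 m) ⟩
    (ν m * v (suc (m ∸ 1)) + ν (suc m) * v (2+ m)) + v (2+ m)
      ≡⟨ cong (λ z → (z + ν (suc m) * v (2+ m)) + v (2+ m)) (lower m) ⟩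
    (ν m * v m + ν (suc m) * v (2+ m)) + v (2+ m)
      ≡⟨ lemma′ (ν m) (v m) (v (2+ m)) ⟩
    ν (2+ m) * v (2+ m) + ν m * v m ∎
    where
    v′ : ℕ → ℚ
    v′ n = v (suc n)
    open Tower v′ using (W)
    lower : ∀ m → ν m * v (suc (m ∸ 1)) ≡ ν m * v m
    lower zero    = trans (ℚP.*-zeroˡ (v 1)) (sym (ℚP.*-zeroˡ (v 0)))
    lower (suc m) = refl
    lemma : ∀ x y → x + y ≡ ((1ℚ + 0ℚ) * x + 0ℚ * 0ℚ) + y
    lemma = solve-∀ ℚ-ring
    lemma′ : ∀ m x y → (m * x + (1ℚ + m) * y) + y ≡ (1ℚ + (1ℚ + m)) * y + m * x
    lemma′ = solve-∀ ℚ-ring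

  -- Coefficientwise (1 + x²) C′ = D C, so here C = exp(arctan(x) D) without a further factor.
  OddRight-run-ode : ∀ k v m → ν (2+ k) * OddRight.run (2+ k) v m + ν k * OddRight.run k v m ≡ D oddSys (OddRight.run (suc k) v) m
  OddRight-run-ode k v zero = begin
    ν (2+ k) * W (2+ k) (0 , 0) + ν k * OddRight.run k v 0
      ≡⟨ cong (ν (2+ k) * W (2+ k) (0 , 0) +_) (lower k) ⟩
    ν (2+ k) * W (2+ k) (0 , 0) + ν k * W k (0 , 0)
      ≡⟨ lemma (ν k) (W (2+ k) (0 , 0)) (W k (0 , 0)) ⟩
    W (2+ k) (0 , 0) + (ν (suc k) * W (2+ k) (0 , 0) + ν k * W k (0 , 0))
      ≡⟨ cong (W (2+ k) (0 , 0) +_) (Tower.W-ode v′ k 0 0) ⟩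
    W (2+ k) (0 , 0) + (0ℚ * W (suc k) (0 , 0) + (1ℚ + 0ℚ) * W (suc k) (0 , 1))
      ≡⟨ lemma′ (W (2+ k) (0 , 0)) (W (suc k) (0 , 0)) (W (suc k) (0 , 1)) ⟩
    (1ℚ + 0ℚ) * (W (2+ k) (0 , 0) + W (suc k) (0 , 1)) + 0ℚ * W (suc k) (0 , 0) ∎
    where
    v′ : ℕ → ℚ
    v′ n = v (suc n)
    open Tower v′ using (W)
    lower : ∀ k → ν k * OddRight.run k v 0 ≡ ν k * W k (0 , 0)
    lower zero    = trans (ℚP.*-zeroˡ (v 0)) (sym (ℚP.*-zeroˡ 0ℚ))
    lower (suc k) = refl
    lemma : ∀ k x y → (1ℚ + (1ℚ + k)) * x + k * y ≡ x + ((1ℚ + k) * x + k * y)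
    lemma = solve-∀ ℚ-ring
    lemma′ : ∀ x y z → x + (0ℚ * y + (1ℚ + 0ℚ) * z) ≡ (1ℚ + 0ℚ) * (x + z) + 0ℚ * y
    lemma′ = solve-∀ ℚ-ring
  OddRight-run-ode k v (suc m) = begin
    ν (2+ k) * (W (suc (2+ k)) (0 , m) + x₂) + ν k * OddRight.run k v (suc m)
      ≡⟨ cong (λ z → ν (2+ k) * (W (suc (2+ k)) (0 , m) + x₂) + ν k * z) (OddRight-run-suc k v m) ⟩
    ν (2+ k) * (W (suc (2+ k)) (0 , m) + x₂) + ν k * (y₁ + x₀)
      ≡⟨ lemma (ν k) (W (suc (2+ k)) (0 , m)) x₂ y₁ x₀ ⟩
    (ν (2+ k) * W (suc (2+ k)) (0 , m) + ν (suc k) * y₁) + ((ν (suc k) * x₂ + ν k * x₀) + (x₂ - y₁))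
      ≡⟨ cong₂ (λ a b → a + (b + (x₂ - y₁))) (Tower.W-ode v′ (suc k) 0 m) (Tower.W-ode v′ k 0 (suc m)) ⟩
    (ν m * W (2+ k) (0 , m ∸ 1) + ν (suc m) * x₂) + ((ν (suc m) * y₁ + ν (2+ m) * W (suc k) (0 , 2+ m)) + (x₂ - y₁))
      ≡⟨ lemma′ (ν m) (W (2+ k) (0 , m ∸ 1)) x₂ y₁ (W (suc k) (0 , 2+ m)) ⟩
    ν (2+ m) * (x₂ + W (suc k) (0 , 2+ m)) + ν m * (W (2+ k) (0 , m ∸ 1) + y₁)
      ≡⟨ cong (ν (2+ m) * (x₂ + W (suc k) (0 , 2+ m)) +_) (lower m) ⟩
    ν (2+ m) * OddRight.run (suc k) v (2+ m) + ν m * OddRight.run (suc k) v m ∎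
    where
    v′ : ℕ → ℚ
    v′ n = v (suc n)
    open Tower v′ using (W)
    x₂ = W (2+ k) (0 , suc m)
    x₀ = W k (0 , suc m)
    y₁ = W (suc k) (0 , m)
    lower : ∀ m → ν m * (W (2+ k) (0 , m ∸ 1) + W (suc k) (0 , m)) ≡ ν m * OddRight.run (suc k) v m
    lower zero    = trans (ℚP.*-zeroˡ (W (2+ k) (0 , 0) + W (suc k) (0 , 0))) (sym (ℚP.*-zeroˡ (OddRight.run (suc k) v 0)))
    lower (suc m) = refl
    lemma : ∀ k a x y z → (1ℚ + (1ℚ + k)) * (a + x) + k * (y + z) ≡ ((1ℚ + (1ℚ + k)) * a + (1ℚ + k) * y) + (((1ℚ + k) * x + k * z) + (x - y))
    lemma = solve-∀ ℚ-ring
    lemma′ : ∀ m a x y b → (m * a + (1ℚ + m) * x) + (((1ℚ + m) * y + (1ℚ + (1ℚ + m)) * b) + (x - y)) ≡ (1ℚ + (1ℚ + m)) * (x + b) + m * (a + y)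
    lemma′ = solve-∀ ℚ-ring

  -- The substitution x = i t in real form

  sumTo-odd : ∀ k (g : ℕ → ℚ) → (∀ j → g (suc (double j)) ≡ 0ℚ) → sumTo (suc (double k)) g ≡ sumTo k (λ j → g (double j))
  sumTo-odd zero    g h = trans (cong (g 0 +_) (h 0)) (ℚP.+-identityʳ (g 0))
  sumTo-odd (suc k) g h = trans (cong₂ (λ x y → x + g (double (suc k)) + y) (sumTo-odd k g h) (h (suc k))) (ℚP.+-identityʳ _)

  sumTo-even : ∀ k (g : ℕ → ℚ) → (∀ j → g (suc (double j)) ≡ 0ℚ) → sumTo (double k) g ≡ sumTo k (λ j → g (double j))
  sumTo-even k g h = trans (sym (ℚP.+-identityʳ _)) (trans (cong (sumTo (double k) g +_) (sym (h k))) (sumTo-odd k g h))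

  double-mono : ∀ {i j} → i ≤ j → double i ≤ double j
  double-mono z≤n     = z≤n
  double-mono (s≤s p) = s≤s (s≤s (double-mono p))

  double-∸ : ∀ {i j} → i ≤ j → double j ∸ double i ≡ double (j ∸ i)
  double-∸ z≤n     = refl
  double-∸ (s≤s p) = double-∸ p

  -- σ = 1, 1, -1, -1, 1, 1, …
  σ : ℕ → ℚ
  σ zero    = 1ℚ
  σ (suc k) = sg k * σ k

  sg²≡1 : ∀ n → sg n * sg n ≡ 1ℚ
  sg²≡1 zero    = refl
  sg²≡1 (suc n) = trans (lemma (sg n)) (sg²≡1 n)
    where
    lemma : ∀ x → (- x) * (- x) ≡ x * x
    lemma = solve-∀ ℚ-ring

  σ-suc-suc : ∀ k → σ (2+ k) ≡ - σ k
  σ-suc-suc k = trans (lemma (sg k) (σ k)) (cong (λ x → - (x * σ k)) (sg²≡1 k) ∙ cong -_ (ℚP.*-identityˡ (σ k)))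
    where
    _∙_ = trans
    lemma : ∀ x y → (- x) * (x * y) ≡ - (x * x * y)
    lemma = solve-∀ ℚ-ring

  σ-double : ∀ k → σ (double k) ≡ sg k
  σ-double zero    = refl
  σ-double (suc k) = trans (σ-suc-suc (double k)) (cong -_ (σ-double k))

  σ-suc-double : ∀ k → σ (suc (double k)) ≡ sg k
  σ-suc-double k = trans (cong₂ _*_ (sg-even k) (σ-double k)) (ℚP.*-identityˡ (sg k))

  -- exp(i y) with the factors i dropped. Nothing is lost, because cosine and sine live in degrees
  -- of different parity.
  cis : Series
  cis = cosS ⊞ sinS

  -- This is cis′(y) = cis(-y); the alternating sign takes the place of the factor i.
  ∂cis : ∀ n → ∂ cis n ≡ sg n * cis n
  ∂cis n = begin
    ν (suc n) * (cosS (suc n) + sinS (suc n))   ≡⟨ ℚP.*-distribˡ-+ (ν (suc n)) (cosS (suc n)) (sinS (suc n)) ⟩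
    ∂ cosS n + ∂ sinS n                         ≡⟨ cong₂ _+_ (∂cosS n) (∂sinS n) ⟩
    - sinS n + cosS n                           ≡⟨ cong₂ _+_ (sym (sg-oddSpread _ n)) (sym (sg-evenSpread _ n)) ⟩
    sg n * sinS n + sg n * cosS n               ≡⟨ lemma (sg n) (sinS n) (cosS n) ⟩
    sg n * (cosS n + sinS n)                    ∎
    where
    lemma : ∀ s x y → s * x + s * y ≡ s * (y + x)
    lemma = solve-∀ ℚ-ring

  J∂-suc : ∀ b k → J (∂ b) (suc k) ≡ ν (2+ k) * b (2+ k) - ν k * b k
  J∂-suc b zero    = cong (λ z → ν 2 * b 2 - z) (sym (ℚP.*-zeroˡ (b 0)))
  J∂-suc b (suc k) = refl

  iter-+ : ∀ {A : Set} (T : A → A) m n x → iter T m (iter T n x) ≡ iter T (m ℕ.+ n) x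
  iter-+ T zero    n x = refl
  iter-+ T (suc m) n x = cong T (iter-+ T m n x)

  -- ev g n is the coefficient of tⁿ in g(L(t) D).
  module Eval {D : (ℕ → ℚ) → (ℕ → ℚ)} (D-linear : Linear D) where

    ev : Series → ℕ → (ℕ → ℚ) → (ℕ → ℚ)
    ev g n u x = sumTo n (λ m → g m * (L ^ˢ m) n * iter D m u x)

    private
      Dᵐ-linear : ∀ m → Linear (iter D m)
      Dᵐ-linear = Linear-iter D-linear

      vanish : ∀ (g : Series) m n z → n < m → g m * (L ^ˢ m) n * z ≡ 0ℚ
      vanish g m n z p = trans (cong (λ y → g m * y * z) (L^-vanish m n p)) (lemma (g m) z)
        where
        lemma : ∀ x z → x * 0ℚ * z ≡ 0ℚ
        lemma = solve-∀ ℚ-ring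

    ev-extend : ∀ g {n N} u x → n ≤ N → ev g n u x ≡ sumTo N (λ m → g m * (L ^ˢ m) n * iter D m u x)
    ev-extend g {n} u x n≤N = sym (sumTo-extend _ n≤N (λ m n<m → vanish g m n (iter D m u x) n<m))

    ev-cong : ∀ {g h : Series} n u x → g ≋ h → ev g n u x ≡ ev h n u x
    ev-cong n u x p = sumTo-ext n (λ m → cong (λ y → y * (L ^ˢ m) n * iter D m u x) (p m))

    ev-⊞ : ∀ g h n u x → ev (g ⊞ h) n u x ≡ ev g n u x + ev h n u x
    ev-⊞ g h n u x = trans (sumTo-ext n (λ m → lemma (g m) (h m) ((L ^ˢ m) n) (iter D m u x))) (sumTo-+ n _ _)
      where
      lemma : ∀ a b c d → (a + b) * c * d ≡ a * c * d + b * c * d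
      lemma = solve-∀ ℚ-ring

    ev-≡0 : ∀ g n u x → (∀ m → g m * (L ^ˢ m) n ≡ 0ℚ) → ev g n u x ≡ 0ℚ
    ev-≡0 g n u x p = sumTo-≡0 n (λ m _ → trans (cong (_* iter D m u x) (p m)) (ℚP.*-zeroˡ (iter D m u x)))

    -- Powers of `D` and powers of `L` both add their exponents, so functions of the one operator
    -- `L D` multiply like power series. All sums are padded to `n` with vanishing terms so that
    -- they can be exchanged.
    ev-⋆ : ∀ g h n u x → ev (g ⋆ h) n u x ≡ sumTo n (λ i → ev g i (ev h (n ∸ i) u) x)
    ev-⋆ g h n u x = sym (begin
      sumTo n (λ i → ev g i (ev h (n ∸ i) u) x)
        ≡⟨ sumTo-cong n (λ i i≤n → ev-extend g (ev h (n ∸ i) u) x i≤n) ⟩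
      sumTo n (λ i → sumTo n (λ m → g m * (L ^ˢ m) i * iter D m (ev h (n ∸ i) u) x))
        ≡⟨ sumTo-ext n (λ i → sumTo-ext n (λ m → trans (cong (g m * (L ^ˢ m) i *_) (inner i m)) (sym (sumTo-*ˡ n (g m * (L ^ˢ m) i) _)))) ⟩
      sumTo n (λ i → sumTo n (λ m → sumTo n (λ l → g m * (L ^ˢ m) i * (h l * (L ^ˢ l) (n ∸ i) * s (m ℕ.+ l)))))
        ≡⟨ sumTo-swap n n _ ⟩
      sumTo n (λ m → sumTo n (λ i → sumTo n (λ l → g m * (L ^ˢ m) i * (h l * (L ^ˢ l) (n ∸ i) * s (m ℕ.+ l)))))
        ≡⟨ sumTo-ext n (λ m → sumTo-swap n n _) ⟩
      sumTo n (λ m → sumTo n (λ l → sumTo n (λ i → g m * (L ^ˢ m) i * (h l * (L ^ˢ l) (n ∸ i) * s (m ℕ.+ l)))))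
        ≡⟨ sumTo-ext n (λ m → sumTo-ext n (λ l → collect m l)) ⟩
      sumTo n (λ m → sumTo n (λ l → g m * h l * s (m ℕ.+ l) * (L ^ˢ (m ℕ.+ l)) n))
        ≡⟨ sumTo-ext n (λ m → sumTo-extend _ (ℕP.m∸n≤m n m) (λ l n∸m<l → trans (cong (g m * h l * s (m ℕ.+ l) *_)
             (L^-vanish (m ℕ.+ l) n (ℕP.≤-<-trans (ℕP.m≤n+m∸n n m) (ℕP.+-monoʳ-< m n∸m<l)))) (ℚP.*-zeroʳ (g m * h l * s (m ℕ.+ l))))) ⟩
      sumTo n (λ m → sumTo (n ∸ m) (λ l → g m * h l * s (m ℕ.+ l) * (L ^ˢ (m ℕ.+ l)) n))
        ≡⟨ sumTo-triangle n _ ⟩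
      sumTo n (λ N → sumTo N (λ m → g m * h (N ∸ m) * s (m ℕ.+ (N ∸ m)) * (L ^ˢ (m ℕ.+ (N ∸ m))) n))
        ≡⟨ sumTo-ext n (λ N → trans
             (sumTo-cong N (λ m m≤N → trans (cong (λ M → g m * h (N ∸ m) * s M * (L ^ˢ M) n) (ℕP.m+[n∸m]≡n m≤N)) (lemma₃ (g m * h (N ∸ m)) (s N) ((L ^ˢ N) n))))
             (trans (sumTo-*ʳ N ((L ^ˢ N) n * s N) _) (sym (ℚP.*-assoc ((g ⋆ h) N) ((L ^ˢ N) n) (s N))))) ⟩
      ev (g ⋆ h) n u x ∎)
      where
      s : ℕ → ℚ
      s N = iter D N u x
      lemma₂ : ∀ a b c d e → a * b * (c * d * e) ≡ a * c * e * (b * d)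
      lemma₂ = solve-∀ ℚ-ring
      lemma₃ : ∀ a b c → a * b * c ≡ a * (c * b)
      lemma₃ = solve-∀ ℚ-ring
      inner : ∀ i m → iter D m (ev h (n ∸ i) u) x ≡ sumTo n (λ l → h l * (L ^ˢ l) (n ∸ i) * s (m ℕ.+ l))
      inner i m = begin
        iter D m (ev h (n ∸ i) u) x
          ≡⟨ ext (Dᵐ-linear m) (λ y → ev-extend h u y (ℕP.m∸n≤m n i)) x ⟩
        iter D m (λ y → sumTo n (λ l → h l * (L ^ˢ l) (n ∸ i) * iter D l u y)) x
          ≡⟨ sum (Dᵐ-linear m) n _ x ⟩
        sumTo n (λ l → iter D m (λ y → h l * (L ^ˢ l) (n ∸ i) * iter D l u y) x)
          ≡⟨ sumTo-ext n (λ l → trans (scl (Dᵐ-linear m) (h l * (L ^ˢ l) (n ∸ i)) (iter D l u) x)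
               (cong (λ w → h l * (L ^ˢ l) (n ∸ i) * w x) (iter-+ D m l u))) ⟩
        sumTo n (λ l → h l * (L ^ˢ l) (n ∸ i) * s (m ℕ.+ l)) ∎
      collect : ∀ m l → sumTo n (λ i → g m * (L ^ˢ m) i * (h l * (L ^ˢ l) (n ∸ i) * s (m ℕ.+ l))) ≡ g m * h l * s (m ℕ.+ l) * (L ^ˢ (m ℕ.+ l)) n
      collect m l = begin
        sumTo n (λ i → g m * (L ^ˢ m) i * (h l * (L ^ˢ l) (n ∸ i) * s (m ℕ.+ l)))
          ≡⟨ sumTo-ext n (λ i → lemma₂ (g m) ((L ^ˢ m) i) (h l) ((L ^ˢ l) (n ∸ i)) (s (m ℕ.+ l))) ⟩
        sumTo n (λ i → g m * h l * s (m ℕ.+ l) * ((L ^ˢ m) i * (L ^ˢ l) (n ∸ i)))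
          ≡⟨ sumTo-*ˡ n (g m * h l * s (m ℕ.+ l)) _ ⟩
        g m * h l * s (m ℕ.+ l) * (L ^ˢ m ⋆ L ^ˢ l) n
          ≡⟨ cong (g m * h l * s (m ℕ.+ l) *_) (L^-+ m l n) ⟩
        g m * h l * s (m ℕ.+ l) * (L ^ˢ (m ℕ.+ l)) n ∎

    -- From (1 - t²) L′ = 1 and cis′(y) = cis(-y) follows (1 - t²) d/dt cis(L D) = D cis(-L D);
    -- since L is odd, the right side differs from D cis(L D) by a sign in each degree.
    ev-cis-ode : ∀ k u x → ν (2+ k) * ev cis (2+ k) u x - ν k * ev cis k u x ≡ sg (suc k) * D (ev cis (suc k) u) x
    ev-cis-ode k u x = begin
      ν (2+ k) * ev cis (2+ k) u x - ν k * ev cis k u x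
        ≡⟨ cong (λ z → ν (2+ k) * ev cis (2+ k) u x - ν k * z) (ev-extend cis u x (ℕP.m≤n⇒m≤1+n (ℕP.n≤1+n k))) ⟩
      ν (2+ k) * sumTo N (λ m → cis m * (L ^ˢ m) N * s m) - ν k * sumTo N (λ m → cis m * (L ^ˢ m) k * s m)
        ≡⟨ trans (lemma₁ (ν (2+ k)) _ (ν k) _) (cong₂ _+_ (sym (sumTo-*ˡ N (ν (2+ k)) _)) (sym (sumTo-*ˡ N (- ν k) _))) ⟩
      sumTo N (λ m → ν (2+ k) * (cis m * (L ^ˢ m) N * s m)) + sumTo N (λ m → - ν k * (cis m * (L ^ˢ m) k * s m))
        ≡⟨ sym (sumTo-+ N _ _) ⟩
      sumTo N (λ m → ν (2+ k) * (cis m * (L ^ˢ m) N * s m) + - ν k * (cis m * (L ^ˢ m) k * s m))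
        ≡⟨ sumTo-ext N (λ m → trans (lemma₂ (ν (2+ k)) (ν k) (cis m) ((L ^ˢ m) N) ((L ^ˢ m) k) (s m))
             (cong (λ z → cis m * z * s m) (sym (J∂-suc (L ^ˢ m) k)))) ⟩
      sumTo N (λ m → cis m * J (∂ (L ^ˢ m)) (suc k) * s m)
        ≡⟨ sumTo-head (suc k) _ ⟩
      cis 0 * J (∂ one) (suc k) * s 0 + sumTo (suc k) (λ m → cis (suc m) * J (∂ (L ^ˢ suc m)) (suc k) * s (suc m))
        ≡⟨ cong₂ _+_ (trans (cong (λ z → cis 0 * z * s 0) (J-0 {∂ one} ∂-one (suc k))) (lemma₀ (cis 0) (s 0)))
             (sumTo-ext (suc k) (λ m → trans (cong (λ z → cis (suc m) * z * s (suc m)) (J∂L^ m (suc k)))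
               (trans (lemma₃ (cis (suc m)) (ν (suc m)) ((L ^ˢ m) (suc k)) (s (suc m)))
                 (trans (cong (λ z → z * ((L ^ˢ m) (suc k) * s (suc m))) (∂cis m))
                   (trans (lemma₄ (sg m) (cis m) ((L ^ˢ m) (suc k)) (s (suc m)))
                     (trans (cong (λ z → cis m * z * s (suc m)) (sym (L^-parity m (suc k))))
                       (lemma₅ (cis m) (sg (suc k)) ((L ^ˢ m) (suc k)) (s (suc m))))))))) ⟩
      0ℚ + sumTo (suc k) (λ m → sg (suc k) * (cis m * (L ^ˢ m) (suc k) * s (suc m)))
        ≡⟨ trans (ℚP.+-identityˡ _) (sumTo-*ˡ (suc k) (sg (suc k)) _) ⟩
      sg (suc k) * sumTo (suc k) (λ m → cis m * (L ^ˢ m) (suc k) * s (suc m))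
        ≡⟨ cong (sg (suc k) *_) (sym (trans (sum D-linear (suc k) _ x) (sumTo-ext (suc k) (λ m → scl D-linear (cis m * (L ^ˢ m) (suc k)) (iter D m u) x)))) ⟩
      sg (suc k) * D (ev cis (suc k) u) x ∎
      where
      N = 2+ k
      s : ℕ → ℚ
      s m = iter D m u x
      lemma₀ : ∀ x z → x * 0ℚ * z ≡ 0ℚ
      lemma₀ = solve-∀ ℚ-ring
      lemma₁ : ∀ a x b y → a * x - b * y ≡ a * x + - b * y
      lemma₁ = solve-∀ ℚ-ring
      lemma₂ : ∀ a b c x y s → a * (c * x * s) + - b * (c * y * s) ≡ c * (a * x - b * y) * s
      lemma₂ = solve-∀ ℚ-ring
      lemma₃ : ∀ c n l s → c * (n * l) * s ≡ (n * c) * (l * s)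
      lemma₃ = solve-∀ ℚ-ring
      lemma₄ : ∀ g c l s → g * c * (l * s) ≡ c * (g * l) * s
      lemma₄ = solve-∀ ℚ-ring
      lemma₅ : ∀ c g l s → c * (g * l) * s ≡ g * (c * l * s)
      lemma₅ = solve-∀ ℚ-ring

    ev-cis-0 : ∀ u x → ev cis 0 u x ≡ u x
    ev-cis-0 u x = ℚP.*-identityˡ (u x)

    ev-cis-1 : ∀ u x → ev cis 1 u x ≡ D u x
    ev-cis-1 u x = lemma (u x) (D u x)
      where
      lemma : ∀ a b → 0ℚ * a + 1ℚ * b ≡ b
      lemma = solve-∀ ℚ-ring

    -- The equation gives degree k + 2 from degrees k and k + 1 after cancellation of the factor
    -- `ν (2+ k)`, so the induction carries two consecutive degrees.
    cis-unique : ∀ (u : ℕ → ℚ) (y : ℕ → ℕ → ℚ) → (∀ x → y 0 x ≡ u x) → (∀ x → y 1 x ≡ D u x) →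
      (∀ k x → ν (2+ k) * y (2+ k) x - ν k * y k x ≡ sg (suc k) * D (y (suc k)) x) →
      ∀ k x → y k x ≡ ev cis k u x
    cis-unique u y y₀ y₁ ode k = proj₁ (both k)
      where
      lemma : ∀ a b → a ≡ (a - b) + b
      lemma = solve-∀ ℚ-ring
      both : ∀ k → (∀ x → y k x ≡ ev cis k u x) × (∀ x → y (suc k) x ≡ ev cis (suc k) u x)
      both zero    = (λ x → trans (y₀ x) (sym (ev-cis-0 u x))) , (λ x → trans (y₁ x) (sym (ev-cis-1 u x)))
      both (suc k) = proj₂ (both k) , λ x → ν-cancel (suc k) (begin
        ν (2+ k) * y (2+ k) x
          ≡⟨ lemma (ν (2+ k) * y (2+ k) x) (ν k * y k x) ⟩
        (ν (2+ k) * y (2+ k) x - ν k * y k x) + ν k * y k x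
          ≡⟨ cong₂ _+_ (trans (ode k x) (trans (cong (sg (suc k) *_) (ext D-linear (proj₂ (both k)) x)) (sym (ev-cis-ode k u x)))) (cong (ν k *_) (proj₁ (both k) x)) ⟩
        (ν (2+ k) * ev cis (2+ k) u x - ν k * ev cis k u x) + ν k * ev cis k u x
          ≡⟨ sym (lemma (ν (2+ k) * ev cis (2+ k) u x) (ν k * ev cis k u x)) ⟩
        ν (2+ k) * ev cis (2+ k) u x ∎)

    cosS-even-odd : ∀ j m → cosS m * (L ^ˢ m) (suc (double j)) ≡ 0ℚ
    cosS-even-odd j m with parity m
    ... | even i = trans (cong (cosS (double i) *_) (L^-even-odd i j)) (ℚP.*-zeroʳ (cosS (double i)))
    ... | odd i  = trans (cong (_* (L ^ˢ suc (double i)) (suc (double j))) (cosS-odd i)) (ℚP.*-zeroˡ ((L ^ˢ suc (double i)) (suc (double j))))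

    sinS-odd-even : ∀ j m → sinS m * (L ^ˢ m) (double j) ≡ 0ℚ
    sinS-odd-even j m with parity m
    ... | odd i  = trans (cong (sinS (suc (double i)) *_) (L^-odd-even i j)) (ℚP.*-zeroʳ (sinS (suc (double i))))
    ... | even i = trans (cong (_* (L ^ˢ double i) (double j)) (sinS-even i)) (ℚP.*-zeroˡ ((L ^ˢ double i) (double j)))

    ev-cosS-odd : ∀ j u x → ev cosS (suc (double j)) u x ≡ 0ℚ
    ev-cosS-odd j u x = ev-≡0 cosS (suc (double j)) u x (cosS-even-odd j)

    ev-sinS-even : ∀ j u x → ev sinS (double j) u x ≡ 0ℚ
    ev-sinS-even j u x = ev-≡0 sinS (double j) u x (sinS-odd-even j)

    ev-cosS-even : ∀ j u x → ev cosS (double j) u x ≡ ev cis (double j) u x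
    ev-cosS-even j u x = sym (trans (ev-⊞ cosS sinS (double j) u x) (trans (cong (ev cosS (double j) u x +_) (ev-sinS-even j u x)) (ℚP.+-identityʳ _)))

    ev-sinS-odd : ∀ j u x → ev sinS (suc (double j)) u x ≡ ev cis (suc (double j)) u x
    ev-sinS-odd j u x = sym (trans (ev-⊞ cosS sinS (suc (double j)) u x) (trans (cong (_+ ev sinS (suc (double j)) u x) (ev-cosS-odd j u x)) (ℚP.+-identityˡ _)))

    ev-one-suc : ∀ n u x → ev one (suc n) u x ≡ 0ℚ
    ev-one-suc n u x = ev-≡0 one (suc n) u x λ { zero → refl ; (suc m) → ℚP.*-zeroˡ ((L ^ˢ suc m) (suc n)) }

    -- The odd degrees of cos · (sec + tan) = 1 + sin at the operator `L D`; the cosine contributes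
    -- in even degrees only.
    cosS-secTan-odd : ∀ k u x → sumTo k (λ j → ev cis (double j) (ev secTan (suc (double (k ∸ j))) u) x) ≡ ev cis (suc (double k)) u x
    cosS-secTan-odd k u x = begin
      sumTo k (λ j → ev cis (double j) (ev secTan (suc (double (k ∸ j))) u) x)
        ≡⟨ sumTo-cong k (λ j j≤k → trans (sym (ev-cosS-even j (ev secTan (suc (double (k ∸ j))) u) x))
             (cong (λ n → ev cosS (double j) (ev secTan n u) x) (sym (trans (ℕP.+-∸-assoc 1 (double-mono j≤k)) (cong suc (double-∸ j≤k)))))) ⟩
      sumTo k (λ j → ev cosS (double j) (ev secTan (suc (double k) ∸ double j) u) x)
        ≡⟨ sym (sumTo-odd k (λ i → ev cosS i (ev secTan (suc (double k) ∸ i) u) x) (λ j → ev-cosS-odd j (ev secTan (suc (double k) ∸ suc (double j)) u) x)) ⟩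
      sumTo (suc (double k)) (λ i → ev cosS i (ev secTan (suc (double k) ∸ i) u) x)
        ≡⟨ sym (ev-⋆ cosS secTan (suc (double k)) u x) ⟩
      ev (cosS ⋆ secTan) (suc (double k)) u x
        ≡⟨ ev-cong (suc (double k)) u x cosS⋆secTan ⟩
      ev (one ⊞ sinS) (suc (double k)) u x
        ≡⟨ ev-⊞ one sinS (suc (double k)) u x ⟩
      ev one (suc (double k)) u x + ev sinS (suc (double k)) u x
        ≡⟨ cong₂ _+_ (ev-one-suc (double k) u x) (ev-sinS-odd k u x) ⟩
      0ℚ + ev cis (suc (double k)) u x
        ≡⟨ ℚP.+-identityˡ _ ⟩
      ev cis (suc (double k)) u x ∎

    cosS-secTan-even : ∀ k u x → sumTo k (λ j → ev cis (double j) (ev secTan (double (k ∸ j)) u) x) ≡ ev one (double k) u x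
    cosS-secTan-even k u x = begin
      sumTo k (λ j → ev cis (double j) (ev secTan (double (k ∸ j)) u) x)
        ≡⟨ sumTo-cong k (λ j j≤k → trans (sym (ev-cosS-even j (ev secTan (double (k ∸ j)) u) x))
             (cong (λ n → ev cosS (double j) (ev secTan n u) x) (sym (double-∸ j≤k)))) ⟩
      sumTo k (λ j → ev cosS (double j) (ev secTan (double k ∸ double j) u) x)
        ≡⟨ sym (sumTo-even k (λ i → ev cosS i (ev secTan (double k ∸ i) u) x) (λ j → ev-cosS-odd j (ev secTan (double k ∸ suc (double j)) u) x)) ⟩
      sumTo (double k) (λ i → ev cosS i (ev secTan (double k ∸ i) u) x)
        ≡⟨ sym (ev-⋆ cosS secTan (double k) u x) ⟩
      ev (cosS ⋆ secTan) (double k) u x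
        ≡⟨ ev-cong (double k) u x cosS⋆secTan ⟩
      ev (one ⊞ sinS) (double k) u x
        ≡⟨ ev-⊞ one sinS (double k) u x ⟩
      ev one (double k) u x + ev sinS (double k) u x
        ≡⟨ trans (cong (ev one (double k) u x +_) (ev-sinS-even k u x)) (ℚP.+-identityʳ _) ⟩
      ev one (double k) u x ∎

  -- The binomial series of (1 - t²)^(-1/2)

  ν-cancel-NonZero : ∀ n .{{_ : NonZero n}} {x y} → ν n * x ≡ ν n * y → x ≡ y
  ν-cancel-NonZero (suc n) = ν-cancel n

  centralBinomial : ℕ → ℕ
  centralBinomial k = (2 ℕ.* k) C k

  centralBinomial-! : ∀ k → centralBinomial k ℕ.* (k ℕ.! ℕ.* k ℕ.!) ≡ (2 ℕ.* k) ℕ.!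
  centralBinomial-! k = begin
    centralBinomial k ℕ.* (k ℕ.! ℕ.* k ℕ.!)
      ≡⟨ cong (λ n → centralBinomial k ℕ.* (k ℕ.! ℕ.* n ℕ.!)) (sym 2k∸k≡k) ⟩
    centralBinomial k ℕ.* (k ℕ.! ℕ.* (2 ℕ.* k ∸ k) ℕ.!)
      ≡⟨ cong (ℕ._* (k ℕ.! ℕ.* (2 ℕ.* k ∸ k) ℕ.!)) (nCk≡n!/k![n-k]! k≤2k) ⟩
    ((2 ℕ.* k) ℕ.! ℕ./ (k ℕ.! ℕ.* (2 ℕ.* k ∸ k) ℕ.!)) {{nz}} ℕ.* (k ℕ.! ℕ.* (2 ℕ.* k ∸ k) ℕ.!)
      ≡⟨ m/n*n≡m {{nz}} (k![n∸k]!∣n! k≤2k) ⟩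
    (2 ℕ.* k) ℕ.! ∎
    where
    nz = k ℕP.!* (2 ℕ.* k ∸ k) !≢0
    k≤2k : k ≤ 2 ℕ.* k
    k≤2k = ℕP.m≤m+n k (k ℕ.+ 0)
    2k∸k≡k : 2 ℕ.* k ∸ k ≡ k
    2k∸k≡k = trans (ℕP.m+n∸m≡n k (k ℕ.+ 0)) (ℕP.+-identityʳ k)

  ν-double : ∀ k → ν (double k) ≡ ν k + ν k
  ν-double zero    = refl
  ν-double (suc k) = trans (cong (λ z → 1ℚ + (1ℚ + z)) (ν-double k)) (lemma (ν k))
    where
    lemma : ∀ x → 1ℚ + (1ℚ + (x + x)) ≡ (1ℚ + x) + (1ℚ + x)
    lemma = solve-∀ ℚ-ring

  -- Both sides become (2k + 2)! when multiplied by (k + 1) k!².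
  centralBinomial-suc : ∀ k → ν (suc k) * ν (centralBinomial (suc k)) ≡ (ν (suc (double k)) + ν (suc (double k))) * ν (centralBinomial k)
  centralBinomial-suc k = ν-cancel-NonZero (k ℕ.! ℕ.* k ℕ.!) {{k ℕP.!* k !≢0}} (ν-cancel k (begin
    ν (suc k) * (FF * (ν (suc k) * B′))
      ≡⟨ cong (λ z → ν (suc k) * (z * (ν (suc k) * B′))) (ν-* (k ℕ.!) (k ℕ.!)) ⟩
    ν (suc k) * (F * F * (ν (suc k) * B′))
      ≡⟨ lemma₁ (ν (suc k)) F B′ ⟩
    B′ * ((ν (suc k) * F) * (ν (suc k) * F))
      ≡⟨ cong (B′ *_) (cong₂ _*_ (sym (ν-* (suc k) (k ℕ.!))) (sym (ν-* (suc k) (k ℕ.!)))) ⟩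
    B′ * (ν (suc k ℕ.!) * ν (suc k ℕ.!))
      ≡⟨ cong (B′ *_) (sym (ν-* (suc k ℕ.!) (suc k ℕ.!))) ⟩
    B′ * ν (suc k ℕ.! ℕ.* suc k ℕ.!)
      ≡⟨ trans (sym (ν-* (centralBinomial (suc k)) _)) (cong ν (centralBinomial-! (suc k))) ⟩
    ν ((2 ℕ.* suc k) ℕ.!)
      ≡⟨ cong (λ n → ν (n ℕ.!)) (sym (double≡2* (suc k))) ⟩
    ν (suc (suc (double k)) ℕ.* (suc (double k) ℕ.* (double k) ℕ.!))
      ≡⟨ trans (ν-* (suc (suc (double k))) (suc (double k) ℕ.!)) (cong (ν (suc (suc (double k))) *_) (ν-* (suc (double k)) (double k ℕ.!))) ⟩
    ν (suc (suc (double k))) * (ν (suc (double k)) * ν ((double k) ℕ.!))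
      ≡⟨ cong₂ (λ y z → y * (ν (suc (double k)) * z)) (ν-double (suc k)) (trans (cong (λ n → ν (n ℕ.!)) (double≡2* k))
           (trans (cong ν (sym (centralBinomial-! k))) (ν-* (centralBinomial k) _))) ⟩
    (ν (suc k) + ν (suc k)) * (ν (suc (double k)) * (B * FF))
      ≡⟨ lemma₂ (ν (suc k)) (ν (suc (double k))) B FF ⟩
    ν (suc k) * (FF * ((ν (suc (double k)) + ν (suc (double k))) * B)) ∎))
    where
    F = ν (k ℕ.!)
    FF = ν (k ℕ.! ℕ.* k ℕ.!)
    B = ν (centralBinomial k)
    B′ = ν (centralBinomial (suc k))
    lemma₁ : ∀ a f b → a * (f * f * (a * b)) ≡ b * ((a * f) * (a * f))
    lemma₁ = solve-∀ ℚ-ring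
    lemma₂ : ∀ a d b f → (a + a) * (d * (b * f)) ≡ a * (f * ((d + d) * b))
    lemma₂ = solve-∀ ℚ-ring

  Q : Series
  Q = invSqrt1-t²

  Q-odd : ∀ k → Q (suc (double k)) ≡ 0ℚ
  Q-odd k = evenSpread-odd _ k

  Q-even : ∀ k → Q (double k) * ν (4 ℕ.^ k) ≡ ν (centralBinomial k)
  Q-even k = trans (cong₂ _*_ (evenSpread-even (λ k → _/_ (ℤ.+ ((2 ℕ.* k) C k)) (4 ℕ.^ k) {{ℕP.m^n≢0 4 k}}) k) (sym (fromℕ≡ν (4 ℕ.^ k))))
    (trans (/-*-cancel (ℤ.+ centralBinomial k) (4 ℕ.^ k) {{ℕP.m^n≢0 4 k}}) (fromℕ≡ν (centralBinomial k)))

  Q-suc : ∀ k → ν (double (suc k)) * Q (double (suc k)) ≡ ν (suc (double k)) * Q (double k)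
  Q-suc k = ν-cancel-NonZero (4 ℕ.^ suc k) {{ℕP.m^n≢0 4 (suc k)}} (begin
    ν (4 ℕ.^ suc k) * (ν (double (suc k)) * Q (double (suc k)))
      ≡⟨ lemma₁ (ν (4 ℕ.^ suc k)) (ν (double (suc k))) (Q (double (suc k))) ⟩
    ν (double (suc k)) * (Q (double (suc k)) * ν (4 ℕ.^ suc k))
      ≡⟨ cong₂ _*_ (ν-double (suc k)) (Q-even (suc k)) ⟩
    (ν (suc k) + ν (suc k)) * ν (centralBinomial (suc k))
      ≡⟨ lemma₂ (ν (suc k)) (ν (centralBinomial (suc k))) ⟩
    ν (suc k) * ν (centralBinomial (suc k)) + ν (suc k) * ν (centralBinomial (suc k))
      ≡⟨ cong (λ z → z + z) (trans (centralBinomial-suc k) (cong ((ν (suc (double k)) + ν (suc (double k))) *_) (sym (Q-even k)))) ⟩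
    (ν (suc (double k)) + ν (suc (double k))) * (Q (double k) * ν (4 ℕ.^ k)) + (ν (suc (double k)) + ν (suc (double k))) * (Q (double k) * ν (4 ℕ.^ k))
      ≡⟨ lemma₃ (ν (suc (double k))) (Q (double k)) (ν (4 ℕ.^ k)) ⟩
    (1ℚ + (1ℚ + (1ℚ + (1ℚ + 0ℚ)))) * ν (4 ℕ.^ k) * (ν (suc (double k)) * Q (double k))
      ≡⟨ cong (_* (ν (suc (double k)) * Q (double k))) (sym (ν-* 4 (4 ℕ.^ k))) ⟩
    ν (4 ℕ.^ suc k) * (ν (suc (double k)) * Q (double k)) ∎)
    where
    lemma₁ : ∀ a b c → a * (b * c) ≡ b * (c * a)
    lemma₁ = solve-∀ ℚ-ring
    lemma₂ : ∀ a b → (a + a) * b ≡ a * b + a * b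
    lemma₂ = solve-∀ ℚ-ring
    lemma₃ : ∀ d q f → (d + d) * (q * f) + (d + d) * (q * f) ≡ (1ℚ + (1ℚ + (1ℚ + (1ℚ + 0ℚ)))) * f * (d * q)
    lemma₃ = solve-∀ ℚ-ring

  -- The equation Q′ = t Q/(1 - t²). Multiplication by Q can thus absorb the factor by which left
  -- runs of even systems differ from cis(L D).
  J∂Q : J (∂ Q) ≋ shift Q
  J∂Q zero = trans (cong (λ z → ν 1 * z - 0ℚ) (Q-odd 0)) refl
  J∂Q (suc n) = trans (J∂-suc Q n) (by-parity (parity n))
    where
    lemma : ∀ d q → (1ℚ + d) * q - d * q ≡ q
    lemma = solve-∀ ℚ-ring
    lemma₀ : ∀ a b → a * 0ℚ - b * 0ℚ ≡ 0ℚ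
    lemma₀ = solve-∀ ℚ-ring
    by-parity : ∀ {n} → Parity n → ν (2+ n) * Q (2+ n) - ν n * Q n ≡ Q n
    by-parity (even k) = trans (cong (λ z → z - ν (double k) * Q (double k)) (Q-suc k)) (lemma (ν (double k)) (Q (double k)))
    by-parity (odd k)  = trans (cong₂ (λ y z → ν (suc (suc (suc (double k)))) * y - ν (suc (double k)) * z) (Q-odd (suc k)) (Q-odd k))
                     (trans (lemma₀ (ν (suc (suc (suc (double k))))) (ν (suc (double k)))) (sym (Q-odd k)))

  -- Alternating chains as tan(L D) and sec(L D)

  recurrence-unique : ∀ (T : ℕ → (ℕ → ℚ) → (ℕ → ℚ)) → (∀ i → Linear (T i)) → (c : ℕ → ℕ → ℚ) (a b : ℕ → ℕ → ℚ) →
    (∀ x → a 0 x ≡ b 0 x) →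
    (∀ k x → a (suc k) x ≡ sumTo k (λ i → sg i * T i (a (k ∸ i)) x) + c k x) →
    (∀ k x → b (suc k) x ≡ sumTo k (λ i → sg i * T i (b (k ∸ i)) x) + c k x) →
    ∀ k x → a k x ≡ b k x
  recurrence-unique T T-linear c a b z ra rb = <-rec (λ k → ∀ x → a k x ≡ b k x) step
    where
    step : ∀ k → (∀ {j} → j < k → ∀ x → a j x ≡ b j x) → ∀ x → a k x ≡ b k x
    step zero    ih x = z x
    step (suc k) ih x = trans (ra k x) (trans
      (cong (_+ c k x) (sumTo-ext k (λ i → cong (sg i *_) (ext (T-linear i) (ih (s≤s (ℕP.m∸n≤m k i))) x))))
      (sym (rb k x)))

  -- `R 0` is the identity, so the term j = 0 of a convolution can be isolated. This puts a solution
  -- of cos · b = e into the form required by `recurrence-unique`, which stands in for inverting the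
  -- cosine of an operator.
  peel : ∀ (R : ℕ → (ℕ → ℚ) → (ℕ → ℚ)) → (∀ u x → R 0 u x ≡ u x) → (b : ℕ → ℕ → ℚ) (k : ℕ) (x : ℕ) {e : ℚ} →
    sumTo (suc k) (λ j → sg j * R j (b (suc k ∸ j)) x) ≡ e →
    b (suc k) x ≡ sumTo k (λ i → sg i * R (suc i) (b (k ∸ i)) x) + e
  peel R R₀ b k x {e} p = begin
    b (suc k) x
      ≡⟨ lemma (b (suc k) x) S ⟩
    S + (1ℚ * b (suc k) x + - 1ℚ * S)
      ≡⟨ cong (S +_) (cong₂ _+_ (cong (1ℚ *_) (sym (R₀ (b (suc k)) x)))
           (trans (sym (sumTo-*ˡ k (- 1ℚ) _)) (sumTo-ext k (λ i → lemma′ (sg i) (R (suc i) (b (k ∸ i)) x))))) ⟩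
    S + (1ℚ * R 0 (b (suc k)) x + sumTo k (λ i → sg (suc i) * R (suc i) (b (k ∸ i)) x))
      ≡⟨ cong (S +_) (sym (sumTo-head k _)) ⟩
    S + sumTo (suc k) (λ j → sg j * R j (b (suc k ∸ j)) x)
      ≡⟨ cong (S +_) p ⟩
    S + e ∎
    where
    S = sumTo k (λ i → sg i * R (suc i) (b (k ∸ i)) x)
    lemma : ∀ x s → x ≡ s + (1ℚ * x + - 1ℚ * s)
    lemma = solve-∀ ℚ-ring
    lemma′ : ∀ x y → - 1ℚ * (x * y) ≡ (- x) * y
    lemma′ = solve-∀ ℚ-ring

  module OddEval = Eval (D-linear oddSys)

  -- At x = i t the equation (1 + x²) C′ = D C becomes the one of cis(L D); `σ k` is i^k with the
  -- factor i dropped in odd degrees.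
  OddRight-run-cis : ∀ k u x → σ k * OddRight.run k u x ≡ OddEval.ev cis k u x
  OddRight-run-cis k u = OddEval.cis-unique u (λ k x → σ k * OddRight.run k u x)
    (λ x → ℚP.*-identityˡ (u x)) (λ x → trans (ℚP.*-identityˡ _) (OddRight-run-1 u x)) ode k
    where
    lemma : ∀ a b s x y → a * (- s * x) - b * (s * y) ≡ - s * (a * x + b * y)
    lemma = solve-∀ ℚ-ring
    ode : ∀ k x → ν (2+ k) * (σ (2+ k) * OddRight.run (2+ k) u x) - ν k * (σ k * OddRight.run k u x)
      ≡ sg (suc k) * D oddSys (λ y → σ (suc k) * OddRight.run (suc k) u y) x
    ode k x = begin
      ν (2+ k) * (σ (2+ k) * r₂) - ν k * (σ k * r₀)
        ≡⟨ cong (λ z → ν (2+ k) * (z * r₂) - ν k * (σ k * r₀)) (σ-suc-suc k) ⟩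
      ν (2+ k) * (- σ k * r₂) - ν k * (σ k * r₀)
        ≡⟨ lemma (ν (2+ k)) (ν k) (σ k) r₂ r₀ ⟩
      - σ k * (ν (2+ k) * r₂ + ν k * r₀)
        ≡⟨ cong₂ _*_ (sym (σ-suc-suc k)) (OddRight-run-ode k u x) ⟩
      sg (suc k) * σ (suc k) * D oddSys (OddRight.run (suc k) u) x
        ≡⟨ ℚP.*-assoc (sg (suc k)) (σ (suc k)) _ ⟩
      sg (suc k) * (σ (suc k) * D oddSys (OddRight.run (suc k) u) x)
        ≡⟨ cong (sg (suc k) *_) (sym (scl (D-linear oddSys) (σ (suc k)) (OddRight.run (suc k) u) x)) ⟩
      sg (suc k) * D oddSys (λ y → σ (suc k) * OddRight.run (suc k) u y) x ∎
      where
      r₂ = OddRight.run (2+ k) u x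
      r₀ = OddRight.run k u x

  -- Signed runs of even and of odd length are cosine and sine of `L D`, so both sides solve cos · F
  -- = sin.
  OddRight-oddChain : ∀ v k x → OddRight.oddChain v k x ≡ OddEval.ev secTan (suc (double k)) v x
  OddRight-oddChain v = recurrence-unique (λ i → OddRight.run (double (suc i))) (λ i → OddRight.run-linear (double (suc i)))
    (λ k x → sg (suc k) * OddRight.run (suc (double (suc k))) v x) (OddRight.oddChain v) h
    (λ x → trans (sym (trans (cong (_* OddRight.run 1 v x) (σ-suc-double 0)) (ℚP.*-identityˡ _)))
      (trans (OddRight-run-cis 1 v x) (trans (sym (OddEval.cosS-secTan-odd 0 v x)) (OddEval.ev-cis-0 (h 0) x))))
    (OddRight.oddChain-suc v)
    (λ k x → peel (λ j → OddRight.run (double j)) (λ _ _ → refl) h k x (begin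
      sumTo (suc k) (λ j → sg j * OddRight.run (double j) (h (suc k ∸ j)) x)
        ≡⟨ sumTo-ext (suc k) (λ j → trans (cong (_* OddRight.run (double j) (h (suc k ∸ j)) x) (sym (σ-double j))) (OddRight-run-cis (double j) (h (suc k ∸ j)) x)) ⟩
      sumTo (suc k) (λ j → OddEval.ev cis (double j) (h (suc k ∸ j)) x)
        ≡⟨ OddEval.cosS-secTan-odd (suc k) v x ⟩
      OddEval.ev cis (suc (double (suc k))) v x
        ≡⟨ sym (OddRight-run-cis (suc (double (suc k))) v x) ⟩
      σ (suc (double (suc k))) * OddRight.run (suc (double (suc k))) v x
        ≡⟨ cong (_* OddRight.run (suc (double (suc k))) v x) (σ-suc-double (suc k)) ⟩
      sg (suc k) * OddRight.run (suc (double (suc k))) v x ∎))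
    where
    h : ℕ → ℕ → ℚ
    h k = OddEval.ev secTan (suc (double k)) v

  module EvenEval = Eval (D-linear evenSys)

  Q-parity : ∀ n i → i ≤ n → Q i * sg (n ∸ i) ≡ sg n * Q i
  Q-parity n i i≤n = begin
    Q i * sg (n ∸ i)                ≡⟨ cong (_* sg (n ∸ i)) (sym (sg-evenSpread _ i)) ⟩
    sg i * Q i * sg (n ∸ i)         ≡⟨ lemma (sg i) (Q i) (sg (n ∸ i)) ⟩
    sg i * sg (n ∸ i) * Q i         ≡⟨ cong (_* Q i) (trans (sym (sg-+ i (n ∸ i))) (cong sg (ℕP.m+[n∸m]≡n i≤n))) ⟩
    sg n * Q i                      ∎
    where
    lemma : ∀ a b c → a * b * c ≡ a * c * b
    lemma = solve-∀ ℚ-ring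

  module _ (u : ℕ → ℚ) where

    private
      y : ℕ → ℕ → ℚ
      y k x = σ k * EvenLeft.run k u x

      DY : ℕ → Series
      DY x k = sg k * D evenSys (y k) x

      -- The equation of left runs at x = i t: (1 - t²) y′ + t y = D y(-t), where the term t y stems
      -- from the factor (1 + x²)^(1/2).
      J∂y : ∀ x → J (∂ (λ k → y k x)) ⊞ shift (λ k → y k x) ≋ DY x
      J∂y x zero = begin
        (1ℚ + 0ℚ) * (1ℚ * EvenLeft.run 1 u x) - 0ℚ + 0ℚ
          ≡⟨ lemma (EvenLeft.run 1 u x) ⟩
        1ℚ * EvenLeft.run 1 u x
          ≡⟨ cong (1ℚ *_) (trans (EvenLeft-run-1 u x) (ext (D-linear evenSys) (λ z → sym (ℚP.*-identityˡ (u z))) x)) ⟩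
        1ℚ * D evenSys (y 0) x ∎
        where
        lemma : ∀ r → (1ℚ + 0ℚ) * (1ℚ * r) - 0ℚ + 0ℚ ≡ 1ℚ * r
        lemma = solve-∀ ℚ-ring
      J∂y x (suc k) = begin
        J (∂ (λ k → y k x)) (suc k) + y k x
          ≡⟨ cong (_+ y k x) (J∂-suc (λ k → y k x) k) ⟩
        ν (2+ k) * (σ (2+ k) * r₂) - ν k * (σ k * r₀) + σ k * r₀
          ≡⟨ cong (λ z → ν (2+ k) * (z * r₂) - ν k * (σ k * r₀) + σ k * r₀) (σ-suc-suc k) ⟩
        ν (2+ k) * (- σ k * r₂) - ν k * (σ k * r₀) + σ k * r₀
          ≡⟨ lemma (ν (2+ k)) (ν k) (σ k) r₂ r₀ ⟩
        - σ k * (ν (2+ k) * r₂ + (ν k - 1ℚ) * r₀)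
          ≡⟨ cong₂ _*_ (sym (σ-suc-suc k)) (EvenLeft-run-ode k u x) ⟩
        sg (suc k) * σ (suc k) * D evenSys (EvenLeft.run (suc k) u) x
          ≡⟨ ℚP.*-assoc (sg (suc k)) (σ (suc k)) _ ⟩
        sg (suc k) * (σ (suc k) * D evenSys (EvenLeft.run (suc k) u) x)
          ≡⟨ cong (sg (suc k) *_) (sym (scl (D-linear evenSys) (σ (suc k)) (EvenLeft.run (suc k) u) x)) ⟩
        sg (suc k) * D evenSys (y (suc k)) x ∎
        where
        r₂ = EvenLeft.run (2+ k) u x
        r₀ = EvenLeft.run k u x
        lemma : ∀ a b s x y → a * (- s * x) - b * (s * y) + s * y ≡ - s * (a * x + (b - 1ℚ) * y)
        lemma = solve-∀ ℚ-ring

      z : ℕ → ℕ → ℚ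
      z k x = (Q ⋆ (λ k → y k x)) k

      -- Differentiating Q produces t Q y, which is just the term that completes Q · (1 - t²) y′ to
      -- Q times the left side of `J∂y`.
      J∂z : ∀ x → J (∂ (λ k → z k x)) ≋ Q ⋆ DY x
      J∂z x n = begin
        J (∂ (Q ⋆ Y)) n
          ≡⟨ J∂-⋆ Q Y n ⟩
        (J (∂ Q) ⋆ Y) n + (Q ⋆ J (∂ Y)) n
          ≡⟨ cong (_+ (Q ⋆ J (∂ Y)) n) (begin
               (J (∂ Q) ⋆ Y) n     ≡⟨ ⋆-cong J∂Q (≋-refl {Y}) n ⟩
               (shift Q ⋆ Y) n     ≡⟨ shift-⋆ Q Y n ⟩
               shift (Q ⋆ Y) n     ≡⟨ shift-cong (⋆-comm Q Y) n ⟩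
               shift (Y ⋆ Q) n     ≡⟨ sym (shift-⋆ Y Q n) ⟩
               (shift Y ⋆ Q) n     ≡⟨ ⋆-comm (shift Y) Q n ⟩
               (Q ⋆ shift Y) n     ∎) ⟩
        (Q ⋆ shift Y) n + (Q ⋆ J (∂ Y)) n
          ≡⟨ ℚP.+-comm ((Q ⋆ shift Y) n) ((Q ⋆ J (∂ Y)) n) ⟩
        (Q ⋆ J (∂ Y)) n + (Q ⋆ shift Y) n
          ≡⟨ sym (⋆-distribˡ-⊞ Q (J (∂ Y)) (shift Y) n) ⟩
        (Q ⋆ (J (∂ Y) ⊞ shift Y)) n
          ≡⟨ ⋆-cong (≋-refl {Q}) (J∂y x) n ⟩
        (Q ⋆ DY x) n ∎
        where
        Y : Series
        Y k = y k x

      Q⋆DY : ∀ x n → (Q ⋆ DY x) n ≡ sg n * D evenSys (z n) x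
      Q⋆DY x n = begin
        sumTo n (λ i → Q i * (sg (n ∸ i) * D evenSys (y (n ∸ i)) x))
          ≡⟨ sumTo-cong n (λ i i≤n → trans (sym (ℚP.*-assoc (Q i) (sg (n ∸ i)) (D evenSys (y (n ∸ i)) x)))
               (trans (cong (_* D evenSys (y (n ∸ i)) x) (Q-parity n i i≤n)) (trans (ℚP.*-assoc (sg n) (Q i) _)
                 (cong (sg n *_) (sym (scl (D-linear evenSys) (Q i) (y (n ∸ i)) x)))))) ⟩
        sumTo n (λ i → sg n * D evenSys (λ w → Q i * y (n ∸ i) w) x)
          ≡⟨ sumTo-*ˡ n (sg n) _ ⟩
        sg n * sumTo n (λ i → D evenSys (λ w → Q i * y (n ∸ i) w) x)
          ≡⟨ cong (sg n *_) (sym (sum (D-linear evenSys) n (λ i w → Q i * y (n ∸ i) w) x)) ⟩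
        sg n * D evenSys (z n) x ∎

    Q⋆EvenLeft-run : ∀ k x → sumTo k (λ i → Q i * (σ (k ∸ i) * EvenLeft.run (k ∸ i) u x)) ≡ EvenEval.ev cis k u x
    Q⋆EvenLeft-run = EvenEval.cis-unique u z
      (λ x → lemma₀ (u x))
      (λ x → trans (lemma₁ (EvenLeft.run 1 u x) (u x)) (EvenLeft-run-1 u x))
      (λ k x → trans (sym (J∂-suc (λ k → z k x) k)) (trans (J∂z x (suc k)) (Q⋆DY x (suc k))))
      where
      lemma₀ : ∀ a → 1ℚ * (1ℚ * a) ≡ a
      lemma₀ = solve-∀ ℚ-ring
      lemma₁ : ∀ a b → 1ℚ * (1ℚ * a) + 0ℚ * (1ℚ * b) ≡ a
      lemma₁ = solve-∀ ℚ-ring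

    Q⋆EvenLeft-run-even : ∀ k x → sumTo k (λ i → Q (double (k ∸ i)) * (sg i * EvenLeft.run (double i) u x)) ≡ EvenEval.ev cis (double k) u x
    Q⋆EvenLeft-run-even k x = begin
      sumTo k (λ i → Q (double (k ∸ i)) * (sg i * EvenLeft.run (double i) u x))
        ≡⟨ sumTo-reverse k _ ⟩
      sumTo k (λ i → Q (double (k ∸ (k ∸ i))) * (sg (k ∸ i) * EvenLeft.run (double (k ∸ i)) u x))
        ≡⟨ sumTo-cong k (λ i i≤k → trans (cong₂ (λ a b → Q (double a) * (b * EvenLeft.run (double (k ∸ i)) u x)) (ℕP.m∸[m∸n]≡n i≤k) (sym (σ-double (k ∸ i))))
             (cong (λ n → Q (double i) * (σ n * EvenLeft.run n u x)) (sym (double-∸ i≤k)))) ⟩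
      sumTo k (λ i → Q (double i) * (σ (double k ∸ double i) * EvenLeft.run (double k ∸ double i) u x))
        ≡⟨ sym (sumTo-even k (λ i → Q i * (σ (double k ∸ i) * EvenLeft.run (double k ∸ i) u x))
             (λ j → trans (cong (_* (σ (double k ∸ suc (double j)) * EvenLeft.run (double k ∸ suc (double j)) u x)) (Q-odd j)) (ℚP.*-zeroˡ (σ (double k ∸ suc (double j)) * EvenLeft.run (double k ∸ suc (double j)) u x)))) ⟩
      sumTo (double k) (λ i → Q i * (σ (double k ∸ i) * EvenLeft.run (double k ∸ i) u x))
        ≡⟨ Q⋆EvenLeft-run (double k) x ⟩
      EvenEval.ev cis (double k) u x ∎

  -- The even degrees of (1 - t²)^(-1/2) sec(L D) v.
  evenSolution : (ℕ → ℚ) → ℕ → ℕ → ℚ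
  evenSolution v k x = sumTo k (λ i → Q (double i) * EvenEval.ev secTan (double (k ∸ i)) v x)

  -- Exchanging the sums brings Q next to the signed runs, where their product is cos(L D); what
  -- remains is cos · sec = 1.
  evenSolution-convolution : ∀ v k x → sumTo k (λ j → sg j * EvenLeft.run (double j) (evenSolution v (k ∸ j)) x) ≡ EvenEval.ev one (double k) v x
  evenSolution-convolution v k x = begin
    sumTo k (λ j → sg j * r j (evenSolution v (k ∸ j)) x)
      ≡⟨ sumTo-ext k (λ j → trans (cong (sg j *_) (trans (sum (r-linear j) (k ∸ j) (λ i w → Q (double i) * h (k ∸ j ∸ i) w) x)
           (sumTo-ext (k ∸ j) (λ i → scl (r-linear j) (Q (double i)) (h (k ∸ j ∸ i)) x))))
           (sym (sumTo-*ˡ (k ∸ j) (sg j) _))) ⟩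
    sumTo k (λ j → sumTo (k ∸ j) (λ i → sg j * (Q (double i) * r j (h (k ∸ j ∸ i)) x)))
      ≡⟨ sumTo-triangle k _ ⟩
    sumTo k (λ N → sumTo N (λ j → sg j * (Q (double (N ∸ j)) * r j (h (k ∸ j ∸ (N ∸ j))) x)))
      ≡⟨ sumTo-ext k (λ N → sumTo-cong N (λ j j≤N → trans
           (cong (λ n → sg j * (Q (double (N ∸ j)) * r j (h n) x)) (trans (ℕP.∸-+-assoc k j (N ∸ j)) (cong (k ∸_) (ℕP.m+[n∸m]≡n j≤N))))
           (lemma (sg j) (Q (double (N ∸ j))) (r j (h (k ∸ N)) x)))) ⟩
    sumTo k (λ N → sumTo N (λ j → Q (double (N ∸ j)) * (sg j * r j (h (k ∸ N)) x)))
      ≡⟨ sumTo-ext k (λ N → Q⋆EvenLeft-run-even (h (k ∸ N)) N x) ⟩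
    sumTo k (λ N → EvenEval.ev cis (double N) (h (k ∸ N)) x)
      ≡⟨ EvenEval.cosS-secTan-even k v x ⟩
    EvenEval.ev one (double k) v x ∎
    where
    r : ℕ → (ℕ → ℚ) → (ℕ → ℚ)
    r j = EvenLeft.run (double j)
    r-linear : ∀ j → Linear (r j)
    r-linear j = EvenLeft.run-linear (double j)
    h : ℕ → ℕ → ℚ
    h n = EvenEval.ev secTan (double n) v
    lemma : ∀ a b c → a * (b * c) ≡ b * (a * c)
    lemma = solve-∀ ℚ-ring

  EvenLeft-evenChain : ∀ v k x → EvenLeft.evenChain v k x ≡ evenSolution v k x
  EvenLeft-evenChain v = recurrence-unique (λ i → EvenLeft.run (double (suc i))) (λ i → EvenLeft.run-linear (double (suc i)))
    (λ _ _ → 0ℚ) (EvenLeft.evenChain v) (evenSolution v)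
    (λ x → sym (lemma (v x)))
    (λ k x → trans (EvenLeft.evenChain-suc v k x) (sym (ℚP.+-identityʳ _)))
    (λ k x → peel (λ j → EvenLeft.run (double j)) (λ _ _ → refl) (evenSolution v) k x
      (trans (evenSolution-convolution v (suc k) x) (EvenEval.ev-one-suc (suc (double k)) v x)))
    where
    lemma : ∀ a → 1ℚ * (1ℚ * a) ≡ a
    lemma = solve-∀ ℚ-ring

  difference : (ℕ → ℕ → ℚ) → ℕ → ℕ → ℚ
  difference a zero    x = a 0 x
  difference a (suc k) x = a (suc k) x - a k x

  -- A left run of length k + 2 is a right run of length k + 2 or a right run of length k,
  -- which multiplies the generating function of the runs by 1 - t².
  EvenRight-evenChain : ∀ v k x → EvenRight.evenChain v k x ≡ difference (EvenLeft.evenChain v) k x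
  EvenRight-evenChain v = recurrence-unique (λ i → r i) r-linear
    (λ _ _ → 0ℚ) (EvenRight.evenChain v) (difference a)
    (λ x → refl)
    (λ k x → trans (EvenRight.evenChain-suc v k x) (sym (ℚP.+-identityʳ _)))
    (λ k x → trans (step k x) (sym (ℚP.+-identityʳ _)))
    where
    a = EvenLeft.evenChain v
    r : ℕ → (ℕ → ℚ) → (ℕ → ℚ)
    r i = EvenRight.run (double (suc i))
    r-linear : ∀ i → Linear (r i)
    r-linear i = EvenRight.run-linear (double (suc i))
    S : ℕ → ℕ → ℚ
    S k x = sumTo k (λ i → sg i * r i (a (k ∸ i)) x)
    a-suc : ∀ k x → a (suc k) x ≡ S k x + sumTo k (λ i → sg i * EvenRight.run (double i) (a (k ∸ i)) x)
    a-suc k x = trans (EvenLeft.evenChain-suc v k x) (trans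
      (sumTo-ext k (λ i → trans (cong (sg i *_) (EvenLeft-run≡EvenRight-run (double i) (a (k ∸ i)) x)) (ℚP.*-distribˡ-+ (sg i) _ _)))
      (sumTo-+ k _ _))
    lemma₀ : ∀ s x → s + 1ℚ * x - x ≡ s
    lemma₀ = solve-∀ ℚ-ring
    lemma₁ : ∀ s x t → s + (1ℚ * x + t) - x ≡ s + t
    lemma₁ = solve-∀ ℚ-ring
    lemma₂ : ∀ s x y → s * (x - y) ≡ s * x + (- s) * y
    lemma₂ = solve-∀ ℚ-ring
    lemma₃ : ∀ a b c → a + b + c ≡ (a + c) + b
    lemma₃ = solve-∀ ℚ-ring
    step : ∀ k x → a (suc k) x - a k x ≡ sumTo k (λ i → sg i * r i (difference a (k ∸ i)) x)
    step zero x = trans (cong (λ z → z - a 0 x) (a-suc 0 x)) (lemma₀ (S 0 x) (a 0 x))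
    step (suc k) x = begin
      a (2+ k) x - a (suc k) x
        ≡⟨ cong (λ z → z - a (suc k) x) (trans (a-suc (suc k) x) (cong (S (suc k) x +_) (sumTo-head k _))) ⟩
      S (suc k) x + (1ℚ * a (suc k) x + sumTo k (λ i → (- sg i) * r i (a (k ∸ i)) x)) - a (suc k) x
        ≡⟨ lemma₁ (S (suc k) x) (a (suc k) x) _ ⟩
      S (suc k) x + sumTo k (λ i → (- sg i) * r i (a (k ∸ i)) x)
        ≡⟨ lemma₃ (sumTo k (λ i → sg i * r i (a (suc k ∸ i)) x)) (sg (suc k) * r (suc k) (a (suc k ∸ suc k)) x) _ ⟩
      sumTo k (λ i → sg i * r i (a (suc k ∸ i)) x) + sumTo k (λ i → (- sg i) * r i (a (k ∸ i)) x) + sg (suc k) * r (suc k) (a (suc k ∸ suc k)) x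
        ≡⟨ cong (_+ sg (suc k) * r (suc k) (a (suc k ∸ suc k)) x) (sym (sumTo-+ k _ _)) ⟩
      sumTo k (λ i → sg i * r i (a (suc k ∸ i)) x + (- sg i) * r i (a (k ∸ i)) x) + sg (suc k) * r (suc k) (a (suc k ∸ suc k)) x
        ≡⟨ cong₂ _+_ (sumTo-cong k (λ i i≤k → sym (term i i≤k)))
             (cong (λ n → sg (suc k) * r (suc k) n x) (last k)) ⟩
      sumTo k (λ i → sg i * r i (difference a (suc k ∸ i)) x) + sg (suc k) * r (suc k) (difference a (suc k ∸ suc k)) x ∎
      where
      -- The last term has no lower partner to be subtracted, since `difference a 0` is `a 0`.
      last : ∀ k → a (suc k ∸ suc k) ≡ difference a (suc k ∸ suc k)
      last k rewrite ℕP.n∸n≡0 k = refl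
      term : ∀ i → i ≤ k → sg i * r i (difference a (suc k ∸ i)) x ≡ sg i * r i (a (suc k ∸ i)) x + (- sg i) * r i (a (k ∸ i)) x
      term i i≤k = begin
        sg i * r i (difference a (suc k ∸ i)) x
          ≡⟨ cong (λ n → sg i * r i (difference a n) x) (ℕP.+-∸-assoc 1 i≤k) ⟩
        sg i * r i (λ y → a (suc (k ∸ i)) y - a (k ∸ i) y) x
          ≡⟨ cong (sg i *_) (sub (r-linear i) (a (suc (k ∸ i))) (a (k ∸ i)) x) ⟩
        sg i * (r i (a (suc (k ∸ i))) x - r i (a (k ∸ i)) x)
          ≡⟨ lemma₂ (sg i) (r i (a (suc (k ∸ i))) x) (r i (a (k ∸ i)) x) ⟩
        sg i * r i (a (suc (k ∸ i))) x + (- sg i) * r i (a (k ∸ i)) x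
          ≡⟨ cong (λ n → sg i * r i (a n) x + (- sg i) * r i (a (k ∸ i)) x) (sym (ℕP.+-∸-assoc 1 i≤k)) ⟩
        sg i * r i (a (suc k ∸ i)) x + (- sg i) * r i (a (k ∸ i)) x ∎

  -- Euler numbers as entries of the powers of D

  δ₀ : ℕ → ℚ
  δ₀ zero    = 1ℚ
  δ₀ (suc m) = 0ℚ

  -- The coordinates of sec = sec · T^0 and of tan = T^1. As a final condition on words they select
  -- the states with no inner gap.
  target : System → ℕ → ℚ
  target evenSys m       = δ₀ m
  target oddSys  zero    = 0ℚ
  target oddSys  (suc m) = δ₀ m

  module Exponential (s : System) where

    -- By Taylor's formula Y_i(x) is the coefficient of T^i, with T = tan y, in sec(x + y)/sec y or
    -- in tan(x + y). So Y_i = sec x tan^i x in the even system; in the odd one Y_0 = tan x and Y_i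
    -- = sec² x tan^(i-1) x for i > 0.
    Y : ℕ → Series
    Y i n = invFact n * iter (D s) n (target s) i

    ∂Y : ∀ i n → ∂ (Y i) n ≡ ν (suc i) * Y (suc i) n + ν (closable s i) * Y (i ∸ 1) n
    ∂Y i n = begin
      ν (suc n) * (invFact (suc n) * D s z i)
        ≡⟨ sym (ℚP.*-assoc (ν (suc n)) (invFact (suc n)) (D s z i)) ⟩
      ν (suc n) * invFact (suc n) * D s z i
        ≡⟨ cong (_* D s z i) (invFact-suc n) ⟩
      invFact n * (ν (suc i) * z (suc i) + ν (closable s i) * z (i ∸ 1))
        ≡⟨ lemma (invFact n) (ν (suc i)) (z (suc i)) (ν (closable s i)) (z (i ∸ 1)) ⟩
      ν (suc i) * Y (suc i) n + ν (closable s i) * Y (i ∸ 1) n ∎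
      where
      z = iter (D s) n (target s)
      lemma : ∀ f a x b y → f * (a * x + b * y) ≡ a * (f * x) + b * (f * y)
      lemma = solve-∀ ℚ-ring

    Yc Ys : ℕ → Series
    Yc i = Y i ⋆ cosS
    Ys i = Y i ⋆ sinS

    ∂Y-⋆ : ∀ g i n → (∂ (Y i) ⋆ g) n ≡ ν (suc i) * (Y (suc i) ⋆ g) n + ν (closable s i) * (Y (i ∸ 1) ⋆ g) n
    ∂Y-⋆ g i n = trans (⋆-cong (∂Y i) (≋-refl {g}) n)
      (trans (⋆-distribʳ-⊞ (scale (ν (suc i)) (Y (suc i))) (scale (ν (closable s i)) (Y (i ∸ 1))) g n)
        (cong₂ _+_ (⋆-scaleˡ (ν (suc i)) (Y (suc i)) g n) (⋆-scaleˡ (ν (closable s i)) (Y (i ∸ 1)) g n)))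

    ∂Yc : ∀ i n → ∂ (Yc i) n ≡ (ν (suc i) * Yc (suc i) n + ν (closable s i) * Yc (i ∸ 1) n) - Ys i n
    ∂Yc i n = trans (∂-⋆ (Y i) cosS n) (cong₂ _+_ (∂Y-⋆ cosS i n) (begin
      (Y i ⋆ ∂ cosS) n                 ≡⟨ ⋆-cong (≋-refl {Y i}) (λ k → trans (∂cosS k) (lemma (sinS k))) n ⟩
      (Y i ⋆ scale (- 1ℚ) sinS) n      ≡⟨ ⋆-scaleʳ (- 1ℚ) (Y i) sinS n ⟩
      - 1ℚ * Ys i n                    ≡⟨ sym (lemma (Ys i n)) ⟩
      - Ys i n                         ∎))
      where
      lemma : ∀ x → - x ≡ - 1ℚ * x
      lemma = solve-∀ ℚ-ring

    ∂Ys : ∀ i n → ∂ (Ys i) n ≡ (ν (suc i) * Ys (suc i) n + ν (closable s i) * Ys (i ∸ 1) n) + Yc i n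
    ∂Ys i n = trans (∂-⋆ (Y i) sinS n) (cong₂ _+_ (∂Y-⋆ sinS i n) (⋆-cong (≋-refl {Y i}) ∂sinS n))

    -- Yᵢ₊₁ cos = Yᵢ sin: both sides solve the same homogeneous linear system.
    gap : ℕ → Series
    gap i n = Yc (suc i) n - Ys i n

    ∂-gap : ∀ i n → ∂ (gap i) n ≡ ∂ (Yc (suc i)) n - ∂ (Ys i) n
    ∂-gap i n = lemma (ν (suc n)) (Yc (suc i) (suc n)) (Ys i (suc n))
      where
      lemma : ∀ a x y → a * (x - y) ≡ a * x - a * y
      lemma = solve-∀ ℚ-ring

  ∂≡0⇒≡0 : ∀ (a : Series) n → ∂ a n ≡ 0ℚ → a (suc n) ≡ 0ℚ
  ∂≡0⇒≡0 a n p = ν-cancel n (trans p (sym (ℚP.*-zeroʳ (ν (suc n)))))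

  module EvenExp = Exponential evenSys
  module OddExp  = Exponential oddSys

  -- Induction on the degree for all i at once, because the derivative of a gap involves its
  -- neighbours i - 1 and i + 1.
  even-gap≡0 : ∀ n i → EvenExp.gap i n ≡ 0ℚ
  even-gap≡0 zero    i = lemma (EvenExp.Y i 0)
    where
    lemma : ∀ y → 1ℚ * 0ℚ * 1ℚ - y * 0ℚ ≡ 0ℚ
    lemma = solve-∀ ℚ-ring
  even-gap≡0 (suc n) i = ∂≡0⇒≡0 (gap i) n (begin
    ∂ (gap i) n
      ≡⟨ trans (∂-gap i n) (cong₂ _-_ (∂Yc (suc i) n) (∂Ys i n)) ⟩
    (ν (2+ i) * Yc (2+ i) n + ν (suc i) * Yc i n - Ys (suc i) n) - (ν (suc i) * Ys (suc i) n + ν i * Ys (i ∸ 1) n + Yc i n)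
      ≡⟨ lemma (ν i) (Yc (2+ i) n) (Yc i n) (Ys (suc i) n) (Ys (i ∸ 1) n) ⟩
    ν (2+ i) * gap (suc i) n + ν i * (Yc i n - Ys (i ∸ 1) n)
      ≡⟨ cong₂ _+_ (trans (cong (ν (2+ i) *_) (even-gap≡0 n (suc i))) (ℚP.*-zeroʳ (ν (2+ i)))) (previous i) ⟩
    0ℚ ∎)
    where
    open EvenExp
    lemma : ∀ i c₂ c₀ s₁ s₋ → ((1ℚ + (1ℚ + i)) * c₂ + (1ℚ + i) * c₀ - s₁) - ((1ℚ + i) * s₁ + i * s₋ + c₀) ≡ (1ℚ + (1ℚ + i)) * (c₂ - s₁) + i * (c₀ - s₋)
    lemma = solve-∀ ℚ-ring
    previous : ∀ i → ν i * (Yc i n - Ys (i ∸ 1) n) ≡ 0ℚ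
    previous zero    = ℚP.*-zeroˡ (Yc 0 n - Ys 0 n)
    previous (suc i) = trans (cong (ν (suc i) *_) (even-gap≡0 n i)) (ℚP.*-zeroʳ (ν (suc i)))

  even-Y⋆cosS : EvenExp.Y 0 ⋆ cosS ≋ one
  even-Y⋆cosS zero    = refl
  even-Y⋆cosS (suc n) = ∂≡0⇒≡0 (Yc 0) n (trans (∂Yc 0 n) (trans (lemma (Yc 1 n) (Yc 0 n) (Ys 0 n)) (even-gap≡0 n 0)))
    where
    open EvenExp
    lemma : ∀ x y z → (1ℚ + 0ℚ) * x + 0ℚ * y - z ≡ x - z
    lemma = solve-∀ ℚ-ring

  -- The index 0 is left out because there Y_1 cos - Y_0 sin = cos. The induction never meets it: in
  -- the derivative of gap 1 it carries the coefficient 0.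
  odd-gap≡0 : ∀ n i → OddExp.gap (suc i) n ≡ 0ℚ
  odd-gap≡0 zero    i = lemma (OddExp.Y (suc i) 0)
    where
    lemma : ∀ y → 1ℚ * 0ℚ * 1ℚ - y * 0ℚ ≡ 0ℚ
    lemma = solve-∀ ℚ-ring
  odd-gap≡0 (suc n) i = ∂≡0⇒≡0 (gap (suc i)) n (begin
    ∂ (gap (suc i)) n
      ≡⟨ trans (∂-gap (suc i) n) (cong₂ _-_ (∂Yc (2+ i) n) (∂Ys (suc i) n)) ⟩
    (ν (suc (2+ i)) * Yc (suc (2+ i)) n + ν (suc i) * Yc (suc i) n - Ys (2+ i) n)
      - (ν (2+ i) * Ys (2+ i) n + ν i * Ys i n + Yc (suc i) n)
      ≡⟨ lemma (ν i) (Yc (suc (2+ i)) n) (Yc (suc i) n) (Ys (2+ i) n) (Ys i n) ⟩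
    ν (suc (2+ i)) * gap (2+ i) n + ν i * gap i n
      ≡⟨ cong₂ _+_ (trans (cong (ν (suc (2+ i)) *_) (odd-gap≡0 n (suc i))) (ℚP.*-zeroʳ (ν (suc (2+ i))))) (previous i) ⟩
    0ℚ ∎)
    where
    open OddExp
    lemma : ∀ i c₃ c₁ s₂ s₀ → ((1ℚ + (1ℚ + (1ℚ + i))) * c₃ + (1ℚ + i) * c₁ - s₂) - ((1ℚ + (1ℚ + i)) * s₂ + i * s₀ + c₁)
      ≡ (1ℚ + (1ℚ + (1ℚ + i))) * (c₃ - s₂) + i * (c₁ - s₀)
    lemma = solve-∀ ℚ-ring
    previous : ∀ i → ν i * gap i n ≡ 0ℚ
    previous zero    = ℚP.*-zeroˡ (gap 0 n)
    previous (suc i) = trans (cong (ν (suc i) *_) (odd-gap≡0 n i)) (ℚP.*-zeroʳ (ν (suc i)))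

  -- `Z` and `P` are the defects of Y_0 cos = sin and Y_1 cos - Y_0 sin = cos. As gap 1 vanishes, Z′
  -- = P and P′ = -Z with initial values 0, so both are zero.
  odd-Y⋆cosS : OddExp.Y 0 ⋆ cosS ≋ sinS
  odd-Y⋆cosS n = trans (lemma (Yc 0 n) (sinS n)) (trans (cong (_+ sinS n) (proj₁ (both n))) (ℚP.+-identityˡ (sinS n)))
    where
    open OddExp
    lemma : ∀ x y → x ≡ (x - y) + y
    lemma = solve-∀ ℚ-ring
    Z P : Series
    Z n = Yc 0 n - sinS n
    P n = gap 0 n - cosS n
    lemma₁ : ∀ a x y → a * (x - y) ≡ a * x - a * y
    lemma₁ = solve-∀ ℚ-ring
    lemma₂ : ∀ c₁ c₀ s₀ c → ((1ℚ + 0ℚ) * c₁ + 0ℚ * c₀ - s₀) - c ≡ c₁ - s₀ - c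
    lemma₂ = solve-∀ ℚ-ring
    lemma₃ : ∀ c₂ c₀ s₁ s₀ s → (((1ℚ + (1ℚ + 0ℚ)) * c₂ + 0ℚ * c₀ - s₁) - ((1ℚ + 0ℚ) * s₁ + 0ℚ * s₀ + c₀)) - (- s) ≡ (1ℚ + (1ℚ + 0ℚ)) * (c₂ - s₁) - (c₀ - s)
    lemma₃ = solve-∀ ℚ-ring
    ∂Z : ∀ n → ∂ Z n ≡ P n
    ∂Z n = trans (lemma₁ (ν (suc n)) (Yc 0 (suc n)) (sinS (suc n))) (trans (cong₂ _-_ (∂Yc 0 n) (∂sinS n)) (lemma₂ (Yc 1 n) (Yc 0 n) (Ys 0 n) (cosS n)))
    ∂P : ∀ n → ∂ P n ≡ (1ℚ + (1ℚ + 0ℚ)) * gap 1 n - Z n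
    ∂P n = trans (lemma₁ (ν (suc n)) (gap 0 (suc n)) (cosS (suc n)))
      (trans (cong₂ _-_ (trans (∂-gap 0 n) (cong₂ _-_ (∂Yc 1 n) (∂Ys 0 n))) (∂cosS n))
        (lemma₃ (Yc 2 n) (Yc 0 n) (Ys 1 n) (Ys 0 n) (sinS n)))
    both : ∀ n → (Z n ≡ 0ℚ) × (P n ≡ 0ℚ)
    both zero    = refl , refl
    both (suc n) = ∂≡0⇒≡0 Z n (trans (∂Z n) (proj₂ (both n))) ,
      ∂≡0⇒≡0 P n (trans (∂P n) (trans (cong₂ (λ x y → (1ℚ + (1ℚ + 0ℚ)) * x - y) (odd-gap≡0 n 0) (proj₁ (both n))) refl))

  secTan≡Y : secTan ≋ EvenExp.Y 0 ⊞ OddExp.Y 0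
  secTan≡Y = cosS-cancel secTan (EvenExp.Y 0 ⊞ OddExp.Y 0) (≋-trans cosS⋆secTan (≋-sym (≋-trans (⋆-distribˡ-⊞ cosS (EvenExp.Y 0) (OddExp.Y 0))
    (⊞-cong (≋-trans (⋆-comm cosS (EvenExp.Y 0)) even-Y⋆cosS) (≋-trans (⋆-comm cosS (OddExp.Y 0)) odd-Y⋆cosS)))))

  private
    sg-step : ∀ sn si a x b y {x′ y′} → (sn * x ≡ x′) → (sn * y ≡ y′) → x′ ≡ (- si) * x → b * y′ ≡ (- si) * (b * y) →
      (- sn) * (a * x + b * y) ≡ si * (a * x + b * y)
    sg-step sn si a x b y {x′} {y′} p q p′ q′ = begin
      (- sn) * (a * x + b * y)                     ≡⟨ lemma₁ sn a x b y ⟩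
      - (a * (sn * x) + b * (sn * y))              ≡⟨ cong₂ (λ u v → - (a * u + b * v)) p q ⟩
      - (a * x′ + b * y′)                          ≡⟨ cong₂ (λ u v → - (a * u + v)) p′ q′ ⟩
      - (a * (- si * x) + (- si) * (b * y))        ≡⟨ lemma₂ si a x b y ⟩
      si * (a * x + b * y)                         ∎
      where
      lemma₁ : ∀ s a x b y → (- s) * (a * x + b * y) ≡ - (a * (s * x) + b * (s * y))
      lemma₁ = solve-∀ ℚ-ring
      lemma₂ : ∀ s a x b y → - (a * (- s * x) + (- s) * (b * y)) ≡ s * (a * x + b * y)
      lemma₂ = solve-∀ ℚ-ring

  -- The n-th derivative of sec is sec times a polynomial in T of the parity of n; for tan the
  -- parity is opposite. This separates sec from tan inside `secTan`.
  even-iter-parity : ∀ n i → sg n * iter (D evenSys) n (target evenSys) i ≡ sg i * iter (D evenSys) n (target evenSys) i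
  even-iter-parity zero    zero    = refl
  even-iter-parity zero    (suc i) = sym (ℚP.*-zeroʳ (sg (suc i)))
  even-iter-parity (suc n) i = sg-step (sg n) (sg i) (ν (suc i)) (z (suc i)) (ν i) (z (i ∸ 1))
    (even-iter-parity n (suc i)) (even-iter-parity n (i ∸ 1)) refl (previous i)
    where
    z = iter (D evenSys) n (target evenSys)
    lemma₀ : ∀ s t y → 0ℚ * (s * y) ≡ t * (0ℚ * y)
    lemma₀ = solve-∀ ℚ-ring
    lemma₁ : ∀ n s y → n * (s * y) ≡ (- - s) * (n * y)
    lemma₁ = solve-∀ ℚ-ring
    previous : ∀ i → ν i * (sg (i ∸ 1) * z (i ∸ 1)) ≡ (- sg i) * (ν i * z (i ∸ 1))
    previous zero    = lemma₀ 1ℚ (- 1ℚ) (z 0)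
    previous (suc i) = lemma₁ (ν (suc i)) (sg i) (z i)

  odd-iter-parity : ∀ n i → sg n * iter (D oddSys) n (target oddSys) i ≡ - sg i * iter (D oddSys) n (target oddSys) i
  odd-iter-parity zero    zero          = refl
  odd-iter-parity zero    (suc zero)    = refl
  odd-iter-parity zero    (2+ i) = sym (ℚP.*-zeroʳ (- sg (2+ i)))
  odd-iter-parity (suc n) i = sg-step (sg n) (- sg i) (ν (suc i)) (z (suc i)) (ν (i ∸ 1)) (z (i ∸ 1))
    (odd-iter-parity n (suc i)) (odd-iter-parity n (i ∸ 1)) refl (previous i)
    where
    z = iter (D oddSys) n (target oddSys)
    lemma₀ : ∀ s t y → 0ℚ * (s * y) ≡ t * (0ℚ * y)
    lemma₀ = solve-∀ ℚ-ring
    lemma₁ : ∀ n s y → n * (- s * y) ≡ (- - - s) * (n * y)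
    lemma₁ = solve-∀ ℚ-ring
    previous : ∀ i → ν (i ∸ 1) * (- sg (i ∸ 1) * z (i ∸ 1)) ≡ (- - sg i) * (ν (i ∸ 1) * z (i ∸ 1))
    previous zero    = lemma₀ (- 1ℚ) (- - 1ℚ) (z 0)
    previous (suc i) = lemma₁ (ν i) (sg i) (z i)

  even-iter-odd : ∀ k → iter (D evenSys) (suc (double k)) (target evenSys) 0 ≡ 0ℚ
  even-iter-odd k = ≡neg⇒≡0 x (trans (sym (ℚP.*-identityˡ x)) (trans (sym (even-iter-parity (suc (double k)) 0)) (trans (cong (_* x) (sg-odd k)) (lemma x))))
    where
    x = iter (D evenSys) (suc (double k)) (target evenSys) 0
    lemma : ∀ x → (- 1ℚ) * x ≡ - x
    lemma = solve-∀ ℚ-ring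

  odd-iter-even : ∀ k → iter (D oddSys) (double k) (target oddSys) 0 ≡ 0ℚ
  odd-iter-even k = ≡neg⇒≡0 x (trans (sym (ℚP.*-identityˡ x)) (trans (cong (_* x) (sym (sg-even k))) (trans (odd-iter-parity (double k) 0) (lemma x))))
    where
    x = iter (D oddSys) (double k) (target oddSys) 0
    lemma : ∀ x → (- 1ℚ) * x ≡ - x
    lemma = solve-∀ ℚ-ring

  secTan-even : ∀ k → secTan (double k) ≡ invFact (double k) * iter (D evenSys) (double k) (target evenSys) 0
  secTan-even k = trans (secTan≡Y (double k)) (trans (cong (λ z → EvenExp.Y 0 (double k) + invFact (double k) * z) (odd-iter-even k)) (lemma (EvenExp.Y 0 (double k)) (invFact (double k))))
    where
    lemma : ∀ x y → x + y * 0ℚ ≡ x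
    lemma = solve-∀ ℚ-ring

  secTan-odd : ∀ k → secTan (suc (double k)) ≡ invFact (suc (double k)) * iter (D oddSys) (suc (double k)) (target oddSys) 0
  secTan-odd k = trans (secTan≡Y (suc (double k))) (trans (cong (λ z → invFact (suc (double k)) * z + OddExp.Y 0 (suc (double k))) (even-iter-odd k)) (lemma (OddExp.Y 0 (suc (double k))) (invFact (suc (double k)))))
    where
    lemma : ∀ x y → y * 0ℚ + x ≡ x
    lemma = solve-∀ ℚ-ring

  factℚ*invFact : ∀ n z → factℚ n * (invFact n * z) ≡ z
  factℚ*invFact n z = begin
    factℚ n * (invFact n * z)      ≡⟨ lemma (factℚ n) (invFact n) z ⟩
    invFact n * factℚ n * z        ≡⟨ cong (λ y → invFact n * y * z) (fromℕ≡ν (n ℕ.!)) ⟩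
    invFact n * ν (n ℕ.!) * z      ≡⟨ cong (_* z) (invFact-! n) ⟩
    1ℚ * z                         ≡⟨ ℚP.*-identityˡ z ⟩
    z                              ∎
    where
    lemma : ∀ x y z → x * (y * z) ≡ y * x * z
    lemma = solve-∀ ℚ-ring

  E-even : ∀ k → E (double k) ≡ iter (D evenSys) (double k) (target evenSys) 0
  E-even k = trans (cong (factℚ (double k) *_) (secTan-even k)) (factℚ*invFact (double k) _)

  E-odd : ∀ k → E (suc (double k)) ≡ iter (D oddSys) (suc (double k)) (target oddSys) 0
  E-odd k = trans (cong (factℚ (suc (double k)) *_) (secTan-odd k)) (factℚ*invFact (suc (double k)) _)

  -- The series of the theorem

  term : ℕ → Series
  term m = scale ((E m * E m) * invFact m) (L ^ˢ m)

  -- The two factors `E m` meet here: one from the coefficient of `secTan`, the other from the m-th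
  -- derivative of sec or tan at 0.
  secTan-term : ∀ m n z → secTan m ≡ invFact m * z → E m ≡ z → secTan m * (L ^ˢ m) n * z ≡ term m n
  secTan-term m n z p q = trans (cong₂ (λ x y → x * (L ^ˢ m) n * y) (trans p (cong (invFact m *_) (sym q))) (sym q)) (lemma (invFact m) (E m) ((L ^ˢ m) n))
    where
    lemma : ∀ f e l → f * e * l * e ≡ e * e * f * l
    lemma = solve-∀ ℚ-ring

  term-vanish : ∀ m n → n < m → term m n ≡ 0ℚ
  term-vanish m n p = trans (cong ((E m * E m) * invFact m *_) (L^-vanish m n p)) (ℚP.*-zeroʳ ((E m * E m) * invFact m))

  oddSeries evenSeries : Series
  oddSeries  = Σseries (λ r → term (2 ℕ.* r ℕ.+ 1))
  evenSeries = Σseries (λ r → term (2 ℕ.* r))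

  2*+1≡ : ∀ r → 2 ℕ.* r ℕ.+ 1 ≡ suc (double r)
  2*+1≡ r = trans (ℕP.+-comm (2 ℕ.* r) 1) (cong suc (sym (double≡2* r)))

  double-< : ∀ {i j} → i < j → double i < double j
  double-< {i} p = ℕP.<-≤-trans (ℕP.n<1+n (double i)) (ℕP.≤-trans (ℕP.n≤1+n (suc (double i))) (double-mono p))

  ≤-double : ∀ k → k ≤ double k
  ≤-double zero    = z≤n
  ≤-double (suc k) = s≤s (ℕP.m≤n⇒m≤1+n (≤-double k))

  oddSeries-even : ∀ k → oddSeries (double k) ≡ 0ℚ
  oddSeries-even k = sumTo-≡0 (double k) (λ r _ → trans (cong (λ m → term m (double k)) (2*+1≡ r))
    (trans (cong ((E (suc (double r)) * E (suc (double r))) * invFact (suc (double r)) *_) (L^-odd-even r k)) (ℚP.*-zeroʳ ((E (suc (double r)) * E (suc (double r))) * invFact (suc (double r))))))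

  evenSeries-odd : ∀ k → evenSeries (suc (double k)) ≡ 0ℚ
  evenSeries-odd k = sumTo-≡0 (suc (double k)) (λ r _ → trans (cong (λ m → term m (suc (double k))) (sym (double≡2* r)))
    (trans (cong ((E (double r) * E (double r)) * invFact (double r) *_) (L^-even-odd r k)) (ℚP.*-zeroʳ ((E (double r) * E (double r)) * invFact (double r)))))

  evenSeries-even : ∀ k → EvenEval.ev secTan (double k) (target evenSys) 0 ≡ evenSeries (double k)
  evenSeries-even k = begin
    sumTo (double k) (λ m → secTan m * (L ^ˢ m) (double k) * iter (D evenSys) m (target evenSys) 0)
      ≡⟨ sumTo-even k _ (λ j → trans (cong (λ z → secTan (suc (double j)) * z * iter (D evenSys) (suc (double j)) (target evenSys) 0) (L^-odd-even j k))
           (lemma (secTan (suc (double j))) (iter (D evenSys) (suc (double j)) (target evenSys) 0))) ⟩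
    sumTo k (λ r → secTan (double r) * (L ^ˢ double r) (double k) * iter (D evenSys) (double r) (target evenSys) 0)
      ≡⟨ sumTo-ext k (λ r → trans (secTan-term (double r) (double k) _ (secTan-even r) (E-even r)) (cong (λ m → term m (double k)) (double≡2* r))) ⟩
    sumTo k (λ r → term (2 ℕ.* r) (double k))
      ≡⟨ sym (sumTo-extend _ (≤-double k) (λ r k<r → term-vanish (2 ℕ.* r) (double k) (subst (double k <_) (double≡2* r) (double-< k<r)))) ⟩
    evenSeries (double k) ∎
    where
    lemma : ∀ x y → x * 0ℚ * y ≡ 0ℚ
    lemma = solve-∀ ℚ-ring

  oddSeries-odd : ∀ k → OddEval.ev secTan (suc (double k)) (target oddSys) 0 ≡ oddSeries (suc (double k))
  oddSeries-odd k = begin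
    sumTo (suc (double k)) g
      ≡⟨ sumTo-head (double k) g ⟩
    g 0 + sumTo (double k) (λ m → g (suc m))
      ≡⟨ cong₂ _+_ (lemma (secTan 0) (target oddSys 0)) (sumTo-even k (λ m → g (suc m)) (λ j → g-even (suc j))) ⟩
    0ℚ + sumTo k (λ r → g (suc (double r)))
      ≡⟨ ℚP.+-identityˡ _ ⟩
    sumTo k (λ r → g (suc (double r)))
      ≡⟨ sumTo-ext k (λ r → trans (secTan-term (suc (double r)) (suc (double k)) _ (secTan-odd r) (E-odd r)) (cong (λ m → term m (suc (double k))) (sym (2*+1≡ r)))) ⟩
    sumTo k (λ r → term (2 ℕ.* r ℕ.+ 1) (suc (double k)))
      ≡⟨ sym (sumTo-extend _ (ℕP.m≤n⇒m≤1+n (≤-double k)) (λ r k<r → term-vanish (2 ℕ.* r ℕ.+ 1) (suc (double k)) (subst (suc (double k) <_) (sym (2*+1≡ r)) (s≤s (double-< k<r))))) ⟩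
    oddSeries (suc (double k)) ∎
    where
    g : ℕ → ℚ
    g m = secTan m * (L ^ˢ m) (suc (double k)) * iter (D oddSys) m (target oddSys) 0
    lemma : ∀ x y → x * 0ℚ * y ≡ 0ℚ
    lemma = solve-∀ ℚ-ring
    g-even : ∀ j → g (double j) ≡ 0ℚ
    g-even j = trans (cong (λ z → secTan (double j) * z * iter (D oddSys) (double j) (target oddSys) 0) (L^-even-odd j k))
      (lemma (secTan (double j)) (iter (D oddSys) (double j) (target oddSys) 0))

  oddSpread≋oddSeries : ∀ (c : ℕ → ℚ) → (∀ k → c k ≡ OddRight.oddChain (target oddSys) k 0) → oddSpread c ≋ oddSeries
  oddSpread≋oddSeries c p n = by-parity (parity n)
    where
    by-parity : ∀ {n} → Parity n → oddSpread c n ≡ oddSeries n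
    by-parity (even k) = trans (oddSpread-even c k) (sym (oddSeries-even k))
    by-parity (odd k)  = trans (oddSpread-odd c k) (trans (p k) (trans (OddRight-oddChain (target oddSys) k 0) (oddSeries-odd k)))

  evenSpread≋evenSeries : ∀ (c : ℕ → ℚ) → (∀ k → c k ≡ EvenLeft.evenChain (target evenSys) k 0) → evenSpread c ≋ invSqrt1-t² ⋆ evenSeries
  evenSpread≋evenSeries c p n = by-parity (parity n)
    where
    index : ∀ j k → double j ≤ suc (double k) → suc (double k) ∸ double j ≡ suc (double (k ∸ j))
    index zero    k       q             = refl
    index (suc j) zero    (s≤s ())
    index (suc j) (suc k) (s≤s (s≤s q)) = index j k q
    vanish : ∀ k {i} → Parity i → i ≤ suc (double k) → Q i * evenSeries (suc (double k) ∸ i) ≡ 0ℚ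
    vanish k (odd j)  i≤ = trans (cong (_* evenSeries (suc (double k) ∸ suc (double j))) (Q-odd j)) (ℚP.*-zeroˡ (evenSeries (suc (double k) ∸ suc (double j))))
    vanish k (even j) i≤ = trans (cong (Q (double j) *_) (trans (cong evenSeries (index j k i≤)) (evenSeries-odd (k ∸ j)))) (ℚP.*-zeroʳ (Q (double j)))
    by-parity : ∀ {n} → Parity n → evenSpread c n ≡ (invSqrt1-t² ⋆ evenSeries) n
    by-parity (odd k)  = trans (evenSpread-odd c k) (sym (sumTo-≡0 (suc (double k)) (λ i → vanish k (parity i))))
    by-parity (even k) = begin
      evenSpread c (double k)
        ≡⟨ trans (evenSpread-even c k) (trans (p k) (EvenLeft-evenChain (target evenSys) k 0)) ⟩
      sumTo k (λ i → Q (double i) * EvenEval.ev secTan (double (k ∸ i)) (target evenSys) 0)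
        ≡⟨ sumTo-cong k (λ i i≤k → cong (Q (double i) *_) (trans (evenSeries-even (k ∸ i)) (cong evenSeries (sym (double-∸ i≤k))))) ⟩
      sumTo k (λ i → Q (double i) * evenSeries (double k ∸ double i))
        ≡⟨ sym (sumTo-even k (λ i → Q i * evenSeries (double k ∸ i)) (λ j → trans (cong (_* evenSeries (double k ∸ suc (double j))) (Q-odd j)) (ℚP.*-zeroˡ (evenSeries (double k ∸ suc (double j)))))) ⟩
      (invSqrt1-t² ⋆ evenSeries) (double k) ∎

module Permutations where

  open GeneratingFunctions
  open import Data.Bool using (Bool; true; false; not; if_then_else_)
  open import Data.Nat as ℕ using (ℕ; zero; suc; _<_; s≤s)
  import Data.Nat.Properties as ℕP
  open import Data.Integer as ℤ using (ℤ)
  import Data.Integer.Properties as ℤP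
  open import Data.Rational as ℚ using (ℚ; 0ℚ; 1ℚ; _+_)
  import Data.Rational.Properties as ℚP
  open import Data.Fin using (Fin; zero; suc; toℕ; fromℕ<; opposite)
  import Data.Fin.Properties as FinP
  open import Data.Vec as Vec using (Vec; []; _∷_; lookup; tabulate)
  import Data.Vec.Properties as VecP
  open import Data.Maybe using (Maybe; just; nothing)
  open import Data.List using (List; []; _∷_; length; _++_; map; concatMap; downFrom; filter; allFin; initLast; _∷ʳ′_)
  import Data.List.Properties as ListP
  open import Data.List.Membership.Propositional using (_∈_; _∉_; find; lose)
  open import Data.List.Membership.Propositional.Properties using (∈-map⁺; ∈-map⁻; ∈-++⁺ˡ; ∈-++⁺ʳ; ∈-++⁻; ∈-concatMap⁺; ∈-concatMap⁻; ∈-downFrom⁺; ∈-downFrom⁻; ∈-filter⁺; ∈-filter⁻; ∈-allFin)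
  open import Data.List.Membership.Propositional.Properties.WithK using (unique∧set⇒bag)
  open import Data.List.Relation.Unary.Any using (Any; here; there)
  open import Data.List.Relation.Unary.All as All using (All; []; _∷_)
  import Data.List.Relation.Unary.All.Properties as AllP
  open import Data.List.Relation.Unary.AllPairs using ([]; _∷_)
  open import Data.List.Relation.Unary.Unique.Propositional using (Unique)
  import Data.List.Relation.Unary.Unique.Propositional.Properties as UniqueP
  open import Data.List.Relation.Binary.BagAndSetEquality using (∼bag⇒↭)
  open import Data.List.Relation.Binary.Permutation.Propositional using (_↭_; ↭-refl; ↭-sym; ↭-trans; ↭-prep; ↭-reflexive; ↭⇒↭ₛ)
  import Data.List.Relation.Binary.Permutation.Propositional.Properties as PermP
  import Data.List.Relation.Binary.Permutation.Setoid.Properties as PermS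
  open import Data.List.Relation.Binary.Sublist.Propositional using (_⊆_; ⊆-refl; ⊆-trans; ⊆-reflexive; from∈; to∈; minimum; _∷ʳ_; _∷_)
  import Data.List.Relation.Binary.Sublist.Propositional.Properties as SubP
  open import Data.Product using (∃; ∃₂; _×_; _,_; proj₁; proj₂)
  open import Data.Sum using (_⊎_; inj₁; inj₂)
  open import Data.Unit using (⊤; tt)
  open import Data.Empty using (⊥; ⊥-elim)
  open import Function.Bundles using (mk⇔)
  open import Relation.Unary using (Decidable)
  open import Relation.Binary.Definitions using (tri<; tri≈; tri>)
  open import Relation.Binary.PropositionalEquality using (_≡_; _≢_; refl; sym; trans; cong; cong₂; subst; subst₂; setoid; module ≡-Reasoning)
  open import Tactic.RingSolver using (solve-∀)

  open ≡-Reasoning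

  -- Building a word by inserting its letters in increasing order

  -- Partial words: the letters inserted so far, and gaps (nothing) that will
  -- receive larger letters. A gap is filled by k alone, which is then a peak, or
  -- by k between two new gaps, which is then a valley.
  Letter : Set
  Letter = Maybe ℕ

  Str : Set
  Str = List Letter

  pattern ∞ = nothing

  Zip : Set
  Zip = Str × Str

  gaps : Str → ℕ
  gaps []           = 0
  gaps (∞ ∷ xs)     = suc (gaps xs)
  gaps (just v ∷ xs) = gaps xs

  cons : Letter → Zip → Zip
  cons x (l , r) = x ∷ l , r

  openings : Str → List Zip
  openings []            = []
  openings (∞ ∷ xs)      = ([] , xs) ∷ map (cons ∞) (openings xs)
  openings (just v ∷ xs) = map (cons (just v)) (openings xs)

  data Dir : Set where
    rightward leftward : Dir

  flip : Dir → Dir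
  flip rightward  = leftward
  flip leftward = rightward

  extendR : Str → ℕ → Zip → Zip
  extendR xs a (l , r) = xs ++ just a ∷ l , r

  extendL : ℕ → Str → Zip → Zip
  extendL a ys (l , r) = l , r ++ just a ∷ ys

  openAt : Dir → ℕ → Zip → List Zip
  openAt rightward  a (xs , ys) = map (extendR xs a) (openings ys)
  openAt leftward a (xs , ys) = map (extendL a ys) (openings xs)

  -- The arguments count the gaps on either side of the chosen one. An end gap shows by having none
  -- beyond it, and it must stay open.
  fillable : System → ℕ → ℕ → Bool
  fillable s       p       zero    = false
  fillable evenSys p       (suc q) = true
  fillable oddSys  zero    (suc q) = false
  fillable oddSys  (suc p) (suc q) = true

  fill : System → Zip → List Zip
  fill s (X , Y) = (if fillable s (gaps X) (gaps Y) then (X , Y) ∷ [] else []) ++ (X ++ ∞ ∷ [] , ∞ ∷ Y) ∷ []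

  moves : System → Dir → ℕ → Zip → List Zip
  moves s d a z = concatMap (fill s) (openAt d a z)

  -- Only the end gaps remain.
  complete : System → ℕ → ℕ → Bool
  complete oddSys  1 1 = true
  complete evenSys 0 1 = true
  complete _       _ _ = false

  assemble : ℕ → Zip → Str
  assemble a (X , Y) = X ++ just a ∷ Y

  -- `a` is the letter placed last, between the two halves of the zip, and `m` is the number of
  -- letters still to come.
  words : System → (ℕ → Dir) → ℕ → ℕ → Zip → List Str
  words s d zero    a z = if complete s (gaps (proj₁ z)) (gaps (proj₂ z)) then assemble a z ∷ [] else []
  words s d (suc m) a z = concatMap (words s d m (suc a)) (moves s (d a) a z)

  gaps-++ : ∀ xs ys → gaps (xs ++ ys) ≡ gaps xs ℕ.+ gaps ys
  gaps-++ []            ys = refl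
  gaps-++ (∞ ∷ xs)      ys = cong suc (gaps-++ xs ys)
  gaps-++ (just v ∷ xs) ys = gaps-++ xs ys

  -- The number of words in terms of the transfer operators

  sumOver : ∀ {A : Set} → List A → (A → ℚ) → ℚ
  sumOver []       g = 0ℚ
  sumOver (x ∷ xs) g = g x + sumOver xs g

  sumOver-cong : ∀ {A : Set} (xs : List A) {g h : A → ℚ} → (∀ x → g x ≡ h x) → sumOver xs g ≡ sumOver xs h
  sumOver-cong []       p = refl
  sumOver-cong (x ∷ xs) p = cong₂ _+_ (p x) (sumOver-cong xs p)

  sumOver-map : ∀ {A B : Set} (f : A → B) xs (g : B → ℚ) → sumOver (map f xs) g ≡ sumOver xs (λ x → g (f x))
  sumOver-map f []       g = refl
  sumOver-map f (x ∷ xs) g = cong (g (f x) +_) (sumOver-map f xs g)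

  sumOver-++ : ∀ {A : Set} (xs ys : List A) (g : A → ℚ) → sumOver (xs ++ ys) g ≡ sumOver xs g + sumOver ys g
  sumOver-++ []       ys g = sym (ℚP.+-identityˡ _)
  sumOver-++ (x ∷ xs) ys g = trans (cong (g x +_) (sumOver-++ xs ys g)) (sym (ℚP.+-assoc (g x) _ _))

  sumOver-concatMap : ∀ {A B : Set} (f : A → List B) xs (g : B → ℚ) → sumOver (concatMap f xs) g ≡ sumOver xs (λ x → sumOver (f x) g)
  sumOver-concatMap f []       g = refl
  sumOver-concatMap f (x ∷ xs) g = trans (sumOver-++ (f x) (concatMap f xs) g) (cong (sumOver (f x) g +_) (sumOver-concatMap f xs g))

  ν-length-concatMap : ∀ {A B : Set} (f : A → List B) xs → ν (length (concatMap f xs)) ≡ sumOver xs (λ x → ν (length (f x)))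
  ν-length-concatMap f []       = refl
  ν-length-concatMap f (x ∷ xs) = trans (cong ν (ListP.length-++ (f x)))
    (trans (ν-+ (length (f x)) _) (cong (ν (length (f x)) +_) (ν-length-concatMap f xs)))

  step : System → Dir → (State → ℚ) → (State → ℚ)
  step s rightward  V = right V
  step s leftward V = left s V

  value : System → (ℕ → Dir) → ℕ → ℕ → State → ℚ
  value s d zero    a = forget s (target s)
  value s d (suc m) a = step s (d a) (value s d m (suc a))

  -- States leave out the end gaps and strings contain them, so in odd length the left half has one
  -- gap more than `p`.
  offset : System → ℕ → ℕ
  offset oddSys  p = suc p
  offset evenSys p = p

  -- The contribution of one chosen gap, given the numbers of gaps of the string on its two sides;
  -- the cases with one term are end gaps.
  fillValue : System → (State → ℚ) → ℕ → ℕ → ℚ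
  fillValue evenSys V c       zero    = V (suc c , 0)
  fillValue evenSys V c       (suc q) = V (suc c , suc q) + V (c , q)
  fillValue oddSys  V zero    q       = V (0 , q)
  fillValue oddSys  V (suc c) zero    = V (suc c , 0)
  fillValue oddSys  V (suc c) (suc q) = V (suc c , suc q) + V (c , q)

  rightSum : (State → ℚ) → ℕ → ℕ → ℚ
  rightSum V p zero    = 0ℚ
  rightSum V p (suc q) = rightAt V p q

  leftSum : System → (State → ℚ) → ℕ → ℕ → ℕ → ℚ
  leftSum s V o zero    q = 0ℚ
  leftSum s V o (suc c) q = fillValue s V o (c ℕ.+ suc q) + leftSum s V (suc o) c q

  rightSum-suc : ∀ s V p q → fillValue s V (offset s p) q + rightSum V (suc p) q ≡ rightAt V p q
  rightSum-suc evenSys V p zero    = ℚP.+-identityʳ _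
  rightSum-suc evenSys V p (suc q) = refl
  rightSum-suc oddSys  V p zero    = ℚP.+-identityʳ _
  rightSum-suc oddSys  V p (suc q) = refl

  offset-suc : ∀ s p c → offset s p ℕ.+ suc c ≡ offset s (suc p) ℕ.+ c
  offset-suc oddSys  p c = cong suc (ℕP.+-suc p c)
  offset-suc evenSys p c = ℕP.+-suc p c

  sumOver-openings-right : ∀ s V ys p → sumOver (openings ys) (λ z → fillValue s V (offset s p ℕ.+ gaps (proj₁ z)) (gaps (proj₂ z))) ≡ rightSum V p (gaps ys)
  sumOver-openings-right s V []            p = refl
  sumOver-openings-right s V (just v ∷ ys) p = trans (sumOver-map (cons (just v)) (openings ys) _) (sumOver-openings-right s V ys p)
  sumOver-openings-right s V (∞ ∷ ys)      p = begin
    fillValue s V (offset s p ℕ.+ 0) (gaps ys) + sumOver (map (cons ∞) (openings ys)) (λ z → fillValue s V (offset s p ℕ.+ gaps (proj₁ z)) (gaps (proj₂ z)))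
      ≡⟨ cong₂ _+_ (cong (λ c → fillValue s V c (gaps ys)) (ℕP.+-identityʳ (offset s p)))
           (trans (sumOver-map (cons ∞) (openings ys) _)
             (trans (sumOver-cong (openings ys) (λ z → cong (λ c → fillValue s V c (gaps (proj₂ z))) (offset-suc s p (gaps (proj₁ z)))))
               (sumOver-openings-right s V ys (suc p)))) ⟩
    fillValue s V (offset s p) (gaps ys) + rightSum V (suc p) (gaps ys)
      ≡⟨ rightSum-suc s V p (gaps ys) ⟩
    rightAt V p (gaps ys) ∎

  sumOver-openings-left : ∀ s V xs o q → sumOver (openings xs) (λ z → fillValue s V (o ℕ.+ gaps (proj₁ z)) (gaps (proj₂ z) ℕ.+ suc q)) ≡ leftSum s V o (gaps xs) q
  sumOver-openings-left s V []            o q = refl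
  sumOver-openings-left s V (just v ∷ xs) o q = trans (sumOver-map (cons (just v)) (openings xs) _) (sumOver-openings-left s V xs o q)
  sumOver-openings-left s V (∞ ∷ xs)      o q = cong₂ _+_
    (cong (λ c → fillValue s V c (gaps xs ℕ.+ suc q)) (ℕP.+-identityʳ o))
    (trans (sumOver-map (cons ∞) (openings xs) _)
      (trans (sumOver-cong (openings xs) (λ z → cong (λ c → fillValue s V c (gaps (proj₂ z) ℕ.+ suc q)) (ℕP.+-suc o (gaps (proj₁ z)))))
        (sumOver-openings-left s V xs (suc o) q)))

  -- `openings` lists gaps from left to right, whereas `leftAt` begins with the nearest gap on the
  -- left; peeling off the last summand reconciles the two orders.
  leftSum-last : ∀ s V o c q → leftSum s V o (suc c) q ≡ fillValue s V (o ℕ.+ c) (suc q) + leftSum s V o c (suc q)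
  leftSum-last s V o zero    q = cong (λ n → fillValue s V n (suc q) + 0ℚ) (sym (ℕP.+-identityʳ o))
  leftSum-last s V o (suc c) q = begin
    fillValue s V o (suc c ℕ.+ suc q) + leftSum s V (suc o) (suc c) q
      ≡⟨ cong₂ _+_ (cong (fillValue s V o) (sym (ℕP.+-suc c (suc q)))) (leftSum-last s V (suc o) c q) ⟩
    fillValue s V o (c ℕ.+ suc (suc q)) + (fillValue s V (suc o ℕ.+ c) (suc q) + leftSum s V (suc o) c (suc q))
      ≡⟨ cong (λ n → fillValue s V o (c ℕ.+ suc (suc q)) + (fillValue s V n (suc q) + leftSum s V (suc o) c (suc q))) (sym (ℕP.+-suc o c)) ⟩
    fillValue s V o (c ℕ.+ suc (suc q)) + (fillValue s V (o ℕ.+ suc c) (suc q) + leftSum s V (suc o) c (suc q))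
      ≡⟨ lemma (fillValue s V o (c ℕ.+ suc (suc q))) (fillValue s V (o ℕ.+ suc c) (suc q)) (leftSum s V (suc o) c (suc q)) ⟩
    fillValue s V (o ℕ.+ suc c) (suc q) + (fillValue s V o (c ℕ.+ suc (suc q)) + leftSum s V (suc o) c (suc q)) ∎
    where
    lemma : ∀ a b c → a + (b + c) ≡ b + (a + c)
    lemma = solve-∀ ℚ-ring

  leftSum≡leftAt : ∀ s V p q → leftSum s V 0 (offset s p) q ≡ leftAt s V p q
  leftSum≡leftAt oddSys  V zero    q = ℚP.+-identityʳ _
  leftSum≡leftAt evenSys V zero    q = refl
  leftSum≡leftAt oddSys  V (suc p) q = trans (leftSum-last oddSys V 0 (suc p) q) (cong (V (suc p , suc q) + V (p , q) +_) (leftSum≡leftAt oddSys V p (suc q)))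
  leftSum≡leftAt evenSys V (suc p) q = trans (leftSum-last evenSys V 0 p q) (cong (V (suc p , suc q) + V (p , q) +_) (leftSum≡leftAt evenSys V p (suc q)))

  module _ (s : System) (V : State → ℚ) (g : Zip → ℚ)
    (g≡V : ∀ X Y p q → gaps X ≡ offset s p → gaps Y ≡ suc q → g (X , Y) ≡ V (p , q)) where

    private
      gaps-∷ʳ : ∀ X → gaps (X ++ ∞ ∷ []) ≡ suc (gaps X)
      gaps-∷ʳ X = trans (gaps-++ X (∞ ∷ [])) (ℕP.+-comm (gaps X) 1)

      swap-0 : ∀ a b → a + (b + 0ℚ) ≡ b + a
      swap-0 = solve-∀ ℚ-ring

    sumOver-fill : ∀ X Y → sumOver (fill s (X , Y)) g ≡ fillValue s V (gaps X) (gaps Y)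
    sumOver-fill X Y = helper s (gaps X) (gaps Y) refl refl g≡V
      where
      helper : ∀ s c q → gaps X ≡ c → gaps Y ≡ q → (∀ X Y p q → gaps X ≡ offset s p → gaps Y ≡ suc q → g (X , Y) ≡ V (p , q)) →
        sumOver ((if fillable s c q then (X , Y) ∷ [] else []) ++ (X ++ ∞ ∷ [] , ∞ ∷ Y) ∷ []) g ≡ fillValue s V c q
      helper oddSys  zero    zero    ex ey h = trans (ℚP.+-identityʳ _) (h _ _ 0 0 (trans (gaps-∷ʳ X) (cong suc ex)) (cong suc ey))
      helper oddSys  zero    (suc q) ex ey h = trans (ℚP.+-identityʳ _) (h _ _ 0 (suc q) (trans (gaps-∷ʳ X) (cong suc ex)) (cong suc ey))
      helper oddSys  (suc c) zero    ex ey h = trans (ℚP.+-identityʳ _) (h _ _ (suc c) 0 (trans (gaps-∷ʳ X) (cong suc ex)) (cong suc ey))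
      helper oddSys  (suc c) (suc q) ex ey h = trans (swap-0 (g (X , Y)) (g (X ++ ∞ ∷ [] , ∞ ∷ Y)))
        (cong₂ _+_ (h _ _ (suc c) (suc q) (trans (gaps-∷ʳ X) (cong suc ex)) (cong suc ey)) (h _ _ c q ex ey))
      helper evenSys c       zero    ex ey h = trans (ℚP.+-identityʳ _) (h _ _ (suc c) 0 (trans (gaps-∷ʳ X) (cong suc ex)) (cong suc ey))
      helper evenSys c       (suc q) ex ey h = trans (swap-0 (g (X , Y)) (g (X ++ ∞ ∷ [] , ∞ ∷ Y)))
        (cong₂ _+_ (h _ _ (suc c) (suc q) (trans (gaps-∷ʳ X) (cong suc ex)) (cong suc ey)) (h _ _ c q ex ey))

    sumOver-moves : ∀ d a X Y p q → gaps X ≡ offset s p → gaps Y ≡ suc q → sumOver (moves s d a (X , Y)) g ≡ step s d V (p , q)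
    sumOver-moves rightward a X Y p q ex ey = begin
      sumOver (moves s rightward a (X , Y)) g
        ≡⟨ sumOver-concatMap (fill s) (map (extendR X a) (openings Y)) g ⟩
      sumOver (map (extendR X a) (openings Y)) (λ z → sumOver (fill s z) g)
        ≡⟨ sumOver-map (extendR X a) (openings Y) _ ⟩
      sumOver (openings Y) (λ z → sumOver (fill s (extendR X a z)) g)
        ≡⟨ sumOver-cong (openings Y) (λ (l , r) → trans (sumOver-fill (X ++ just a ∷ l) r)
             (cong (λ c → fillValue s V c (gaps r)) (trans (gaps-++ X (just a ∷ l)) (cong (ℕ._+ gaps l) ex)))) ⟩
      sumOver (openings Y) (λ z → fillValue s V (offset s p ℕ.+ gaps (proj₁ z)) (gaps (proj₂ z)))
        ≡⟨ sumOver-openings-right s V Y p ⟩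
      rightSum V p (gaps Y)
        ≡⟨ cong (rightSum V p) ey ⟩
      rightAt V p q ∎
    sumOver-moves leftward a X Y p q ex ey = begin
      sumOver (moves s leftward a (X , Y)) g
        ≡⟨ sumOver-concatMap (fill s) (map (extendL a Y) (openings X)) g ⟩
      sumOver (map (extendL a Y) (openings X)) (λ z → sumOver (fill s z) g)
        ≡⟨ sumOver-map (extendL a Y) (openings X) _ ⟩
      sumOver (openings X) (λ z → sumOver (fill s (extendL a Y z)) g)
        ≡⟨ sumOver-cong (openings X) (λ (l , r) → trans (sumOver-fill l (r ++ just a ∷ Y))
             (cong (fillValue s V (gaps l)) (trans (gaps-++ r (just a ∷ Y)) (cong (gaps r ℕ.+_) ey)))) ⟩
      sumOver (openings X) (λ z → fillValue s V (gaps (proj₁ z)) (gaps (proj₂ z) ℕ.+ suc q))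
        ≡⟨ sumOver-openings-left s V X 0 q ⟩
      leftSum s V 0 (gaps X) q
        ≡⟨ cong (λ c → leftSum s V 0 c q) ex ⟩
      leftSum s V 0 (offset s p) q
        ≡⟨ leftSum≡leftAt s V p q ⟩
      leftAt s V p q ∎

  -- The number of completions depends on a zip only through its gap counts, so strings may be
  -- replaced by states.
  words-value : ∀ s d m a X Y p q → gaps X ≡ offset s p → gaps Y ≡ suc q → ν (length (words s d m a (X , Y))) ≡ value s d m a (p , q)
  words-value s d (suc m) a X Y p q ex ey = trans (ν-length-concatMap (words s d m (suc a)) (moves s (d a) a (X , Y)))
    (sumOver-moves s (value s d m (suc a)) (λ z → ν (length (words s d m (suc a) z))) (words-value s d m (suc a)) (d a) a X Y p q ex ey)
  words-value s d zero a X Y p q ex ey rewrite ex | ey = final s p q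
    where
    final : ∀ s p q → ν (length (if complete s (offset s p) (suc q) then assemble a (X , Y) ∷ [] else [])) ≡ forget s (target s) (p , q)
    final oddSys  zero    zero    = refl
    final oddSys  zero    (suc q) = refl
    final oddSys  (suc p) q       = refl
    final evenSys zero    zero    = refl
    final evenSys zero    (suc q) = refl
    final evenSys (suc p) q       = refl

  alternating : Dir → ℕ → Dir
  alternating d zero    = d
  alternating d (suc a) = flip (alternating d a)

  flip-flip : ∀ d → flip (flip d) ≡ d
  flip-flip rightward  = refl
  flip-flip leftward = refl

  -- Alternating directions have period two, so two moves split off as one link of a chain.
  value-+2 : ∀ s d m a → value s (alternating d) m (suc (suc a)) ≡ value s (alternating d) m a
  value-+2 s d zero    a = refl
  value-+2 s d (suc m) a = cong₂ (step s) (flip-flip (alternating d a)) (value-+2 s d m (suc a))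

  value-odd : ∀ k → value oddSys (alternating rightward) (double k) 0 ≡ iter (λ V → right (left oddSys V)) k (forget oddSys (target oddSys))
  value-odd zero    = refl
  value-odd (suc k) = cong (λ V → right (left oddSys V)) (trans (value-+2 oddSys rightward (double k) 0) (value-odd k))

  value-even-left : ∀ k → value evenSys (alternating leftward) (suc (double k)) 0 ≡ iter (λ V → left evenSys (right V)) k (left evenSys (forget evenSys (target evenSys)))
  value-even-left zero    = refl
  value-even-left (suc k) = cong (λ V → left evenSys (right V)) (trans (value-+2 evenSys leftward (suc (double k)) 0) (value-even-left k))

  value-even-right : ∀ k → value evenSys (alternating rightward) (suc (double k)) 0 ≡ iter (λ V → right (left evenSys V)) k (right (forget evenSys (target evenSys)))
  value-even-right zero    = refl
  value-even-right (suc k) = cong (λ V → right (left evenSys V)) (trans (value-+2 evenSys rightward (suc (double k)) 0) (value-even-right k))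

  start : Zip
  start = ∞ ∷ [] , ∞ ∷ []

  allWordsOf : System → Dir → ℕ → List Str
  allWordsOf s d m = words s (alternating d) m 0 start

  length-odd : ∀ k → ν (length (allWordsOf oddSys rightward (double k))) ≡ OddRight.oddChain (target oddSys) k 0
  length-odd k = trans (words-value oddSys (alternating rightward) (double k) 0 (∞ ∷ []) (∞ ∷ []) 0 0 refl refl) (cong (λ V → V (0 , 0)) (value-odd k))

  length-even-left : ∀ k → ν (length (allWordsOf evenSys leftward (suc (double k)))) ≡ EvenLeft.evenChain (target evenSys) (suc k) 0
  length-even-left k = trans (words-value evenSys (alternating leftward) (suc (double k)) 0 (∞ ∷ []) (∞ ∷ []) 1 0 refl refl) (cong (λ V → V (1 , 0)) (value-even-left k))

  length-even-right : ∀ k → ν (length (allWordsOf evenSys rightward (suc (double k)))) ≡ EvenRight.evenChain (target evenSys) (suc k) 0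
  length-even-right k = trans (words-value evenSys (alternating rightward) (suc (double k)) 0 (∞ ∷ []) (∞ ∷ []) 1 0 refl refl) (cong (λ V → V (1 , 0)) (value-even-right k))

  -- Alternation of partial words, every gap counting as a very large letter

  _≺_ : Letter → Letter → Set
  just a ≺ just b = a < b
  just a ≺ ∞      = ⊤
  ∞      ≺ _      = ⊥

  Compare : Bool → Letter → Letter → Set
  Compare true  x y = y ≺ x
  Compare false x y = x ≺ y

  Zigzag : Bool → Str → Set
  Zigzag b []           = ⊤
  Zigzag b (x ∷ [])     = ⊤
  Zigzag b (x ∷ y ∷ zs) = Compare b x y × Zigzag (not b) (y ∷ zs)

  -- `phase true X` tells, by the parity of the length of `X`, whether the position after `X` is a
  -- peak.
  phase : Bool → Str → Bool
  phase b []       = b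
  phase b (x ∷ xs) = phase (not b) xs

  phase-∷ʳ : ∀ b X x → phase b (X ++ x ∷ []) ≡ not (phase b X)
  phase-∷ʳ b []      x = refl
  phase-∷ʳ b (_ ∷ X) x = phase-∷ʳ (not b) X x

  gap-phase : ∀ b x X Y → Zigzag b (x ∷ X ++ ∞ ∷ Y) → phase b (x ∷ X) ≡ true
  gap-phase true  ∞        [] Y (() , _)
  gap-phase true  (just _) [] Y (() , _)
  gap-phase false x        [] Y _ = refl
  gap-phase b x (x′ ∷ X) Y (_ , z) = gap-phase (not b) x′ X Y z

  -- `∞` is never the smaller side of a comparison, so it cannot stand at a valley.
  gap-is-peak : ∀ X Y → Zigzag true (X ++ ∞ ∷ Y) → phase true X ≡ true
  gap-is-peak []      Y z = refl
  gap-is-peak (x ∷ X) Y z = gap-phase true x X Y z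

  -- A peak occurs only as the larger side of comparisons, so it is enough that what lies below `e`
  -- lies below `e′`.
  replace-peak : ∀ {e e′} b X Y → phase b X ≡ true → All (λ y → y ≺ e → y ≺ e′) X → All (λ y → y ≺ e → y ≺ e′) Y →
    Zigzag b (X ++ e ∷ Y) → Zigzag b (X ++ e′ ∷ Y)
  replace-peak true  []       []      _  _ _ _       = tt
  replace-peak true  []       (y ∷ Y) _  _ (p ∷ _) (c , z) = p c , z
  replace-peak true  (x ∷ []) Y       () _ _ _
  replace-peak false (x ∷ []) Y       _  (p ∷ _) ps (c , z) = p c , replace-peak true [] Y refl [] ps z
  replace-peak b (x ∷ x′ ∷ X) Y h (_ ∷ ps) qs (c , z) = c , replace-peak (not b) (x′ ∷ X) Y h ps qs z

  insert-valley : ∀ k b X Y → phase b X ≡ true → Zigzag b (X ++ ∞ ∷ Y) → Zigzag b (X ++ ∞ ∷ just k ∷ ∞ ∷ Y)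
  insert-valley k true  []           Y _  z       = tt , tt , z
  insert-valley k b     (x ∷ [])     Y h  (c , z) = c , insert-valley k (not b) [] Y h z
  insert-valley k b     (x ∷ x′ ∷ X) Y h  (c , z) = c , insert-valley k (not b) (x′ ∷ X) Y h z

  delete-valley : ∀ k b X Y → phase b X ≡ true → Zigzag b (X ++ ∞ ∷ just k ∷ ∞ ∷ Y) → Zigzag b (X ++ ∞ ∷ Y)
  delete-valley k true  []           Y _  (_ , _ , z) = z
  delete-valley k b     (x ∷ [])     Y h  (c , z) = c , delete-valley k (not b) [] Y h z
  delete-valley k b     (x ∷ x′ ∷ X) Y h  (c , z) = c , delete-valley k (not b) (x′ ∷ X) Y h z

  valley-neighbours : ∀ {e} b X x y Y → phase b X ≡ true → Zigzag b (X ++ x ∷ e ∷ y ∷ Y) → (e ≺ x) × (e ≺ y)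
  valley-neighbours true []            x y Y _ (c , c′ , _) = c , c′
  valley-neighbours b    (x′ ∷ [])     x y Y h (_ , z) = valley-neighbours (not b) [] x y Y h z
  valley-neighbours b    (x′ ∷ x″ ∷ X) x y Y h (_ , z) = valley-neighbours (not b) (x″ ∷ X) x y Y h z

  fin : Str → List ℕ
  fin []            = []
  fin (∞ ∷ xs)      = fin xs
  fin (just v ∷ xs) = v ∷ fin xs

  fin-++ : ∀ xs ys → fin (xs ++ ys) ≡ fin xs ++ fin ys
  fin-++ []            ys = refl
  fin-++ (∞ ∷ xs)      ys = fin-++ xs ys
  fin-++ (just v ∷ xs) ys = cong (v ∷_) (fin-++ xs ys)

  ∈-fin : ∀ {v} xs → just v ∈ xs → v ∈ fin xs
  ∈-fin (∞ ∷ xs)      (there p)   = ∈-fin xs p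
  ∈-fin (just v ∷ xs) (here refl) = here refl
  ∈-fin (just v ∷ xs) (there p)   = there (∈-fin xs p)

  ∈-fin-split : ∀ {v} xs → v ∈ fin xs → ∃₂ λ l r → xs ≡ l ++ just v ∷ r
  ∈-fin-split (∞ ∷ xs) p with l , r , e ← ∈-fin-split xs p = ∞ ∷ l , r , cong (∞ ∷_) e
  ∈-fin-split (just v ∷ xs) (here refl) = [] , xs , refl
  ∈-fin-split (just v ∷ xs) (there p) with l , r , e ← ∈-fin-split xs p = just v ∷ l , r , cong (just v ∷_) e

  LastGap : Str → Set
  LastGap []           = ⊥
  LastGap (x ∷ [])     = x ≡ ∞
  LastGap (x ∷ y ∷ ys) = LastGap (y ∷ ys)

  lastGap⁺ : ∀ X y Y → LastGap (y ∷ Y) → LastGap (X ++ y ∷ Y)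
  lastGap⁺ []           y Y h = h
  lastGap⁺ (x ∷ [])     y Y h = h
  lastGap⁺ (x ∷ x′ ∷ X) y Y h = lastGap⁺ (x′ ∷ X) y Y h

  lastGap⁻ : ∀ X y Y → LastGap (X ++ y ∷ Y) → LastGap (y ∷ Y)
  lastGap⁻ []           y Y h = h
  lastGap⁻ (x ∷ [])     y Y h = h
  lastGap⁻ (x ∷ x′ ∷ X) y Y h = lastGap⁻ (x′ ∷ X) y Y h

  FirstGap : System → Str → Set
  FirstGap evenSys _       = ⊤
  FirstGap oddSys  (∞ ∷ _) = ⊤
  FirstGap oddSys  _       = ⊥

  firstGap-++ : ∀ s x X Y Y′ → FirstGap s (x ∷ X ++ Y) → FirstGap s (x ∷ X ++ Y′)
  firstGap-++ evenSys x X Y Y′ h = tt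
  firstGap-++ oddSys  ∞ X Y Y′ h = tt

  -- The invariant of a partial word with letters 0, ..., k - 1. It does not mention moves, so it
  -- can also be checked after a letter is taken away.
  record Valid (s : System) (k : ℕ) (w : Str) : Set where
    constructor valid
    field
      zigzag  : Zigzag true w
      letters : fin w ↭ downFrom k
      last    : LastGap w
      first   : FirstGap s w

  open Valid

  Unique-resp-↭ : ∀ {xs ys : List ℕ} → xs ↭ ys → Unique xs → Unique ys
  Unique-resp-↭ p = PermS.Unique-resp-↭ (setoid ℕ) (↭⇒↭ₛ p)

  valid-unique : ∀ {s k w} → Valid s k w → Unique (fin w)
  valid-unique {k = k} v = Unique-resp-↭ (↭-sym (letters v)) (UniqueP.downFrom⁺ k)

  valid-bound : ∀ {s k w v} → Valid s k w → just v ∈ w → v < k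
  valid-bound {w = w} V p = ∈-downFrom⁻ (PermP.∈-resp-↭ (letters V) (∈-fin w p))

  -- `Fill` and `Open` are relational forms of `fill` and `openAt`: list membership is inverted
  -- once, afterwards constructors are matched.
  data Fill (s : System) : Zip → Zip → Set where
    peak   : ∀ {X Y} → fillable s (gaps X) (gaps Y) ≡ true → Fill s (X , Y) (X , Y)
    valley : ∀ {X Y} → Fill s (X , Y) (X ++ ∞ ∷ [] , ∞ ∷ Y)

  data Open : Dir → ℕ → Zip → Zip → Set where
    openR : ∀ {a} xs l r → Open rightward a (xs , l ++ ∞ ∷ r) (xs ++ just a ∷ l , r)
    openL : ∀ {a} l r ys → Open leftward a (l ++ ∞ ∷ r , ys) (l , r ++ just a ∷ ys)

  close : Zip → Str
  close (X , Y) = X ++ ∞ ∷ Y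

  ∈-fill⁻ : ∀ s X Y {z} → z ∈ fill s (X , Y) → Fill s (X , Y) z
  ∈-fill⁻ s X Y p with fillable s (gaps X) (gaps Y) in eq
  ∈-fill⁻ s X Y (here refl)         | true  = peak eq
  ∈-fill⁻ s X Y (there (here refl)) | true  = valley
  ∈-fill⁻ s X Y (here refl)         | false = valley

  ∈-fill⁺ : ∀ s {o z} → Fill s o z → z ∈ fill s o
  ∈-fill⁺ s (peak h) rewrite h = here refl
  ∈-fill⁺ s {X , Y} valley with fillable s (gaps X) (gaps Y)
  ... | true  = there (here refl)
  ... | false = here refl

  ∈-openings⁻ : ∀ xs {z} → z ∈ openings xs → xs ≡ close z
  ∈-openings⁻ (∞ ∷ xs) (here refl) = refl
  ∈-openings⁻ (∞ ∷ xs) (there p) with z , q , refl ← ∈-map⁻ (cons ∞) p = cong (∞ ∷_) (∈-openings⁻ xs q)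
  ∈-openings⁻ (just v ∷ xs) p with z , q , refl ← ∈-map⁻ (cons (just v)) p = cong (just v ∷_) (∈-openings⁻ xs q)

  ∈-openings⁺ : ∀ l r → (l , r) ∈ openings (l ++ ∞ ∷ r)
  ∈-openings⁺ []           r = here refl
  ∈-openings⁺ (∞ ∷ l)      r = there (∈-map⁺ (cons ∞) (∈-openings⁺ l r))
  ∈-openings⁺ (just v ∷ l) r = ∈-map⁺ (cons (just v)) (∈-openings⁺ l r)

  ∈-open⁻ : ∀ d a z {o} → o ∈ openAt d a z → Open d a z o
  ∈-open⁻ rightward a (xs , ys) p with (l , r) , q , refl ← ∈-map⁻ (extendR xs a) p with refl ← ∈-openings⁻ ys q = openR xs l r
  ∈-open⁻ leftward a (xs , ys) p with (l , r) , q , refl ← ∈-map⁻ (extendL a ys) p with refl ← ∈-openings⁻ xs q = openL l r ys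

  ∈-open⁺ : ∀ {d a z o} → Open d a z o → o ∈ openAt d a z
  ∈-open⁺ {a = a} (openR xs l r) = ∈-map⁺ (extendR xs a) (∈-openings⁺ l r)
  ∈-open⁺ {a = a} (openL l r ys) = ∈-map⁺ (extendL a ys) (∈-openings⁺ l r)

  ∈-moves⁻ : ∀ s d a z {z′} → z′ ∈ moves s d a z → ∃ λ o → Open d a z o × Fill s o z′
  ∈-moves⁻ s d a z p with o , q , r ← find (∈-concatMap⁻ (fill s) {xs = openAt d a z} p) = o , ∈-open⁻ d a z q , ∈-fill⁻ s (proj₁ o) (proj₂ o) r

  ∈-moves⁺ : ∀ s {d a z o z′} → Open d a z o → Fill s o z′ → z′ ∈ moves s d a z
  ∈-moves⁺ s {d} {a} {z} p q = ∈-concatMap⁺ (fill s) {xs = openAt d a z} (lose (∈-open⁺ p) (∈-fill⁺ s q))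

  open-close : ∀ {d a z o} → Open d a z o → assemble a z ≡ close o
  open-close {a = a} (openR xs l r) = sym (ListP.++-assoc xs (just a ∷ l) (∞ ∷ r))
  open-close {a = a} (openL l r ys) = ListP.++-assoc l (∞ ∷ r) (just a ∷ ys)

  fin-fill : ∀ {s k X Y z} → Fill s (X , Y) z → fin (assemble k z) ≡ fin X ++ k ∷ fin Y
  fin-fill {X = X} {Y} (peak _) = fin-++ X _
  fin-fill {k = k} {X = X} {Y} valley = trans (cong fin (ListP.++-assoc X (∞ ∷ []) (just k ∷ ∞ ∷ Y))) (fin-++ X _)

  -- The new letter k exceeds all letters present and lies below every gap, so it fits as a peak in
  -- place of a gap and as a valley between two gaps.
  fill-valid : ∀ {s k X Y z} → Valid s k (X ++ ∞ ∷ Y) → Fill s (X , Y) z → Valid s (suc k) (assemble k z)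
  fill-valid {s} {k} {X} {Y} V F = valid (zig F) (↭-trans (↭-reflexive (fin-fill F)) (↭-trans (PermP.shift k (fin X) (fin Y))
      (↭-prep k (↭-trans (↭-reflexive (sym (fin-++ X (∞ ∷ Y)))) (letters V))))) (lst F) (fst s F (first V))
    where
    below : ∀ {ys} → (∀ {v} → just v ∈ ys → v < k) → All (λ y → y ≺ ∞ → y ≺ just k) ys
    below {[]}          h = []
    below {∞ ∷ ys}      h = (λ ()) ∷ below (λ p → h (there p))
    below {just v ∷ ys} h = (λ _ → h (here refl)) ∷ below (λ p → h (there p))
    zig : ∀ {z} → Fill s (X , Y) z → Zigzag true (assemble k z)
    zig (peak _) = replace-peak true X Y (gap-is-peak X Y (zigzag V)) (below (λ p → valid-bound V (∈-++⁺ˡ p))) (below (λ p → valid-bound V (∈-++⁺ʳ X (there p)))) (zigzag V)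
    zig valley   = subst (Zigzag true) (sym (ListP.++-assoc X (∞ ∷ []) (just k ∷ ∞ ∷ Y))) (insert-valley k true X Y (gap-is-peak X Y (zigzag V)) (zigzag V))
    nonempty : ∀ s p Y → fillable s p (gaps Y) ≡ true → LastGap (∞ ∷ Y) → LastGap (just k ∷ Y)
    nonempty s p (y ∷ Y) _ h = h
    lst : ∀ {z} → Fill s (X , Y) z → LastGap (assemble k z)
    lst (peak h) = lastGap⁺ X (just k) Y (nonempty s (gaps X) Y h (lastGap⁻ X ∞ Y (last V)))
    lst valley   = lastGap⁺ (X ++ ∞ ∷ []) (just k) (∞ ∷ Y) (lastGap⁻ X ∞ Y (last V))
    fst : ∀ s {X Y z} → Fill s (X , Y) z → FirstGap s (X ++ ∞ ∷ Y) → FirstGap s (assemble k z)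
    fst evenSys F h = tt
    fst oddSys {x ∷ X} {Y} (peak _) h = firstGap-++ oddSys x X (∞ ∷ Y) (just k ∷ Y) h
    fst oddSys {[]} {[]} (peak ()) h
    fst oddSys {[]} {∞ ∷ Y} (peak ()) h
    -- With `X` empty this is the left end gap; `fillable` computes to `false` only after `gaps Y`
    -- has been split.
    fst oddSys {[]} {just v ∷ Y} (peak e) h with gaps Y
    fst oddSys {[]} {just v ∷ Y} (peak ()) h | zero
    fst oddSys {[]} {just v ∷ Y} (peak ()) h | suc _
    fst oddSys {[]} valley h = tt
    fst oddSys {∞ ∷ X} valley h = tt

  -- Each word has only one history

  fill-injective : ∀ {s o₁ o₂ z} → phase true (proj₁ o₁) ≡ true → phase true (proj₁ o₂) ≡ true → Fill s o₁ z → Fill s o₂ z → o₁ ≡ o₂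
  fill-injective h₁ h₂ F₁ F₂ = helper h₁ h₂ F₁ F₂ refl
    where
    -- A peak has a prefix of even length before the letter, a valley one of odd length, so the two
    -- cannot yield the same zip.
    clash : ∀ X {x} → phase true X ≡ true → phase true (X ++ x ∷ []) ≡ true → ⊥
    clash X {x} p q with () ← trans (sym q) (trans (phase-∷ʳ true X x) (cong not p))
    helper : ∀ {s o₁ o₂ z₁ z₂} → phase true (proj₁ o₁) ≡ true → phase true (proj₁ o₂) ≡ true → Fill s o₁ z₁ → Fill s o₂ z₂ → z₁ ≡ z₂ → o₁ ≡ o₂
    helper h₁ h₂ (peak _) (peak _) e = e
    helper h₁ h₂ (peak _) (valley {X}) refl = ⊥-elim (clash X h₂ h₁)
    helper h₁ h₂ (valley {X}) (peak _) refl = ⊥-elim (clash X h₁ h₂)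
    helper h₁ h₂ (valley {X₁} {Y₁}) (valley {X₂} {Y₂}) e =
      cong₂ _,_ (ListP.∷ʳ-injectiveˡ X₁ X₂ (cong proj₁ e)) (ListP.∷-injectiveʳ (cong proj₂ e))

  split-unique : ∀ {a : ℕ} X₁ X₂ {Y₁ Y₂} → just a ∉ X₁ → just a ∉ X₂ → X₁ ++ just a ∷ Y₁ ≡ X₂ ++ just a ∷ Y₂ → (X₁ , Y₁) ≡ (X₂ , Y₂)
  split-unique []       []       _ _ refl = refl
  split-unique []       (x ∷ X₂) _ n₂ refl = ⊥-elim (n₂ (here refl))
  split-unique (x ∷ X₁) []       n₁ _ refl = ⊥-elim (n₁ (here refl))
  split-unique (x ∷ X₁) (y ∷ X₂) n₁ n₂ e with refl ← ListP.∷-injectiveˡ e =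
    cong (cons x) (split-unique X₁ X₂ (λ p → n₁ (there p)) (λ p → n₂ (there p)) (ListP.∷-injectiveʳ e))

  unique-++ : ∀ {a : ℕ} xs {ys} → Unique (xs ++ a ∷ ys) → a ∉ xs
  unique-++ (x ∷ xs) (h ∷ u) (here refl) = All.lookup h (∈-++⁺ʳ xs (here refl)) refl
  unique-++ (x ∷ xs) (h ∷ u) (there p)   = unique-++ xs u p

  valid-∉ : ∀ {s k a X Y} → Valid s k (X ++ just a ∷ Y) → just a ∉ X
  valid-∉ {X = X} {Y} V p = unique-++ (fin X) (subst Unique (fin-++ X (just _ ∷ Y)) (valid-unique V)) (∈-fin X p)

  assemble-injective : ∀ {s k a z₁ z₂} → Valid s k (assemble a z₁) → Valid s k (assemble a z₂) → assemble a z₁ ≡ assemble a z₂ → z₁ ≡ z₂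
  assemble-injective {z₁ = X₁ , _} {X₂ , _} V₁ V₂ e = split-unique X₁ X₂ (valid-∉ V₁) (valid-∉ V₂) e

  move-valid : ∀ {s d a z o z′} → Valid s (suc a) (assemble a z) → Open d a z o → Fill s o z′ → Valid s (suc (suc a)) (assemble (suc a) z′)
  move-valid {s} {a = a} V O F = fill-valid (subst (Valid s (suc a)) (open-close O) V) F

  open-phase : ∀ {s d a z o} → Valid s (suc a) (assemble a z) → Open d a z o → phase true (proj₁ o) ≡ true
  open-phase {s} {a = a} {o = X , Y} V O = gap-is-peak X Y (zigzag (subst (Valid s (suc a)) (open-close O) V))

  move-injective : ∀ {s d a z₁ z₂ z′} → Valid s (suc a) (assemble a z₁) → Valid s (suc a) (assemble a z₂) →
    z′ ∈ moves s d a z₁ → z′ ∈ moves s d a z₂ → z₁ ≡ z₂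
  move-injective {s} {d} {a} {z₁} {z₂} V₁ V₂ p₁ p₂
    with o₁ , O₁ , F₁ ← ∈-moves⁻ s d a z₁ p₁ | o₂ , O₂ , F₂ ← ∈-moves⁻ s d a z₂ p₂
    with refl ← fill-injective (open-phase V₁ O₁) (open-phase V₂ O₂) F₁ F₂
    = assemble-injective V₁ V₂ (trans (open-close O₁) (sym (open-close O₂)))

  concatMap-unique : ∀ {A B : Set} (f : A → List B) {xs} → Unique xs → (∀ {x} → x ∈ xs → Unique (f x)) →
    (∀ {x y b} → x ∈ xs → y ∈ xs → b ∈ f x → b ∈ f y → x ≡ y) → Unique (concatMap f xs)
  concatMap-unique f {[]}     u v i = []
  concatMap-unique f {x ∷ xs} (h ∷ u) v i = UniqueP.++⁺ (v (here refl))
    (concatMap-unique f u (λ p → v (there p)) (λ p q → i (there p) (there q)))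
    (λ (p , q) → let (y , y∈ , b∈) = find (∈-concatMap⁻ f {xs = xs} q) in All.lookup h y∈ (i (here refl) (there y∈) p b∈))

  cons-injective : ∀ x {z₁ z₂} → cons x z₁ ≡ cons x z₂ → z₁ ≡ z₂
  cons-injective x refl = refl

  openings-unique : ∀ xs → Unique (openings xs)
  openings-unique []            = []
  openings-unique (∞ ∷ xs)      = AllP.map⁺ (All.universal (λ _ ()) (openings xs)) ∷ UniqueP.map⁺ (cons-injective ∞) (openings-unique xs)
  openings-unique (just v ∷ xs) = UniqueP.map⁺ (cons-injective (just v)) (openings-unique xs)

  open-unique : ∀ d a z → Unique (openAt d a z)
  open-unique rightward a (xs , ys) = UniqueP.map⁺ (λ e → cong₂ _,_ (ListP.∷-injectiveʳ (ListP.++-cancelˡ xs _ _ (cong proj₁ e))) (cong proj₂ e)) (openings-unique ys)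
  open-unique leftward a (xs , ys) = UniqueP.map⁺ (λ e → cong₂ _,_ (cong proj₁ e) (ListP.++-cancelʳ (just a ∷ ys) _ _ (cong proj₂ e))) (openings-unique xs)

  fill-unique : ∀ s o → Unique (fill s o)
  fill-unique s (X , Y) with fillable s (gaps X) (gaps Y)
  ... | true  = ((λ e → longer X (cong proj₁ e)) ∷ []) ∷ ([] ∷ [])
    where
    longer : ∀ (X : Str) {x} → X ≡ X ++ x ∷ [] → ⊥
    longer (x ∷ X) e = longer X (ListP.∷-injectiveʳ e)
  ... | false = [] ∷ []

  moves-unique : ∀ {s d a z} → Valid s (suc a) (assemble a z) → Unique (moves s d a z)
  moves-unique {s} {d} {a} {z} V = concatMap-unique (fill s) (open-unique d a z) (λ {o} _ → fill-unique s o)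
    (λ {o₁} {o₂} p₁ p₂ q₁ q₂ → fill-injective (open-phase V (∈-open⁻ d a z p₁)) (open-phase V (∈-open⁻ d a z p₂))
      (∈-fill⁻ s (proj₁ o₁) (proj₂ o₁) q₁) (∈-fill⁻ s (proj₁ o₂) (proj₂ o₂) q₂))

  ∈-words-zero : ∀ s d a z {x} → x ∈ words s d 0 a z → (x ≡ assemble a z) × (complete s (gaps (proj₁ z)) (gaps (proj₂ z)) ≡ true)
  ∈-words-zero s d a z p with complete s (gaps (proj₁ z)) (gaps (proj₂ z))
  ∈-words-zero s d a z (here refl) | true = refl , refl

  ∈-words-suc : ∀ s d m a z {x} → x ∈ words s d (suc m) a z → ∃ λ z′ → (z′ ∈ moves s (d a) a z) × (x ∈ words s d m (suc a) z′)
  ∈-words-suc s d m a z p = find (∈-concatMap⁻ (words s d m (suc a)) {xs = moves s (d a) a z} p)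

  moves-valid : ∀ {s d a z z′} → Valid s (suc a) (assemble a z) → z′ ∈ moves s d a z → Valid s (suc (suc a)) (assemble (suc a) z′)
  moves-valid {s} {d} {a} {z} V p with o , O , F ← ∈-moves⁻ s d a z p = move-valid V O F

  -- Going backwards, the finished word determines its last zip and then each zip before it, so
  -- different zips lead to disjoint lists of words.
  words-injective : ∀ s d m a {z₁ z₂ x} → Valid s (suc a) (assemble a z₁) → Valid s (suc a) (assemble a z₂) →
    x ∈ words s d m a z₁ → x ∈ words s d m a z₂ → z₁ ≡ z₂
  words-injective s d zero a {z₁} {z₂} V₁ V₂ p₁ p₂ = assemble-injective V₁ V₂ (trans (sym (proj₁ (∈-words-zero s d a z₁ p₁))) (proj₁ (∈-words-zero s d a z₂ p₂)))
  words-injective s d (suc m) a {z₁} {z₂} V₁ V₂ p₁ p₂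
    with z₁′ , q₁ , r₁ ← ∈-words-suc s d m a z₁ p₁ | z₂′ , q₂ , r₂ ← ∈-words-suc s d m a z₂ p₂
    with refl ← words-injective s d m (suc a) (moves-valid {d = d a} V₁ q₁) (moves-valid {d = d a} V₂ q₂) r₁ r₂
    = move-injective {d = d a} V₁ V₂ q₁ q₂

  words-unique : ∀ s d m a z → Valid s (suc a) (assemble a z) → Unique (words s d m a z)
  words-unique s d zero a z V with complete s (gaps (proj₁ z)) (gaps (proj₂ z))
  ... | true  = [] ∷ []
  ... | false = []
  words-unique s d (suc m) a z V = concatMap-unique (words s d m (suc a)) (moves-unique {d = d a} V)
    (λ {z′} p → words-unique s d m (suc a) z′ (moves-valid {d = d a} V p))
    (λ p₁ p₂ → words-injective s d m (suc a) (moves-valid {d = d a} V p₁) (moves-valid {d = d a} V p₂))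

  -- Directions of moves and the order of consecutive letters

  Order : Dir → ℕ → List ℕ → Set
  Order rightward  i l = i ∷ suc i ∷ [] ⊆ l
  Order leftward i l = suc i ∷ i ∷ [] ⊆ l

  fin-⊆ : ∀ {s d a z o z′} → Open d a z o → Fill s o z′ → fin (assemble a z) ⊆ fin (assemble (suc a) z′)
  fin-⊆ {a = a} {z = z} {o = X , Y} O F = ⊆-trans (⊆-reflexive (trans (cong fin (open-close O)) (fin-++ X (∞ ∷ Y))))
    (⊆-trans (SubP.++⁺ (⊆-refl {x = fin X}) (suc a ∷ʳ ⊆-refl)) (⊆-reflexive (sym (fin-fill F))))

  fin-order : ∀ {s d a z o z′} → Open d a z o → Fill s o z′ → Order d a (fin (assemble (suc a) z′))
  fin-order {a = a} O@(openR xs l r) F = ⊆-trans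
    (SubP.++⁺ (from∈ (∈-fin (xs ++ just a ∷ l) (∈-++⁺ʳ xs (here refl)))) (refl ∷ minimum (fin r)))
    (⊆-reflexive (sym (fin-fill F)))
  fin-order {a = a} O@(openL l r ys) F = ⊆-trans
    (SubP.++⁺ (minimum (fin l)) (refl ∷ from∈ (∈-fin (r ++ just a ∷ ys) (∈-++⁺ʳ r (here refl)))))
    (⊆-reflexive (sym (fin-fill F)))

  words-⊆ : ∀ s d m a z {x} → x ∈ words s d m a z → fin (assemble a z) ⊆ fin x
  words-⊆ s d zero    a z p = ⊆-reflexive (cong fin (sym (proj₁ (∈-words-zero s d a z p))))
  words-⊆ s d (suc m) a z p with z′ , q , r ← ∈-words-suc s d m a z p with o , O , F ← ∈-moves⁻ s (d a) a z q =
    ⊆-trans (fin-⊆ O F) (words-⊆ s d m (suc a) z′ r)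

  -- The move that places a letter fixes its side of the preceding one, and later insertions keep
  -- the earlier letters as a sublist.
  words-order : ∀ s d m a z {x} → x ∈ words s d m a z → ∀ i → i < m → Order (d (i ℕ.+ a)) (i ℕ.+ a) (fin x)
  words-order s d (suc m) a z {x} p i i<m with z′ , q , r ← ∈-words-suc s d m a z p with o , O , F ← ∈-moves⁻ s (d a) a z q = go i i<m
    where
    order-⊆ : ∀ d i {l l′} → l ⊆ l′ → Order d i l → Order d i l′
    order-⊆ rightward  i p q = ⊆-trans q p
    order-⊆ leftward i p q = ⊆-trans q p
    go : ∀ i → i < suc m → Order (d (i ℕ.+ a)) (i ℕ.+ a) (fin x)
    go zero    _         = order-⊆ (d a) a (words-⊆ s d m (suc a) z′ r) (fin-order O F)
    go (suc i) (s≤s i<m) = subst (λ j → Order (d j) j (fin x)) (ℕP.+-suc i a) (words-order s d m (suc a) z′ r i i<m)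

  words-valid : ∀ s d m a z {x} → Valid s (suc a) (assemble a z) → x ∈ words s d m a z → Valid s (suc (m ℕ.+ a)) x × (gaps x ≡ offset s 1)
  words-valid s d zero a z@(X , Y) V p with refl , c ← ∈-words-zero s d a z p = V , trans (gaps-++ X (just a ∷ Y)) (total s (gaps X) (gaps Y) c)
    where
    total : ∀ s p q → complete s p q ≡ true → p ℕ.+ q ≡ offset s 1
    total oddSys  1 1 _ = refl
    total evenSys 0 1 _ = refl
  words-valid s d (suc m) a z {x} V p with z′ , q , r ← ∈-words-suc s d m a z p =
    subst (λ n → Valid s (suc n) x × (gaps x ≡ offset s 1)) (ℕP.+-suc m a) (words-valid s d m (suc a) z′ (moves-valid {d = d a} V q) r)

  order-asym : ∀ {u v : ℕ} {l} → Unique l → u ∷ v ∷ [] ⊆ l → v ∷ u ∷ [] ⊆ l → ⊥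
  order-asym (h ∷ un) (_ ∷ʳ p)   (_ ∷ʳ q)   = order-asym un p q
  order-asym (h ∷ un) (refl ∷ p) (_ ∷ʳ q)   = All.lookup h (to∈ (⊆-trans (_ ∷ʳ ⊆-refl) q)) refl
  order-asym (h ∷ un) (_ ∷ʳ p)   (refl ∷ q) = All.lookup h (to∈ (⊆-trans (_ ∷ʳ ⊆-refl) p)) refl
  order-asym (h ∷ un) (refl ∷ p) (refl ∷ q) = All.lookup h (to∈ p) refl

  -- Every valid word is reached

  gaps-last : ∀ {v} Y → LastGap (just v ∷ Y) → ∃ λ q → gaps Y ≡ suc q
  gaps-last (∞ ∷ [])           h = 0 , refl
  gaps-last (∞ ∷ y ∷ Y)        h = gaps (y ∷ Y) , refl
  gaps-last (just v ∷ Y@(_ ∷ _)) h = gaps-last {v} Y h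

  gaps-first : ∀ s {v} X Y → FirstGap s (X ++ just v ∷ Y) → ∃ λ p → gaps X ≡ offset s p
  gaps-first evenSys X       Y h = gaps X , refl
  gaps-first oddSys  (∞ ∷ X) Y h = gaps X , refl

  fillable-true : ∀ s p q → fillable s (offset s p) (suc q) ≡ true
  fillable-true oddSys  p q = refl
  fillable-true evenSys p q = refl

  ≺∞ : ∀ {k} ys → All (λ y → y ≺ just k → y ≺ ∞) ys
  ≺∞ []            = []
  ≺∞ (∞ ∷ ys)      = (λ ()) ∷ ≺∞ ys
  ≺∞ (just v ∷ ys) = (λ _ → tt) ∷ ≺∞ ys

  large-letter : ∀ {s k w} x → Valid s (suc k) w → x ∈ w → just k ≺ x → x ≡ ∞
  large-letter ∞        V p q = refl
  large-letter (just v) V p q = ⊥-elim (ℕP.<⇒≱ q (ℕP.≤-pred (valid-bound V p)))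

  -- Raising the largest letter at a peak to a gap keeps the zigzag. The end gaps are still present
  -- beyond it, so the gap it leaves is one that may be filled.
  undo-peak : ∀ {s k} X Y → phase true X ≡ true → Valid s (suc k) (X ++ just k ∷ Y) → Valid s k (X ++ ∞ ∷ Y) × Fill s (X , Y) (X , Y)
  undo-peak {s} {k} X Y h V = valid
      (replace-peak true X Y h (≺∞ X) (≺∞ Y) (zigzag V))
      (PermP.drop-∷ (↭-trans (↭-prep k (↭-reflexive (fin-++ X (∞ ∷ Y)))) (↭-trans (↭-sym (PermP.shift k (fin X) (fin Y)))
        (↭-trans (↭-reflexive (sym (fin-++ X (just k ∷ Y)))) (letters V)))))
      (lastGap⁺ X ∞ Y (tail-gap Y last′))
      (head-gap s X (first V)) ,
    peak (fillable-gaps (gaps-first s X Y (first V)) (gaps-last {k} Y last′))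
    where
    last′ : LastGap (just k ∷ Y)
    last′ = lastGap⁻ X (just k) Y (last V)
    tail-gap : ∀ Y → LastGap (just k ∷ Y) → LastGap (∞ ∷ Y)
    tail-gap (y ∷ Y) h = h
    head-gap : ∀ s X → FirstGap s (X ++ just k ∷ Y) → FirstGap s (X ++ ∞ ∷ Y)
    head-gap evenSys X       h = tt
    head-gap oddSys  (∞ ∷ X) h = tt
    fillable-gaps : (∃ λ p → gaps X ≡ offset s p) → (∃ λ q → gaps Y ≡ suc q) → fillable s (gaps X) (gaps Y) ≡ true
    fillable-gaps (p , ep) (q , eq) rewrite ep | eq = fillable-true s p q

  -- The neighbours of a valley k exceed the largest letter, hence are gaps; merging `∞ k ∞` into
  -- one gap undoes the move.
  undo-valley : ∀ {s k} X x Y → phase true (X ++ x ∷ []) ≡ false → Valid s (suc k) ((X ++ x ∷ []) ++ just k ∷ Y) →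
    ∃ λ o → Valid s k (close o) × Fill s o (X ++ x ∷ [] , Y)
  undo-valley {s} {k} X x [] h V with () ← lastGap⁻ (X ++ x ∷ []) (just k) [] (last V)
  undo-valley {s} {k} X x (y ∷ Y) h V = result (large-letter x V (∈-++⁺ˡ (∈-++⁺ʳ X (here refl))) (proj₁ neighbours))
      (large-letter y V (∈-++⁺ʳ (X ++ x ∷ []) (there (here refl))) (proj₂ neighbours)) V
    where
    not-false : ∀ {b} → not b ≡ false → b ≡ true
    not-false {true} _ = refl
    peak-X : phase true X ≡ true
    peak-X = not-false (trans (sym (phase-∷ʳ true X x)) h)
    neighbours : (just k ≺ x) × (just k ≺ y)
    neighbours = valley-neighbours true X x y Y peak-X (subst (Zigzag true) (ListP.++-assoc X (x ∷ []) (just k ∷ y ∷ Y)) (zigzag V))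
    first′ : ∀ s X → FirstGap s ((X ++ ∞ ∷ []) ++ just k ∷ ∞ ∷ Y) → FirstGap s (X ++ ∞ ∷ Y)
    first′ evenSys X       h = tt
    first′ oddSys  []      h = tt
    first′ oddSys  (∞ ∷ X) h = tt
    result : ∀ {x y} → x ≡ ∞ → y ≡ ∞ → Valid s (suc k) ((X ++ x ∷ []) ++ just k ∷ y ∷ Y) → ∃ λ o → Valid s k (close o) × Fill s o (X ++ x ∷ [] , y ∷ Y)
    result refl refl V = (X , Y) , valid
      (delete-valley k true X Y peak-X (subst (Zigzag true) assoc (zigzag V)))
      (PermP.drop-∷ (↭-trans (↭-prep k (↭-reflexive (fin-++ X (∞ ∷ Y)))) (↭-trans (↭-sym (PermP.shift k (fin X) (fin Y)))
        (↭-trans (↭-reflexive (sym (trans (cong fin assoc) (fin-++ X (∞ ∷ just k ∷ ∞ ∷ Y))))) (letters V)))))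
      (lastGap⁺ X ∞ Y (lastGap⁻ (X ++ ∞ ∷ []) (just k) (∞ ∷ Y) (last V)))
      (first′ s X (first V)) , valley
      where
      assoc : (X ++ ∞ ∷ []) ++ just k ∷ ∞ ∷ Y ≡ X ++ ∞ ∷ just k ∷ ∞ ∷ Y
      assoc = ListP.++-assoc X (∞ ∷ []) (just k ∷ ∞ ∷ Y)

  undo : ∀ {s k} X Y → Valid s (suc k) (X ++ just k ∷ Y) → ∃ λ o → Valid s k (close o) × Fill s o (X , Y)
  undo X Y V with phase true X in eq
  ... | true = (X , Y) , undo-peak X Y eq V
  ... | false with initLast X
  ...   | X′ ∷ʳ′ x = undo-valley X′ x Y eq V
  ...   | [] with () ← eq

  first-valid : ∀ {s} o → Valid s 0 (close o) → o ≡ ([] , [])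
  first-valid (X , Y) V = split X Y (only-gap (X ++ ∞ ∷ Y) (PermP.↭-empty-inv (letters V)) (zigzag V) (last V))
    where
    only-gap : ∀ w → fin w ≡ [] → Zigzag true w → LastGap w → w ≡ ∞ ∷ []
    only-gap (∞ ∷ [])           _ _ _        = refl
    only-gap (∞ ∷ ∞ ∷ _)        _ (() , _) _
    split : ∀ X Y → X ++ ∞ ∷ Y ≡ ∞ ∷ [] → (X , Y) ≡ ([] , [])
    split []           []      _  = refl
    split (_ ∷ [])     Y       ()
    split (_ ∷ _ ∷ _)  Y       ()

  start-valid : ∀ s → Valid s 1 (assemble 0 start)
  start-valid evenSys = valid (tt , tt , tt) ↭-refl refl tt
  start-valid oddSys  = valid (tt , tt , tt) ↭-refl refl tt

  start-unique : ∀ {s} z → Valid s 1 (assemble 0 z) → z ≡ start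
  start-unique {s} (X , Y) V with o , V₀ , F ← undo X Y V with refl ← first-valid o V₀ = helper s F
    where
    helper : ∀ s {z} → Fill s ([] , []) z → z ≡ start
    helper s valley = refl
    helper oddSys  (peak ())
    helper evenSys (peak ())

  -- Backward induction: `undo` takes away the largest letter, and `m` counts the letters already
  -- taken away. The move undone had the prescribed direction, because a move the other way would
  -- contradict the order of the two letters in `x`.
  words-complete : ∀ s d k m X Y {x} → Valid s (suc k) (X ++ just k ∷ Y) → x ∈ words s d m k (X , Y) → Unique (fin x) →
    (∀ i → i < k → Order (d i) i (fin x)) → x ∈ words s d (m ℕ.+ k) 0 start
  words-complete s d zero m X Y V p u h rewrite start-unique (X , Y) V | ℕP.+-identityʳ m = p
  words-complete s d (suc k) m X Y {x} V p u h with (X′ , Y′) , V′ , F ← undo X Y V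
    = result (∈-++⁻ (fin X′) (subst (k ∈_) (fin-++ X′ (∞ ∷ Y′)) (PermP.∈-resp-↭ (↭-sym (letters V′)) (here refl))))
    where
    continue : ∀ {z} → Open (d k) k z (X′ , Y′) → x ∈ words s d (m ℕ.+ suc k) 0 start
    continue {z} O = subst (λ n → x ∈ words s d n 0 start) (sym (ℕP.+-suc m k))
      (words-complete s d k (suc m) (proj₁ z) (proj₂ z) (subst (Valid s (suc k)) (sym (open-close O)) V′)
        (∈-concatMap⁺ (words s d m (suc k)) {xs = moves s (d k) k z} (lose (∈-moves⁺ s O F) p)) u (λ i i<k → h i (ℕP.m≤n⇒m≤1+n i<k)))
    wrong : ∀ {d′ z} → Open d′ k z (X′ , Y′) → Order d′ k (fin x)
    wrong {d′} O = order-⊆ d′ k (words-⊆ s d m (suc k) (X , Y) p) (fin-order O F)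
      where
      order-⊆ : ∀ d i {l l′} → l ⊆ l′ → Order d i l → Order d i l′
      order-⊆ rightward  i p q = ⊆-trans q p
      order-⊆ leftward i p q = ⊆-trans q p
    agree : ∀ d₁ d₂ → Order d₁ k (fin x) → Order d₂ k (fin x) → d₁ ≡ d₂
    agree rightward  rightward  _ _ = refl
    agree leftward leftward _ _ = refl
    agree rightward  leftward p q = ⊥-elim (order-asym u p q)
    agree leftward rightward  p q = ⊥-elim (order-asym u p q)
    any-direction : ∀ {d′ z} → Open d′ k z (X′ , Y′) → x ∈ words s d (m ℕ.+ suc k) 0 start
    any-direction {d′} {z} O = continue (subst (λ d′ → Open d′ k z (X′ , Y′)) (agree d′ (d k) (wrong O) (h k ℕP.≤-refl)) O)
    result : (k ∈ fin X′) ⊎ (k ∈ fin Y′) → x ∈ words s d (m ℕ.+ suc k) 0 start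
    result (inj₁ k∈X) with l , r , refl ← ∈-fin-split X′ k∈X = any-direction (openR l r Y′)
    result (inj₂ k∈Y) with l , r , refl ← ∈-fin-split Y′ k∈Y = any-direction (openL X′ l r)

  -- Counting by bijections of lists without repetition

  ↭-from-set : ∀ {A : Set} {xs ys : List A} → Unique xs → Unique ys → (∀ {x} → x ∈ xs → x ∈ ys) → (∀ {x} → x ∈ ys → x ∈ xs) → xs ↭ ys
  ↭-from-set u v p q = ∼bag⇒↭ (unique∧set⇒bag u v (mk⇔ p q))

  length-bijection : ∀ {A B : Set} {xs : List A} {ys : List B} (φ : A → B) → (∀ {x y} → φ x ≡ φ y → x ≡ y) → Unique xs → Unique ys →
    (∀ {x} → x ∈ xs → φ x ∈ ys) → (∀ {y} → y ∈ ys → ∃ λ x → (x ∈ xs) × (y ≡ φ x)) → length xs ≡ length ys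
  length-bijection {xs = xs} {ys} φ inj u v p q = trans (sym (ListP.length-map φ xs)) (PermP.↭-length (↭-from-set (UniqueP.map⁺ inj u) v into onto))
    where
    into : ∀ {y} → y ∈ map φ xs → y ∈ ys
    into h with x , x∈ , refl ← ∈-map⁻ φ h = p x∈
    onto : ∀ {y} → y ∈ ys → y ∈ map φ xs
    onto h with x , x∈ , refl ← q h = ∈-map⁺ φ x∈

  ∈-allWords : ∀ {m n} (w : Vec (Fin n) m) → w ∈ allWords m n
  ∈-allWords []      = here refl
  ∈-allWords {suc m} {n} (i ∷ w) = ∈-concatMap⁺ (λ i → map (i ∷_) (allWords m n)) {xs = allFin n} (lose (∈-allFin i) (∈-map⁺ (i ∷_) (∈-allWords w)))

  allWords-unique : ∀ m n → Unique (allWords m n)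
  allWords-unique zero    n = [] ∷ []
  allWords-unique (suc m) n = concatMap-unique (λ i → map (i ∷_) (allWords m n)) (UniqueP.allFin⁺ n)
    (λ _ → UniqueP.map⁺ VecP.∷-injectiveʳ (allWords-unique m n)) same-head
    where
    same-head : ∀ {i j w} → i ∈ allFin n → j ∈ allFin n → w ∈ map (i ∷_) (allWords m n) → w ∈ map (j ∷_) (allWords m n) → i ≡ j
    same-head {i} {j} _ _ p q with _ , _ , refl ← ∈-map⁻ (i ∷_) p with _ , _ , e ← ∈-map⁻ (j ∷_) q = VecP.∷-injectiveˡ e

  -- Alternation in terms of positions

  Precedes : Dir → ℕ → ℕ → Set
  Precedes rightward  x y = x < y
  Precedes leftward x y = y < x

  alternating-flip : ∀ d a → alternating (flip d) a ≡ flip (alternating d a)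
  alternating-flip d zero    = refl
  alternating-flip d (suc a) = cong flip (alternating-flip d a)

  letterList : ∀ {N m} → Vec (Fin N) m → List ℕ
  letterList v = map toℕ (Vec.toList v)

  -- Comparing adjacent positions one pair at a time suits reversal, complement and inversion, which
  -- the recursion on lists does not.
  Alternates : Dir → ∀ {N m} → Vec (Fin N) m → Set
  Alternates d {m = m} v = ∀ (i j : Fin m) → toℕ j ≡ suc (toℕ i) → Precedes (alternating d (toℕ i)) (toℕ (lookup v i)) (toℕ (lookup v j))

  AltDir : Dir → List ℕ → Set
  AltDir rightward  = RevAlt
  AltDir leftward = Alt

  altDir-∷∷ : ∀ d {x y l} → AltDir d (x ∷ y ∷ l) → Precedes d x y × AltDir (flip d) (y ∷ l)
  altDir-∷∷ rightward  h = h
  altDir-∷∷ leftward h = h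

  altDir-∷∷⁺ : ∀ d {x y l} → Precedes d x y → AltDir (flip d) (y ∷ l) → AltDir d (x ∷ y ∷ l)
  altDir-∷∷⁺ rightward  p h = p , h
  altDir-∷∷⁺ leftward p h = p , h

  altDir-[] : ∀ d → AltDir d []
  altDir-[] rightward  = tt
  altDir-[] leftward = tt

  altDir-[x] : ∀ d x → AltDir d (x ∷ [])
  altDir-[x] rightward  x = tt
  altDir-[x] leftward x = tt

  altDir⇒alternates : ∀ d {N m} (v : Vec (Fin N) m) → AltDir d (letterList v) → Alternates d v
  altDir⇒alternates d (x ∷ y ∷ v) h zero    (suc zero) _ = proj₁ (altDir-∷∷ d h)
  altDir⇒alternates d (x ∷ y ∷ v) h (suc i) (suc j)    e = subst (λ d → Precedes d (toℕ (lookup (y ∷ v) i)) (toℕ (lookup (y ∷ v) j))) (alternating-flip d (toℕ i))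
    (altDir⇒alternates (flip d) (y ∷ v) (proj₂ (altDir-∷∷ d h)) i j (ℕP.suc-injective e))
  altDir⇒alternates d (x ∷ []) h zero zero ()
  altDir⇒alternates d (x ∷ y ∷ v) h zero zero ()
  altDir⇒alternates d (x ∷ y ∷ v) h zero (suc (suc j)) ()
  altDir⇒alternates d (x ∷ y ∷ v) h (suc i) zero ()

  alternates⇒altDir : ∀ d {N m} (v : Vec (Fin N) m) → Alternates d v → AltDir d (letterList v)
  alternates⇒altDir d []          h = altDir-[] d
  alternates⇒altDir d (x ∷ [])    h = altDir-[x] d (toℕ x)
  alternates⇒altDir d (x ∷ y ∷ v) h = altDir-∷∷⁺ d (h zero (suc zero) refl) (alternates⇒altDir (flip d) (y ∷ v)
    (λ i j e → subst (λ d → Precedes d (toℕ (lookup (y ∷ v) i)) (toℕ (lookup (y ∷ v) j))) (sym (alternating-flip d (toℕ i))) (h (suc i) (suc j) (cong suc e))))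

  -- Reversal and complement

  alternating-+ : ∀ d a b → alternating d (a ℕ.+ b) ≡ alternating (alternating d b) a
  alternating-+ d zero    b = refl
  alternating-+ d (suc a) b = cong flip (alternating-+ d a b)

  alternating-involutive : ∀ d a → alternating (alternating d a) a ≡ d
  alternating-involutive d zero    = refl
  alternating-involutive d (suc a) = trans (cong flip (alternating-flip (alternating d a) a)) (trans (flip-flip _) (alternating-involutive d a))

  alternating-double : ∀ d k → alternating d (double k) ≡ d
  alternating-double d zero    = refl
  alternating-double d (suc k) = trans (flip-flip _) (alternating-double d k)

  -- Length 2k + 1 has 2k comparisons, and reversal sends number b to number 2k - 1 - b, of the
  -- other direction. Read backwards it flips once more, so reversal preserves alternation.
  alternating-mirror : ∀ d k a b → a ℕ.+ suc b ≡ double k → alternating d a ≡ flip (alternating d b)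
  alternating-mirror d k a b e = sym (trans (sym (alternating-involutive (alternating d (suc b)) a))
    (cong (λ d → alternating d a) (trans (sym (alternating-+ d a (suc b))) (trans (cong (alternating d) e) (alternating-double d k)))))

  precedes-flip : ∀ d {x y} → Precedes d x y → Precedes (flip d) y x
  precedes-flip rightward  p = p
  precedes-flip leftward p = p

  opposite-< : ∀ {n} (x y : Fin n) → toℕ x < toℕ y → toℕ (opposite y) < toℕ (opposite x)
  opposite-< x y p rewrite FinP.opposite-prop x | FinP.opposite-prop y = ℕP.∸-monoʳ-< (s≤s p) (FinP.toℕ<n y)

  precedes-opposite : ∀ d {n} (x y : Fin n) → Precedes d (toℕ x) (toℕ y) → Precedes (flip d) (toℕ (opposite x)) (toℕ (opposite y))
  precedes-opposite rightward  x y p = opposite-< x y p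
  precedes-opposite leftward x y p = opposite-< y x p

  opposite-suc : ∀ {n} (i j : Fin n) → toℕ j ≡ suc (toℕ i) → toℕ (opposite i) ≡ suc (toℕ (opposite j))
  opposite-suc {n} i j e = begin
    toℕ (opposite i)              ≡⟨ FinP.opposite-prop i ⟩
    n ℕ.∸ suc (toℕ i)             ≡⟨ cong (n ℕ.∸_) (sym e) ⟩
    n ℕ.∸ toℕ j                   ≡⟨ pred-∸ (FinP.toℕ<n j) ⟩
    suc (n ℕ.∸ suc (toℕ j))       ≡⟨ cong suc (sym (FinP.opposite-prop j)) ⟩
    suc (toℕ (opposite j))        ∎
    where
    pred-∸ : ∀ {m n} → m < n → n ℕ.∸ m ≡ suc (n ℕ.∸ suc m)
    pred-∸ {zero}  {suc n} _       = refl
    pred-∸ {suc m} {suc n} (s≤s p) = pred-∸ p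

  reverseV complementV : ∀ {n} → Vec (Fin n) n → Vec (Fin n) n
  reverseV    w = tabulate (λ i → lookup w (opposite i))
  complementV w = tabulate (λ i → opposite (lookup w i))

  alternates-complement : ∀ d {n} (w : Vec (Fin n) n) → Alternates d w → Alternates (flip d) (complementV w)
  alternates-complement d w h i j e rewrite VecP.lookup∘tabulate (λ i → opposite (lookup w i)) i | VecP.lookup∘tabulate (λ i → opposite (lookup w i)) j | alternating-flip d (toℕ i) =
    precedes-opposite (alternating d (toℕ i)) (lookup w i) (lookup w j) (h i j e)

  alternates-reverse : ∀ d k (w : Vec (Fin (suc (double k))) (suc (double k))) → Alternates d w → Alternates d (reverseV w)
  alternates-reverse d k w h i j e rewrite VecP.lookup∘tabulate (λ i → lookup w (opposite i)) i | VecP.lookup∘tabulate (λ i → lookup w (opposite i)) j =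
    subst (λ d → Precedes d (toℕ (lookup w (opposite i))) (toℕ (lookup w (opposite j))))
      (trans (cong flip (alternating-mirror d k (toℕ (opposite j)) (toℕ i) sum≡)) (flip-flip _))
      (precedes-flip (alternating d (toℕ (opposite j))) (h (opposite j) (opposite i) (opposite-suc i j e)))
    where
    sum≡ : toℕ (opposite j) ℕ.+ suc (toℕ i) ≡ double k
    sum≡ = trans (cong₂ ℕ._+_ (FinP.opposite-prop j) (sym e)) (ℕP.m∸n+n≡m (ℕP.≤-pred (FinP.toℕ<n j)))

  lookup-ext : ∀ {A : Set} {n} {v w : Vec A n} → (∀ i → lookup v i ≡ lookup w i) → v ≡ w
  lookup-ext {v = v} {w} h = trans (sym (VecP.tabulate∘lookup v)) (trans (VecP.tabulate-cong h) (VecP.tabulate∘lookup w))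

  lookup-reverseV : ∀ {n} (w : Vec (Fin n) n) i → lookup (reverseV w) i ≡ lookup w (opposite i)
  lookup-reverseV w i = VecP.lookup∘tabulate (λ i → lookup w (opposite i)) i

  lookup-complementV : ∀ {n} (w : Vec (Fin n) n) i → lookup (complementV w) i ≡ opposite (lookup w i)
  lookup-complementV w i = VecP.lookup∘tabulate (λ i → opposite (lookup w i)) i

  reverseV-involutive : ∀ {n} (w : Vec (Fin n) n) → reverseV (reverseV w) ≡ w
  reverseV-involutive w = lookup-ext (λ i → trans (lookup-reverseV (reverseV w) i) (trans (lookup-reverseV w (opposite i)) (cong (lookup w) (FinP.opposite-involutive i))))

  complementV-involutive : ∀ {n} (w : Vec (Fin n) n) → complementV (complementV w) ≡ w
  complementV-involutive w = lookup-ext (λ i → trans (lookup-complementV (complementV w) i) (trans (cong opposite (lookup-complementV w i)) (FinP.opposite-involutive (lookup w i))))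

  -- Reversal composes w with `opposite` before it, so the inverse is composed with `opposite` after
  -- it.
  inverse-reverse : ∀ {n} (w u : Vec (Fin n) n) → IsInverse w u → IsInverse (reverseV w) (complementV u)
  inverse-reverse w u (p , q) =
    (λ i → trans (lookup-complementV u _) (trans (cong (λ j → opposite (lookup u j)) (lookup-reverseV w i)) (trans (cong opposite (p (opposite i))) (FinP.opposite-involutive i)))) ,
    (λ i → trans (lookup-reverseV w _) (trans (cong (λ j → lookup w (opposite j)) (lookup-complementV u i)) (trans (cong (lookup w) (FinP.opposite-involutive (lookup u i))) (q i))))

  inverse-sym : ∀ {n} {w u : Vec (Fin n) n} → IsInverse w u → IsInverse u w
  inverse-sym (p , q) = q , p

  Both : Dir → Dir → ∀ {n} → Vec (Fin n) n → Set
  Both d e w = ∃ λ u → IsInverse w u × (Alternates d w × Alternates e u)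

  both-reverse : ∀ d e k (w : Vec (Fin (suc (double k))) (suc (double k))) → Both d e w → Both d (flip e) (reverseV w)
  both-reverse d e k w (u , inv , a , b) = complementV u , inverse-reverse w u inv , alternates-reverse d k w a , alternates-complement e u b

  both-complement : ∀ d e k (w : Vec (Fin (suc (double k))) (suc (double k))) → Both d e w → Both (flip d) e (complementV w)
  both-complement d e k w (u , inv , a , b) = reverseV u , inverse-sym {w = reverseV u} {complementV w} (inverse-reverse u w (inverse-sym {w = w} {u} inv)) ,
    alternates-complement d w a , alternates-reverse e k u b

  -- Permutations as lists

  lookup-∈ : ∀ {N m} (v : Vec (Fin N) m) i → toℕ (lookup v i) ∈ letterList v
  lookup-∈ (x ∷ v) zero    = here refl
  lookup-∈ (x ∷ v) (suc i) = there (lookup-∈ v i)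

  ∈-lookup : ∀ {N m} (v : Vec (Fin N) m) {x} → x ∈ letterList v → ∃ λ i → toℕ (lookup v i) ≡ x
  ∈-lookup (y ∷ v) (here refl) = zero , refl
  ∈-lookup (y ∷ v) (there p) with i , e ← ∈-lookup v p = suc i , e

  lookup-⊆ : ∀ {N m} (v : Vec (Fin N) m) i j → toℕ i < toℕ j → toℕ (lookup v i) ∷ toℕ (lookup v j) ∷ [] ⊆ letterList v
  lookup-⊆ (x ∷ v) zero    (suc j) p       = refl ∷ from∈ (lookup-∈ v j)
  lookup-⊆ (x ∷ v) (suc i) (suc j) (s≤s p) = toℕ x ∷ʳ lookup-⊆ v i j p

  injective⇒unique : ∀ {N m} (v : Vec (Fin N) m) → (∀ i j → lookup v i ≡ lookup v j → i ≡ j) → Unique (letterList v)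
  injective⇒unique []      h = []
  injective⇒unique (x ∷ v) h = All.tabulate (λ p e → absurd (∈-lookup v p) e) ∷ injective⇒unique v (λ i j e → FinP.suc-injective (h (suc i) (suc j) e))
    where
    absurd : ∀ {y} → (∃ λ i → toℕ (lookup v i) ≡ y) → toℕ x ≡ y → ⊥
    absurd (i , e) e′ with () ← h zero (suc i) (FinP.toℕ-injective (trans e′ (sym e)))

  unique⇒injective : ∀ {N m} (v : Vec (Fin N) m) → Unique (letterList v) → ∀ i j → lookup v i ≡ lookup v j → i ≡ j
  unique⇒injective (x ∷ v) (h ∷ u) zero    zero    e = refl
  unique⇒injective (x ∷ v) (h ∷ u) zero    (suc j) e = ⊥-elim (All.lookup h (lookup-∈ v j) (cong toℕ e))
  unique⇒injective (x ∷ v) (h ∷ u) (suc i) zero    e = ⊥-elim (All.lookup h (lookup-∈ v i) (cong toℕ (sym e)))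
  unique⇒injective (x ∷ v) (h ∷ u) (suc i) (suc j) e = cong suc (unique⇒injective v u i j e)

  inverse⇒unique : ∀ {n} (w u : Vec (Fin n) n) → IsInverse w u → Unique (word w)
  inverse⇒unique w u (p , _) = injective⇒unique w (λ i j e → trans (sym (p i)) (trans (cong (lookup u) e) (p j)))

  inverse⇒↭ : ∀ {n} (w u : Vec (Fin n) n) → IsInverse w u → word w ↭ downFrom n
  inverse⇒↭ {n} w u inv@(_ , q) = ↭-from-set (inverse⇒unique w u inv) (UniqueP.downFrom⁺ n) small all-in
    where
    small : ∀ {x} → x ∈ word w → x ∈ downFrom n
    small h with i , refl ← ∈-lookup w h = ∈-downFrom⁺ (FinP.toℕ<n (lookup w i))
    all-in : ∀ {x} → x ∈ downFrom n → x ∈ word w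
    all-in {x} h = subst (_∈ word w) (trans (cong toℕ (q (fromℕ< x<n))) (FinP.toℕ-fromℕ< x<n)) (lookup-∈ w (lookup u (fromℕ< x<n)))
      where
      x<n : x < n
      x<n = ∈-downFrom⁻ h

  fromList : ∀ n {m} (l : List ℕ) → length l ≡ m → All (_< n) l → ∃ λ (v : Vec (Fin n) m) → letterList v ≡ l
  fromList n []      refl []       = [] , refl
  fromList n (x ∷ l) refl (p ∷ ps) with v , e ← fromList n l refl ps = fromℕ< p ∷ v , cong₂ _∷_ (FinP.toℕ-fromℕ< p) e

  ↭⇒inverse : ∀ n l → l ↭ downFrom n → ∃₂ λ w u → (word {n} w ≡ l) × IsInverse w u
  ↭⇒inverse n l p with w , refl ← fromList n l (trans (PermP.↭-length p) (ListP.length-downFrom n)) (All.tabulate (λ h → ∈-downFrom⁻ (PermP.∈-resp-↭ p h)))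
    = w , u , refl , (λ i → unique⇒injective w unique (lookup u (lookup w i)) i (w∘u (lookup w i))) , w∘u
    where
    unique : Unique (word w)
    unique = Unique-resp-↭ (↭-sym p) (UniqueP.downFrom⁺ n)
    position : ∀ (i : Fin n) → ∃ λ j → toℕ (lookup w j) ≡ toℕ i
    position i = ∈-lookup w (PermP.∈-resp-↭ (↭-sym p) (∈-downFrom⁺ (FinP.toℕ<n i)))
    u : Vec (Fin n) n
    u = tabulate (λ i → proj₁ (position i))
    w∘u : ∀ i → lookup w (lookup u i) ≡ i
    w∘u i = FinP.toℕ-injective (trans (cong (λ j → toℕ (lookup w j)) (VecP.lookup∘tabulate (λ i → proj₁ (position i)) i)) (proj₂ (position i)))

  module _ {n} (w u : Vec (Fin n) n) (inv : IsInverse w u) where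

    ordered : ∀ (a b : Fin n) → toℕ (lookup u a) < toℕ (lookup u b) → toℕ a ∷ toℕ b ∷ [] ⊆ word w
    ordered a b h = subst₂ (λ x y → toℕ x ∷ toℕ y ∷ [] ⊆ word w) (proj₂ inv a) (proj₂ inv b) (lookup-⊆ w (lookup u a) (lookup u b) h)

    ordered⁻ : ∀ (a b : Fin n) → a ≢ b → toℕ a ∷ toℕ b ∷ [] ⊆ word w → toℕ (lookup u a) < toℕ (lookup u b)
    ordered⁻ a b a≢b h with ℕP.<-cmp (toℕ (lookup u a)) (toℕ (lookup u b))
    ... | tri< p _ _ = p
    ... | tri≈ _ e _ = ⊥-elim (a≢b (trans (sym (proj₂ inv a)) (trans (cong (lookup w) (FinP.toℕ-injective e)) (proj₂ inv b))))
    ... | tri> _ _ p = ⊥-elim (order-asym (inverse⇒unique w u inv) h (ordered b a p))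

    -- `lookup u a` is the position of the letter a in w, so comparing adjacent entries of u is
    -- comparing the places of consecutive letters of w.
    alternates⇒order : ∀ d → Alternates d u → ∀ i → suc i < n → Order (alternating d i) i (word w)
    alternates⇒order d h i p = go (alternating d i) (subst (λ x → Precedes (alternating d x) (toℕ (lookup u a)) (toℕ (lookup u b))) a≡ (h a b (trans b≡ (cong suc (sym a≡)))))
      where
      a b : Fin n
      a = fromℕ< (ℕP.<-trans (ℕP.n<1+n i) p)
      b = fromℕ< p
      a≡ : toℕ a ≡ i
      a≡ = FinP.toℕ-fromℕ< _
      b≡ : toℕ b ≡ suc i
      b≡ = FinP.toℕ-fromℕ< p
      go : ∀ d → Precedes d (toℕ (lookup u a)) (toℕ (lookup u b)) → Order d i (word w)
      go rightward  q = subst₂ (λ x y → x ∷ y ∷ [] ⊆ word w) a≡ b≡ (ordered a b q)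
      go leftward q = subst₂ (λ x y → y ∷ x ∷ [] ⊆ word w) a≡ b≡ (ordered b a q)

    order⇒alternates : ∀ d → (∀ i → suc i < n → Order (alternating d i) i (word w)) → Alternates d u
    order⇒alternates d h a b e = go (alternating d (toℕ a)) (h (toℕ a) (subst (_< n) e (FinP.toℕ<n b)))
      where
      a≢b : a ≢ b
      a≢b refl with () ← ℕP.1+n≢n (sym e)
      go : ∀ d → Order d (toℕ a) (word w) → Precedes d (toℕ (lookup u a)) (toℕ (lookup u b))
      go rightward  q = ordered⁻ a b a≢b (subst (λ y → toℕ a ∷ y ∷ [] ⊆ word w) (sym e) q)
      go leftward q = ordered⁻ b a (λ e → a≢b (sym e)) (subst (λ y → y ∷ toℕ a ∷ [] ⊆ word w) (sym e) q)

  -- Permutations as completed partial words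

  descent : System → Bool
  descent evenSys = true
  descent oddSys  = false

  wordDir : Bool → Dir
  wordDir true  = leftward
  wordDir false = rightward

  prefix : System → Str
  prefix evenSys = []
  prefix oddSys  = ∞ ∷ []

  -- The permanent end gaps are restored. In odd length they turn a reverse alternating word into a
  -- zigzag that starts and ends with a peak.
  encode : System → List ℕ → Str
  encode s l = prefix s ++ map just l ++ ∞ ∷ []

  fin-map-just : ∀ l → fin (map just l ++ ∞ ∷ []) ≡ l
  fin-map-just []      = refl
  fin-map-just (x ∷ l) = cong (x ∷_) (fin-map-just l)

  fin-encode : ∀ s l → fin (encode s l) ≡ l
  fin-encode evenSys l = fin-map-just l
  fin-encode oddSys  l = fin-map-just l

  gaps-map-just : ∀ l → gaps (map just l ++ ∞ ∷ []) ≡ 1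
  gaps-map-just []      = refl
  gaps-map-just (x ∷ l) = gaps-map-just l

  gaps-encode : ∀ s l → gaps (encode s l) ≡ offset s 1
  gaps-encode evenSys l = gaps-map-just l
  gaps-encode oddSys  l = cong suc (gaps-map-just l)

  zigzag⇒altDir : ∀ b l → Zigzag b (map just l ++ ∞ ∷ []) → AltDir (wordDir b) l
  zigzag⇒altDir b     []          h       = altDir-[] (wordDir b)
  zigzag⇒altDir b     (x ∷ [])    h       = altDir-[x] (wordDir b) x
  zigzag⇒altDir true  (x ∷ y ∷ l) (c , h) = c , zigzag⇒altDir false (y ∷ l) h
  zigzag⇒altDir false (x ∷ y ∷ l) (c , h) = c , zigzag⇒altDir true (y ∷ l) h

  -- The hypothesis on `phase` fixes the parity of the length, so that the final gap falls on a
  -- peak.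
  altDir⇒zigzag : ∀ b l → phase b (map just l) ≡ true → AltDir (wordDir b) l → Zigzag b (map just l ++ ∞ ∷ [])
  altDir⇒zigzag b     []          p h       = tt
  altDir⇒zigzag true  (x ∷ [])    () h
  altDir⇒zigzag false (x ∷ [])    p h       = tt , tt
  altDir⇒zigzag true  (x ∷ y ∷ l) p (c , h) = c , altDir⇒zigzag false (y ∷ l) p h
  altDir⇒zigzag false (x ∷ y ∷ l) p (c , h) = c , altDir⇒zigzag true (y ∷ l) p h

  lastGap-shape : ∀ x → LastGap x → gaps x ≡ 1 → x ≡ map just (fin x) ++ ∞ ∷ []
  lastGap-shape (∞ ∷ [])          h e = refl
  lastGap-shape (∞ ∷ y ∷ ys)      h e with q , e′ ← gaps-last {0} (y ∷ ys) h with () ← trans (sym e′) (ℕP.suc-injective e)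
  lastGap-shape (just v ∷ y ∷ ys) h e = cong (just v ∷_) (lastGap-shape (y ∷ ys) h e)

  encode-fin : ∀ {s k} x → Valid s k x → gaps x ≡ offset s 1 → x ≡ encode s (fin x)
  encode-fin {evenSys} x            V e = lastGap-shape x (last V) e
  encode-fin {oddSys}  (∞ ∷ y ∷ ys) V e = cong (∞ ∷_) (lastGap-shape (y ∷ ys) (last V) (ℕP.suc-injective e))
  encode-fin {oddSys}  (∞ ∷ [])     V ()
  encode-fin {oddSys}  (just v ∷ x) V e with () ← first V

  encode-zigzag⁻ : ∀ s l → Zigzag true (encode s l) → AltDir (wordDir (descent s)) l
  encode-zigzag⁻ evenSys l       h       = zigzag⇒altDir true l h
  encode-zigzag⁻ oddSys  []      h       = tt
  encode-zigzag⁻ oddSys  (x ∷ l) (_ , h) = zigzag⇒altDir false (x ∷ l) h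

  encode-valid : ∀ s n l → l ↭ downFrom n → phase (descent s) (map just l) ≡ true → AltDir (wordDir (descent s)) l → Valid s n (encode s l)
  encode-valid s n l p h a = valid (zig s l h a) (↭-trans (↭-reflexive (fin-encode s l)) p) (lst s) (fst s)
    where
    zig : ∀ s l → phase (descent s) (map just l) ≡ true → AltDir (wordDir (descent s)) l → Zigzag true (encode s l)
    zig evenSys l       h a = altDir⇒zigzag true l h a
    zig oddSys  (x ∷ l) h a = tt , altDir⇒zigzag false (x ∷ l) h a
    lst : ∀ s → LastGap (encode s l)
    lst evenSys = lastGap⁺ (map just l) ∞ [] refl
    lst oddSys  = lastGap⁺ (∞ ∷ map just l) ∞ [] refl
    fst : ∀ s → FirstGap s (encode s l)
    fst evenSys = tt
    fst oddSys  = tt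

  encode∈words : ∀ s d m l → l ↭ downFrom (suc m) → phase (descent s) (map just l) ≡ true → AltDir (wordDir (descent s)) l →
    (∀ i → i < m → Order (alternating d i) i l) → encode s l ∈ allWordsOf s d m
  encode∈words s d m l p h a o
    with X , Y , e ← ∈-fin-split {m} (encode s l) (subst (m ∈_) (sym (fin-encode s l)) (PermP.∈-resp-↭ (↭-sym p) (here refl)))
    = words-complete s (alternating d) m 0 X Y V finished
        (subst Unique (sym (fin-encode s l)) (Unique-resp-↭ (↭-sym p) (UniqueP.downFrom⁺ (suc m))))
        (λ i i<m → subst (Order (alternating d i) i) (sym (fin-encode s l)) (o i i<m))
    where
    V : Valid s (suc m) (X ++ just m ∷ Y)
    V = subst (Valid s (suc m)) e (encode-valid s (suc m) l p h a)
    total : gaps X ℕ.+ gaps Y ≡ offset s 1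
    total = trans (sym (gaps-++ X (just m ∷ Y))) (trans (cong gaps (sym e)) (gaps-encode s l))
    completed : ∀ s p q → offset s p ℕ.+ suc q ≡ offset s 1 → complete s (offset s p) (suc q) ≡ true
    completed evenSys zero    zero    _ = refl
    completed oddSys  zero    zero    _ = refl
    completed evenSys (suc p) q       e with () ← ℕP.m+1+n≢0 p (ℕP.suc-injective e)
    completed oddSys  (suc p) q       e with () ← ℕP.m+1+n≢0 p (ℕP.suc-injective (ℕP.suc-injective e))
    done : complete s (gaps X) (gaps Y) ≡ true
    done with p , ep ← gaps-first s X Y (first V) | q , eq ← gaps-last {m} Y (lastGap⁻ X (just m) Y (last V)) =
      subst₂′ ep eq (completed s p q (trans (sym (cong₂ ℕ._+_ ep eq)) total))
      where
      subst₂′ : ∀ {p q} → gaps X ≡ p → gaps Y ≡ q → complete s p q ≡ true → complete s (gaps X) (gaps Y) ≡ true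
      subst₂′ refl refl h = h
    finished : encode s l ∈ words s (alternating d) 0 m (X , Y)
    finished rewrite done | e = here refl

  ∈words⇒encode : ∀ s d m {x} → x ∈ allWordsOf s d m → ∃ λ l → (x ≡ encode s l) × (l ↭ downFrom (suc m)) × AltDir (wordDir (descent s)) l ×
    (∀ i → i < m → Order (alternating d i) i l)
  ∈words⇒encode s d m {x} p with V , g ← words-valid s (alternating d) m 0 start (start-valid s) p =
    fin x , x≡ , subst (λ n → fin x ↭ downFrom (suc n)) (ℕP.+-identityʳ m) (letters V) ,
    encode-zigzag⁻ s (fin x) (subst (Zigzag true) x≡ (zigzag V)) ,
    (λ i i<m → subst (λ j → Order (alternating d j) j (fin x)) (ℕP.+-identityʳ i) (words-order s (alternating d) m 0 start p i i<m))
    where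
    x≡ = encode-fin x V g

  letterList-injective : ∀ {N m} (v w : Vec (Fin N) m) → letterList v ≡ letterList w → v ≡ w
  letterList-injective []      []      e = refl
  letterList-injective (x ∷ v) (y ∷ w) e = cong₂ _∷_ (FinP.toℕ-injective (ListP.∷-injectiveˡ e)) (letterList-injective v w (ListP.∷-injectiveʳ e))

  encode-word-injective : ∀ s {n} {v w : Vec (Fin n) n} → encode s (word v) ≡ encode s (word w) → v ≡ w
  encode-word-injective s {v = v} {w} e = letterList-injective v w (trans (sym (fin-encode s (word v))) (trans (cong fin e) (fin-encode s (word w))))

  -- `φ` carries the permutations to be counted to those that insertion builds: the identity in even
  -- length, the reverse complement in odd length.
  count-words : ∀ s d m → (∀ (w : Vec (Fin (suc m)) (suc m)) → phase (descent s) (map just (word w)) ≡ true) →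
    {P : Vec (Fin (suc m)) (suc m) → Set} (P? : Decidable P) (φ φ⁻¹ : Vec (Fin (suc m)) (suc m) → Vec (Fin (suc m)) (suc m)) →
    (∀ w → φ⁻¹ (φ w) ≡ w) → (∀ w → φ (φ⁻¹ w) ≡ w) →
    (∀ w → P w → Both (wordDir (descent s)) d (φ w)) → (∀ w → Both (wordDir (descent s)) d w → P (φ⁻¹ w)) →
    length (filter P? (allWords (suc m) (suc m))) ≡ length (allWordsOf s d m)
  count-words s d m even-length P? φ φ⁻¹ left-inv right-inv to from = length-bijection (λ w → encode s (word (φ w)))
    (λ {v} {w} e → trans (sym (left-inv v)) (trans (cong φ⁻¹ (encode-word-injective s e)) (left-inv w)))
    (UniqueP.filter⁺ P? (allWords-unique (suc m) (suc m)))
    (words-unique s (alternating d) m 0 start (start-valid s))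
    (λ {w} h → into (φ w) (to w (proj₂ (∈-filter⁻ P? {xs = allWords (suc m) (suc m)} h))))
    onto
    where
    into : ∀ w → Both (wordDir (descent s)) d w → encode s (word w) ∈ allWordsOf s d m
    into w (u , inv , a , b) = encode∈words s d m (word w) (inverse⇒↭ w u inv) (even-length w) (alternates⇒altDir (wordDir (descent s)) w a)
      (λ i i<m → alternates⇒order w u inv d b i (s≤s i<m))
    onto : ∀ {x} → x ∈ allWordsOf s d m → ∃ λ w → (w ∈ filter P? (allWords (suc m) (suc m))) × (x ≡ encode s (word (φ w)))
    onto h with l , refl , p , a , o ← ∈words⇒encode s d m h with w , u , refl , inv ← ↭⇒inverse (suc m) l p =
      φ⁻¹ w , ∈-filter⁺ P? (∈-allWords (φ⁻¹ w)) (from w (u , inv , altDir⇒alternates (wordDir (descent s)) w a , order⇒alternates w u inv d (λ i i<m → o i (ℕP.≤-pred i<m)))) ,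
      cong (λ v → encode s (word v)) (sym (right-inv w))

  AnyBoth : Dir → Dir → ∀ {n} → Vec (Fin n) n → Set
  AnyBoth d e {n} w = Any (λ u → IsInverse w u × (AltDir d (word w) × AltDir e (word u))) (allWords n n)

  any⇒both : ∀ d e {n} (w : Vec (Fin n) n) → AnyBoth d e w → Both d e w
  any⇒both d e w p with u , _ , inv , a , b ← find p = u , inv , altDir⇒alternates d w a , altDir⇒alternates e u b

  both⇒any : ∀ d e {n} (w : Vec (Fin n) n) → Both d e w → AnyBoth d e w
  both⇒any d e w (u , inv , a , b) = lose (∈-allWords u) (inv , alternates⇒altDir d w a , alternates⇒altDir e u b)

  phase-double : ∀ b k (l : List ℕ) → length l ≡ double k → phase b (map just l) ≡ b
  phase-double b zero    []          e = refl
  phase-double b (suc k) (x ∷ y ∷ l) e = trans (cong (λ c → phase c (map just l)) (not-not b)) (phase-double b k l (ℕP.suc-injective (ℕP.suc-injective e)))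
    where
    not-not : ∀ b → not (not b) ≡ b
    not-not true  = refl
    not-not false = refl

  phase-suc-double : ∀ b k (l : List ℕ) → length l ≡ suc (double k) → phase b (map just l) ≡ not b
  phase-suc-double b k (x ∷ l) e = phase-double (not b) k l (ℕP.suc-injective e)

  length-word : ∀ {n} (w : Vec (Fin n) n) → length (word w) ≡ n
  length-word w = helper w
    where
    helper : ∀ {N m} (v : Vec (Fin N) m) → length (letterList v) ≡ m
    helper []      = refl
    helper (x ∷ v) = cong suc (helper v)

  reverse-complement complement-reverse : ∀ {n} → Vec (Fin n) n → Vec (Fin n) n
  reverse-complement w = complementV (reverseV w)
  complement-reverse w = reverseV (complementV w)

  -- In odd length reversal keeps w alternating and complements its inverse; complementing then
  -- exchanges these roles. Both words become reverse alternating, with valleys at both ends.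
  f-odd : ∀ k → f (suc (double k)) ≡ length (allWordsOf oddSys rightward (double k))
  f-odd k = count-words oddSys rightward (double k) (λ w → phase-suc-double false k (word w) (length-word w)) _ reverse-complement complement-reverse
    (λ w → trans (cong reverseV (complementV-involutive (reverseV w))) (reverseV-involutive w))
    (λ w → trans (cong complementV (reverseV-involutive (complementV w))) (complementV-involutive w))
    (λ w p → both-complement leftward rightward k (reverseV w) (both-reverse leftward leftward k w (any⇒both leftward leftward w p)))
    (λ w b → both⇒any leftward leftward (reverseV (complementV w)) (both-reverse leftward rightward k (complementV w) (both-complement rightward rightward k w b)))

  -- Reversal alone suffices: w stays alternating, while its inverse is complemented and changes
  -- type.
  f*-odd : ∀ k → f* (suc (double k)) ≡ f (suc (double k))
  f*-odd k = length-bijection reverseV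
    (λ {v} {w} e → trans (sym (reverseV-involutive v)) (trans (cong reverseV e) (reverseV-involutive w)))
    (UniqueP.filter⁺ _ (allWords-unique n n)) (UniqueP.filter⁺ _ (allWords-unique n n))
    (λ {w} h → ∈-filter⁺ _ (∈-allWords (reverseV w)) (both⇒any leftward leftward (reverseV w) (both-reverse leftward rightward k w (any⇒both leftward rightward w (proj₂ (∈-filter⁻ _ {xs = allWords n n} h))))))
    (λ {w} h → reverseV w , ∈-filter⁺ _ (∈-allWords (reverseV w)) (both⇒any leftward rightward (reverseV w) (both-reverse leftward leftward k w (any⇒both leftward leftward w (proj₂ (∈-filter⁻ _ {xs = allWords n n} h))))) ,
      sym (reverseV-involutive w))
    where
    n = suc (double k)

  f-even : ∀ k → f (double (suc k)) ≡ length (allWordsOf evenSys leftward (suc (double k)))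
  f-even k = count-words evenSys leftward (suc (double k)) (λ w → phase-double true (suc k) (word w) (length-word w)) _ (λ w → w) (λ w → w)
    (λ _ → refl) (λ _ → refl) (any⇒both leftward leftward) (both⇒any leftward leftward)

  f*-even : ∀ k → f* (double (suc k)) ≡ length (allWordsOf evenSys rightward (suc (double k)))
  f*-even k = count-words evenSys rightward (suc (double k)) (λ w → phase-double true (suc k) (word w) (length-word w)) _ (λ w → w) (λ w → w)
    (λ _ → refl) (λ _ → refl) (any⇒both leftward rightward) (both⇒any leftward rightward)

  -- Return to natural numbers and integers

  ν-f-odd : ∀ k → ν (f (suc (double k))) ≡ OddRight.oddChain (target oddSys) k 0
  ν-f-odd k = trans (cong ν (f-odd k)) (length-odd k)

  ν-f-even : ∀ k → ν (f (double k)) ≡ EvenLeft.evenChain (target evenSys) k 0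
  ν-f-even zero    = refl
  ν-f-even (suc k) = trans (cong ν (f-even k)) (length-even-left k)

  ν-f*-even : ∀ k → ν (f* (double (suc k))) ≡ EvenRight.evenChain (target evenSys) (suc k) 0
  ν-f*-even k = trans (cong ν (f*-even k)) (length-even-right k)

  ν-suc≢0ℚ : ∀ n → ν (suc n) ≡ 0ℚ → ⊥
  ν-suc≢0ℚ n e = 1≢0 (ν-cancel n {1ℚ} {0ℚ} (trans (ℚP.*-identityʳ (ν (suc n))) (trans e (sym (ℚP.*-zeroʳ (ν (suc n)))))))
    where
    1≢0 : 1ℚ ≡ 0ℚ → ⊥
    1≢0 ()

  ν-injective : ∀ m n → ν m ≡ ν n → m ≡ n
  ν-injective zero    zero    e = refl
  ν-injective zero    (suc n) e = ⊥-elim (ν-suc≢0ℚ n (sym e))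
  ν-injective (suc m) zero    e = ⊥-elim (ν-suc≢0ℚ m e)
  ν-injective (suc m) (suc n) e = cong suc (ν-injective m n (trans (lemma (ν m)) (trans (cong (λ x → x ℚ.- 1ℚ) e) (sym (lemma (ν n))))))
    where
    lemma : ∀ x → x ≡ (1ℚ ℚ.+ x) ℚ.- 1ℚ
    lemma = solve-∀ ℚ-ring

  difference-ν : ∀ a b c {x y} → ν a ≡ x ℚ.- y → ν b ≡ y → ν c ≡ x → ℤ.+ a ≡ ℤ.+ c ℤ.- ℤ.+ b
  difference-ν a b c {x} {y} p q r = begin
    ℤ.+ a                               ≡⟨ sym (ℤP.+-identityʳ (ℤ.+ a)) ⟩
    ℤ.+ a ℤ.+ ℤ.+ 0                     ≡⟨ cong (ℤ._+_ (ℤ.+ a)) (sym (ℤP.+-inverseʳ (ℤ.+ b))) ⟩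
    ℤ.+ a ℤ.+ (ℤ.+ b ℤ.- ℤ.+ b)         ≡⟨ sym (ℤP.+-assoc (ℤ.+ a) (ℤ.+ b) (ℤ.- ℤ.+ b)) ⟩
    ℤ.+ (a ℕ.+ b) ℤ.- ℤ.+ b             ≡⟨ cong (λ n → ℤ.+ n ℤ.- ℤ.+ b) (ν-injective (a ℕ.+ b) c ν-sum) ⟩
    ℤ.+ c ℤ.- ℤ.+ b                     ∎
    where
    lemma : ∀ x y → (x ℚ.- y) ℚ.+ y ≡ x
    lemma = solve-∀ ℚ-ring
    ν-sum : ν (a ℕ.+ b) ≡ ν c
    ν-sum = trans (ν-+ a b) (trans (cong₂ ℚ._+_ p q) (trans (lemma x y) (sym r)))

  -- Even right chains are differences of even left chains, and injectivity of `ν` carries this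
  -- identity from ℚ to ℤ.
  f*-double : ∀ k → ℤ.+ f* (double (suc k)) ≡ ℤ.+ f (double (suc k)) ℤ.- ℤ.+ f (double k)
  f*-double k = difference-ν (f* (double (suc k))) (f (double k)) (f (double (suc k)))
    (trans (ν-f*-even k) (EvenRight-evenChain (target evenSys) (suc k) 0)) (ν-f-even k) (ν-f-even (suc k))

  odd-generating-function : oddSpread (λ k → fromℕ (f (2 ℕ.* k ℕ.+ 1))) ≋ oddSeries
  odd-generating-function = oddSpread≋oddSeries (λ k → fromℕ (f (2 ℕ.* k ℕ.+ 1)))
    (λ k → trans (fromℕ≡ν (f (2 ℕ.* k ℕ.+ 1))) (trans (cong (λ n → ν (f n)) (2*+1≡ k)) (ν-f-odd k)))

  f*[2k+1]≡f[2k+1] : ∀ k → f* (2 ℕ.* k ℕ.+ 1) ≡ f (2 ℕ.* k ℕ.+ 1)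
  f*[2k+1]≡f[2k+1] k = subst (λ n → f* n ≡ f n) (sym (2*+1≡ k)) (f*-odd k)

  even-generating-function : evenSpread (λ k → fromℕ (f (2 ℕ.* k))) ≋ invSqrt1-t² ⋆ evenSeries
  even-generating-function = evenSpread≋evenSeries (λ k → fromℕ (f (2 ℕ.* k)))
    (λ k → trans (fromℕ≡ν (f (2 ℕ.* k))) (trans (cong (λ n → ν (f n)) (sym (double≡2* k))) (ν-f-even k)))

  f*[2k+2]≡f[2k+2]-f[2k] : ∀ k → ℤ.+ f* (2 ℕ.* suc k) ≡ ℤ.+ f (2 ℕ.* suc k) ℤ.- ℤ.+ f (2 ℕ.* k)
  f*[2k+2]≡f[2k+2]-f[2k] k = subst₂ (λ m n → ℤ.+ f* m ≡ ℤ.+ f m ℤ.- ℤ.+ f n) (double≡2* (suc k)) (double≡2* k) (f*-double k)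

open import Data.Nat using (ℕ; suc; _*_; _+_)
open import Data.Integer using (+_; _-_)
open import Data.Rational using (ℚ) renaming (_*_ to _*ℚ_)
open import Data.Product using (_×_; _,_)
open import Relation.Binary.PropositionalEquality using (_≡_)

theorem3p1 : (oddSpread (λ k → fromℕ (f (2 * k + 1)))
    ≋ Σseries (λ r → scale ((E (2 * r + 1) *ℚ E (2 * r + 1)) *ℚ invFact (2 * r + 1)) (L ^ˢ (2 * r + 1))))
    × ((k : ℕ) → f* (2 * k + 1) ≡ f (2 * k + 1))
    × (evenSpread (λ k → fromℕ (f (2 * k)))
    ≋ invSqrt1-t² ⋆ Σseries (λ r → scale ((E (2 * r) *ℚ E (2 * r)) *ℚ invFact (2 * r)) (L ^ˢ (2 * r))))
    × ((k : ℕ) → + f* (2 * suc k) ≡ + f (2 * suc k) - + f (2 * k))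
theorem3p1 =
  Permutations.odd-generating-function ,
  Permutations.f*[2k+1]≡f[2k+1] ,
  Permutations.even-generating-function ,
  Permutations.f*[2k+2]≡f[2k+2]-f[2k]
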